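{- Let $q$ be an odd prime power and let $g\ge 1$ be an integer. For every monic irreducible polynomial $P\in\mathbb{F}_q[T]$ of degree $2g$, $$M_{q,g}(P)=\frac{1}{q-1},\qquad\text{where}\qquad M_{q,g}(P):=\frac{1}{\#\mathcal{H}_{2g+1}}\sum_{D\in\mathcal{H}_{2g+1}}\chi_D(P)\sqrt{|P|}.$$
   Context: $\mathcal{H}_n$ denotes the set of monic square-free polynomials of degree $n$ in $\mathbb{F}_q[T]$. For a nonzero polynomial $f$, $|f|=q^{\deg f}$. For a monic polynomial $D\in\mathbb{F}_q[T]$ of positive degree that is not a perfect square, $\chi_D(f)=\left(\frac{D}{f}\right)$ is the quadratic residue symbol in $\mathbb{F}_q[T]$; in particular, for $P$ monic irreducible, $\chi_D(P)$ is $0$ if $P\mid D$, $1$ if $D$ is a nonzero square modulo $P$, and $-1$ otherwise. -}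

module Defs where

open import Algebra.Apartness.Bundles using (HeytingField)
open import Algebra.Bundles using (CommutativeRing; Semiring)
import Algebra.Definitions.RawMagma as RawMagmaDefinitions
import Algebra.Definitions.RawSemiring as RawSemiringDefinitions
import Algebra.Properties.Ring as RingProperties
open import Algebra.Structures using (IsCommutativeRing)
open import Data.Bool.Base using (if_then_else_)
open import Data.Empty using (⊥-elim)
open import Data.Fin.Base using (Fin)
import Data.Fin.Properties as Fin
open import Data.Integer.Base as ℤ using (ℤ; +_; 0ℤ; 1ℤ; -1ℤ)
open import Data.List.Base
  using (List; []; _∷_; [_]; map; foldr; filter; length; tabulate; cartesianProductWith)
open import Data.Nat.Base as ℕ using (ℕ; zero; suc; z≤n; s≤s)
open import Data.Nat.Divisibility using () renaming (_∣_ to _∣ℕ_)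
import Data.Nat.Primality as ℕ
import Data.Nat.Properties as ℕ
open import Data.Product.Base using (∃; ∃-syntax; _×_; _,_; proj₁; proj₂)
open import Data.Rational.Base as ℚ using (ℚ; 0ℚ)
open import Data.Sum.Base using (inj₁; inj₂)
open import Function.Base using (_∘_)
open import Function.Bundles using (Inverse)
open import Level using (_⊔_) renaming (suc to lsuc)
open import Relation.Binary.PropositionalEquality as ≡ using (_≡_)
import Relation.Binary.Reasoning.Setoid as SetoidReasoning
open import Relation.Nullary using (¬_; Dec; yes; no; does)
open import Relation.Nullary.Decidable using (map′; ¬?; _×-dec_; decidable-stable)

OddPrimePower : ℕ → Set
OddPrimePower q =
  (∃[ p ] ∃[ k ] (ℕ.Prime p × 1 ℕ.≤ k × q ≡ p ℕ.^ k)) × ¬ (2 ∣ℕ q)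

-- Floor of the square root; exact on perfect squares (√-square below).
√_ : ℕ → ℕ
√ zero    = 0
√ (suc n) with suc (√ n) ℕ.* suc (√ n) ℕ.≤? suc n
... | yes _ = suc (√ n)
... | no  _ = √ n

√-lower : ∀ n → (√ n) ℕ.* (√ n) ℕ.≤ n
√-lower zero = z≤n
√-lower (suc n) with suc (√ n) ℕ.* suc (√ n) ℕ.≤? suc n
... | yes le = le
... | no  _  = ℕ.m≤n⇒m≤1+n (√-lower n)

√-upper : ∀ n → n ℕ.< suc (√ n) ℕ.* suc (√ n)
√-upper zero = s≤s z≤n
√-upper (suc n) with suc (√ n) ℕ.* suc (√ n) ℕ.≤? suc n
... | yes _  = ℕ.≤-<-trans (√-upper n)
                 (ℕ.*-mono-< (ℕ.n<1+n (suc (√ n))) (ℕ.n<1+n (suc (√ n))))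
... | no  gt = ℕ.≰⇒> gt

√-square : ∀ m → √ (m ℕ.* m) ≡ m
√-square m = ℕ.≤-antisym
  (ℕ.≮⇒≥ λ lt → ℕ.<⇒≱ (ℕ.*-mono-< lt lt) (√-lower (m ℕ.* m)))
  (ℕ.≮⇒≥ λ lt → ℕ.<⇒≱ (√-upper (m ℕ.* m)) (ℕ.*-mono-≤ lt lt))

-- Division totalised by i /₀ 0 = 0, so that a mean over a list needs no proof of
-- nonemptiness; a nonzero mean forces the list to be nonempty.
infixl 7 _/₀_
_/₀_ : ℤ → ℕ → ℚ
i /₀ zero  = 0ℚ
i /₀ suc n = i ℚ./ suc n

-- For a finite carrier the apartness relation carries no extra data: x # y
-- holds exactly when x - y is invertible, and by tightness exactly when x ≉ y.
record FiniteField c ℓ₁ ℓ₂ (q : ℕ) : Set (lsuc (c ⊔ ℓ₁ ⊔ ℓ₂)) where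
  field
    heytingField : HeytingField c ℓ₁ ℓ₂

  commutativeRing : CommutativeRing c ℓ₁
  commutativeRing = record { isCommutativeRing = HeytingField.isCommutativeRing heytingField }

  field
    enumeration : Inverse (CommutativeRing.setoid commutativeRing) (≡.setoid (Fin q))

module Polynomials {c ℓ} (R : CommutativeRing c ℓ) where

  open CommutativeRing R
  open SetoidReasoning setoid
  open RingProperties ring using (-0#≈0#)

  -- Coefficients in increasing degree; trailing zeros are allowed and
  -- disregarded by _≈ₚ_.
  Poly : Set c
  Poly = List Carrier

  coeff : Poly → ℕ → Carrier
  coeff []      _       = 0#
  coeff (a ∷ p) zero    = a
  coeff (a ∷ p) (suc i) = coeff p i

  infix 4 _≈ₚ_
  record _≈ₚ_ (p q : Poly) : Set ℓ where
    constructor mk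
    field at : ∀ i → coeff p i ≈ coeff q i
  open _≈ₚ_ public

  infixl 6 _+ₚ_
  infixl 7 _*ₚ_
  infix  8 -ₚ_

  0ₚ 1ₚ : Poly
  0ₚ = []
  1ₚ = [ 1# ]

  _+ₚ_ : Poly → Poly → Poly
  []      +ₚ q       = q
  (a ∷ p) +ₚ []      = a ∷ p
  (a ∷ p) +ₚ (b ∷ q) = (a + b) ∷ (p +ₚ q)

  -ₚ_ : Poly → Poly
  -ₚ_ = map (-_)

  _*ₚ_ : Poly → Poly → Poly
  []      *ₚ q = []
  (a ∷ p) *ₚ q = map (a *_) q +ₚ (0# ∷ (p *ₚ q))

  coeff-+ : ∀ p q i → coeff (p +ₚ q) i ≈ coeff p i + coeff q i
  coeff-+ []      q       i       = sym (+-identityˡ _)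
  coeff-+ (a ∷ p) []      i       = sym (+-identityʳ _)
  coeff-+ (a ∷ p) (b ∷ q) zero    = refl
  coeff-+ (a ∷ p) (b ∷ q) (suc i) = coeff-+ p q i

  coeff-neg : ∀ p i → coeff (-ₚ p) i ≈ - coeff p i
  coeff-neg []      i       = sym -0#≈0#
  coeff-neg (a ∷ p) zero    = refl
  coeff-neg (a ∷ p) (suc i) = coeff-neg p i

  coeff-scale : ∀ a p i → coeff (map (a *_) p) i ≈ a * coeff p i
  coeff-scale a []      i       = sym (zeroʳ a)
  coeff-scale a (b ∷ p) zero    = refl
  coeff-scale a (b ∷ p) (suc i) = coeff-scale a p i

  -- conv f g i = Σ_{j + k = i} f j * g k
  conv : (f g : ℕ → Carrier) → ℕ → Carrier
  conv f g zero    = f 0 * g 0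
  conv f g (suc i) = f 0 * g (suc i) + conv (f ∘ suc) g i

  conv-cong : ∀ {f f′ g g′} → (∀ i → f i ≈ f′ i) → (∀ i → g i ≈ g′ i) →
              ∀ i → conv f g i ≈ conv f′ g′ i
  conv-cong f≈ g≈ zero    = *-cong (f≈ 0) (g≈ 0)
  conv-cong f≈ g≈ (suc i) =
    +-cong (*-cong (f≈ 0) (g≈ (suc i))) (conv-cong (f≈ ∘ suc) g≈ i)

  conv-zeroˡ : ∀ {f} g → (∀ i → f i ≈ 0#) → ∀ i → conv f g i ≈ 0#
  conv-zeroˡ g f≈0 zero    = trans (*-congʳ (f≈0 0)) (zeroˡ _)
  conv-zeroˡ g f≈0 (suc i) = trans
    (+-cong (trans (*-congʳ (f≈0 0)) (zeroˡ _)) (conv-zeroˡ g (f≈0 ∘ suc) i))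
    (+-identityˡ 0#)

  coeff-* : ∀ p q i → coeff (p *ₚ q) i ≈ conv (coeff p) (coeff q) i
  coeff-* []      q i = sym (conv-zeroˡ (coeff q) (λ _ → refl) i)
  coeff-* (a ∷ p) q zero = begin
    coeff (map (a *_) q +ₚ (0# ∷ p *ₚ q)) 0 ≈⟨ coeff-+ (map (a *_) q) _ 0 ⟩
    coeff (map (a *_) q) 0 + 0#             ≈⟨ +-identityʳ _ ⟩
    coeff (map (a *_) q) 0                  ≈⟨ coeff-scale a q 0 ⟩
    a * coeff q 0                           ∎
  coeff-* (a ∷ p) q (suc i) = trans (coeff-+ (map (a *_) q) _ (suc i))
    (+-cong (coeff-scale a q (suc i)) (coeff-* p q i))

  private
    interchange : ∀ w x y z → (w + x) + (y + z) ≈ (w + y) + (x + z)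
    interchange w x y z = begin
      (w + x) + (y + z) ≈⟨ +-assoc w x _ ⟩
      w + (x + (y + z)) ≈⟨ +-congˡ (sym (+-assoc x y z)) ⟩
      w + ((x + y) + z) ≈⟨ +-congˡ (+-congʳ (+-comm x y)) ⟩
      w + ((y + x) + z) ≈⟨ +-congˡ (+-assoc y x z) ⟩
      w + (y + (x + z)) ≈⟨ sym (+-assoc w y _) ⟩
      (w + y) + (x + z) ∎

  conv-distribʳ : ∀ f f′ g i → conv (λ j → f j + f′ j) g i ≈ conv f g i + conv f′ g i
  conv-distribʳ f f′ g zero    = distribʳ _ _ _
  conv-distribʳ f f′ g (suc i) = trans
    (+-cong (distribʳ _ _ _) (conv-distribʳ (f ∘ suc) (f′ ∘ suc) g i))
    (interchange _ _ _ _)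

  conv-scale : ∀ a f g i → conv (λ j → a * f j) g i ≈ a * conv f g i
  conv-scale a f g zero    = *-assoc _ _ _
  conv-scale a f g (suc i) = trans
    (+-cong (*-assoc _ _ _) (conv-scale a (f ∘ suc) g i)) (sym (distribˡ _ _ _))

  conv-last : ∀ f g i → conv f g (suc i) ≈ conv f (g ∘ suc) i + f (suc i) * g 0
  conv-last f g zero    = refl
  conv-last f g (suc i) = trans (+-congˡ (conv-last (f ∘ suc) g i)) (sym (+-assoc _ _ _))

  conv-comm : ∀ f g i → conv f g i ≈ conv g f i
  conv-comm f g zero    = *-comm _ _
  conv-comm f g (suc i) = begin
    f 0 * g (suc i) + conv (f ∘ suc) g i ≈⟨ +-cong (*-comm _ _) (conv-comm (f ∘ suc) g i) ⟩
    g (suc i) * f 0 + conv g (f ∘ suc) i ≈⟨ +-comm _ _ ⟩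
    conv g (f ∘ suc) i + g (suc i) * f 0 ≈⟨ sym (conv-last g f i) ⟩
    conv g f (suc i)                     ∎

  conv-assoc : ∀ f g h i → conv (conv f g) h i ≈ conv f (conv g h) i
  conv-assoc f g h zero    = *-assoc _ _ _
  conv-assoc f g h (suc i) = begin
    f 0 * g 0 * h (suc i) + conv (λ j → f 0 * g (suc j) + conv (f ∘ suc) g j) h i
      ≈⟨ +-cong (*-assoc _ _ _) (conv-distribʳ _ _ h i) ⟩
    f 0 * (g 0 * h (suc i)) + (conv (λ j → f 0 * g (suc j)) h i + conv (conv (f ∘ suc) g) h i)
      ≈⟨ +-congˡ (+-cong (conv-scale (f 0) (g ∘ suc) h i) (conv-assoc (f ∘ suc) g h i)) ⟩
    f 0 * (g 0 * h (suc i)) + (f 0 * conv (g ∘ suc) h i + conv (f ∘ suc) (conv g h) i)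
      ≈⟨ sym (+-assoc _ _ _) ⟩
    (f 0 * (g 0 * h (suc i)) + f 0 * conv (g ∘ suc) h i) + conv (f ∘ suc) (conv g h) i
      ≈⟨ +-congʳ (sym (distribˡ _ _ _)) ⟩
    f 0 * conv g h (suc i) + conv (f ∘ suc) (conv g h) i ∎

  conv-identityˡ : ∀ g i → conv (coeff 1ₚ) g i ≈ g i
  conv-identityˡ g zero    = *-identityˡ _
  conv-identityˡ g (suc i) = trans
    (+-cong (*-identityˡ _) (conv-zeroˡ g (λ _ → refl) i)) (+-identityʳ _)

  private
    +ₚ-cong : ∀ {p p′ q q′} → p ≈ₚ p′ → q ≈ₚ q′ → p +ₚ q ≈ₚ p′ +ₚ q′
    +ₚ-cong {p} {p′} {q} {q′} (mk e) (mk e′) = mk λ i →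
      trans (coeff-+ p q i) (trans (+-cong (e i) (e′ i)) (sym (coeff-+ p′ q′ i)))

    *ₚ-cong : ∀ {p p′ q q′} → p ≈ₚ p′ → q ≈ₚ q′ → p *ₚ q ≈ₚ p′ *ₚ q′
    *ₚ-cong {p} {p′} {q} {q′} (mk e) (mk e′) = mk λ i →
      trans (coeff-* p q i) (trans (conv-cong e e′ i) (sym (coeff-* p′ q′ i)))

    *ₚ-comm : ∀ p q → p *ₚ q ≈ₚ q *ₚ p
    *ₚ-comm p q = mk λ i →
      trans (coeff-* p q i) (trans (conv-comm (coeff p) (coeff q) i) (sym (coeff-* q p i)))

    ≈ₚ-trans : ∀ {p q r} → p ≈ₚ q → q ≈ₚ r → p ≈ₚ r
    ≈ₚ-trans (mk e) (mk e′) = mk λ i → trans (e i) (e′ i)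

    *ₚ-distribʳ : ∀ r p q → (p +ₚ q) *ₚ r ≈ₚ p *ₚ r +ₚ q *ₚ r
    *ₚ-distribʳ r p q = mk λ i → begin
      coeff ((p +ₚ q) *ₚ r) i
        ≈⟨ coeff-* (p +ₚ q) r i ⟩
      conv (coeff (p +ₚ q)) (coeff r) i
        ≈⟨ conv-cong (coeff-+ p q) (λ _ → refl) i ⟩
      conv (λ j → coeff p j + coeff q j) (coeff r) i
        ≈⟨ conv-distribʳ (coeff p) (coeff q) (coeff r) i ⟩
      conv (coeff p) (coeff r) i + conv (coeff q) (coeff r) i
        ≈⟨ sym (+-cong (coeff-* p r i) (coeff-* q r i)) ⟩
      coeff (p *ₚ r) i + coeff (q *ₚ r) i
        ≈⟨ sym (coeff-+ (p *ₚ r) (q *ₚ r) i) ⟩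
      coeff (p *ₚ r +ₚ q *ₚ r) i ∎

    *ₚ-assoc : ∀ p q r → (p *ₚ q) *ₚ r ≈ₚ p *ₚ (q *ₚ r)
    *ₚ-assoc p q r = mk λ i → begin
      coeff ((p *ₚ q) *ₚ r) i                        ≈⟨ coeff-* (p *ₚ q) r i ⟩
      conv (coeff (p *ₚ q)) (coeff r) i              ≈⟨ conv-cong (coeff-* p q) (λ _ → refl) i ⟩
      conv (conv (coeff p) (coeff q)) (coeff r) i    ≈⟨ conv-assoc (coeff p) (coeff q) (coeff r) i ⟩
      conv (coeff p) (conv (coeff q) (coeff r)) i    ≈⟨ sym (conv-cong (λ _ → refl) (coeff-* q r) i) ⟩
      conv (coeff p) (coeff (q *ₚ r)) i              ≈⟨ sym (coeff-* p (q *ₚ r) i) ⟩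
      coeff (p *ₚ (q *ₚ r)) i                        ∎

    *ₚ-identityˡ : ∀ p → 1ₚ *ₚ p ≈ₚ p
    *ₚ-identityˡ p = mk λ i → trans (coeff-* 1ₚ p i) (conv-identityˡ (coeff p) i)

    +ₚ-assoc : ∀ p q r → (p +ₚ q) +ₚ r ≈ₚ p +ₚ (q +ₚ r)
    +ₚ-assoc p q r = mk λ i → begin
      coeff ((p +ₚ q) +ₚ r) i               ≈⟨ coeff-+ (p +ₚ q) r i ⟩
      coeff (p +ₚ q) i + coeff r i          ≈⟨ +-congʳ (coeff-+ p q i) ⟩
      coeff p i + coeff q i + coeff r i     ≈⟨ +-assoc _ _ _ ⟩
      coeff p i + (coeff q i + coeff r i)   ≈⟨ +-congˡ (sym (coeff-+ q r i)) ⟩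
      coeff p i + coeff (q +ₚ r) i          ≈⟨ sym (coeff-+ p (q +ₚ r) i) ⟩
      coeff (p +ₚ (q +ₚ r)) i               ∎

    +ₚ-comm : ∀ p q → p +ₚ q ≈ₚ q +ₚ p
    +ₚ-comm p q = mk λ i →
      trans (coeff-+ p q i) (trans (+-comm _ _) (sym (coeff-+ q p i)))

    +ₚ-identityʳ : ∀ p → p +ₚ 0ₚ ≈ₚ p
    +ₚ-identityʳ p = mk λ i → trans (coeff-+ p 0ₚ i) (+-identityʳ _)

    -ₚ-inverseˡ : ∀ p → -ₚ p +ₚ p ≈ₚ 0ₚ
    -ₚ-inverseˡ p = mk λ i →
      trans (coeff-+ (-ₚ p) p i) (trans (+-congʳ (coeff-neg p i)) (-‿inverseˡ _))

    -ₚ-inverseʳ : ∀ p → p +ₚ -ₚ p ≈ₚ 0ₚ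
    -ₚ-inverseʳ p = ≈ₚ-trans (+ₚ-comm p (-ₚ p)) (-ₚ-inverseˡ p)

  polyIsCommutativeRing : IsCommutativeRing _≈ₚ_ _+ₚ_ _*ₚ_ -ₚ_ 0ₚ 1ₚ
  polyIsCommutativeRing = record
    { isRing = record
      { +-isAbelianGroup = record
        { isGroup = record
          { isMonoid = record
            { isSemigroup = record
              { isMagma = record
                { isEquivalence = record
                  { refl  = mk λ _ → refl
                  ; sym   = λ (mk e) → mk λ i → sym (e i)
                  ; trans = ≈ₚ-trans
                  }
                ; ∙-cong = +ₚ-cong
                }
              ; assoc = +ₚ-assoc
              }
            ; identity = (λ _ → mk λ _ → refl) , +ₚ-identityʳ
            }
          ; inverse = -ₚ-inverseˡ , -ₚ-inverseʳ
          ; ⁻¹-cong = λ {p} {q} (mk e) → mk λ i →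
              trans (coeff-neg p i) (trans (-‿cong (e i)) (sym (coeff-neg q i)))
          }
        ; comm = +ₚ-comm
        }
      ; *-cong     = *ₚ-cong
      ; *-assoc    = *ₚ-assoc
      ; *-identity = *ₚ-identityˡ , λ p → ≈ₚ-trans (*ₚ-comm p 1ₚ) (*ₚ-identityˡ p)
      ; distrib    = (λ r p q → ≈ₚ-trans (*ₚ-comm r (p +ₚ q)) (≈ₚ-trans (*ₚ-distribʳ r p q)
                        (+ₚ-cong (*ₚ-comm p r) (*ₚ-comm q r))))
                   , *ₚ-distribʳ
      }
    ; *-comm = *ₚ-comm
    }

  R[T] : CommutativeRing c ℓ
  R[T] = record { isCommutativeRing = polyIsCommutativeRing }

  open RawSemiringDefinitions (Semiring.rawSemiring (CommutativeRing.semiring R[T])) public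
    using (_∣_; _∤_; Irreducible)
  open RawMagmaDefinitions (Semiring.*-rawMagma (CommutativeRing.semiring R[T])) public
    using (_,_)

  SquareFree : Poly → Set (c ⊔ ℓ)
  SquareFree D = ∀ {f} → f *ₚ f ∣ D → f ∣ 1ₚ

  SquareModulo : Poly → Poly → Set (c ⊔ ℓ)
  SquareModulo P D = ∃[ f ] (P ∣ D +ₚ -ₚ (f *ₚ f))

module FinitePolynomials {c ℓ₁ ℓ₂ q} (F : FiniteField c ℓ₁ ℓ₂ q) where

  open FiniteField F
  open Inverse enumeration using (to; from; to-cong; strictlyInverseʳ)
  open CommutativeRing commutativeRing hiding (isCommutativeRing)
  open RingProperties ring using (-0#≈0#)
  open Polynomials commutativeRing public
  private
    module 𝔽 = HeytingField heytingField
    module A = CommutativeRing R[T]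
    module A- = RingProperties A.ring

  private
    search : ∀ {p} {Q : Carrier → Set p} → (∀ {x y} → x ≈ y → Q x → Q y) →
             (∀ x → Dec (Q x)) → Dec (∃ Q)
    search resp Q? = map′
      (λ (i , Qi) → from i , Qi)
      (λ (x , Qx) → to x , resp (sym (strictlyInverseʳ x)) Qx)
      (Fin.any? (Q? ∘ from))

  infix 4 _≟_
  _≟_ : ∀ x y → Dec (x ≈ y)
  x ≟ y = map′
    (λ e → trans (sym (strictlyInverseʳ x)) (trans (reflexive (≡.cong from e)) (strictlyInverseʳ y)))
    to-cong (to x Fin.≟ to y)

  1≉0 : ¬ (1# ≈ 0#)
  1≉0 1≈0 = 𝔽.#-irrefl refl
    (𝔽.invertible⇒# {0#} {0#} (0# , trans (zeroˡ _) (sym 1≈0) , trans (zeroʳ _) (sym 1≈0)))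

  inverse : ∀ {x} → ¬ (x ≈ 0#) → ∃[ y ] (y * x ≈ 1#)
  inverse {x} x≉0 with search (λ e → trans (*-congʳ (sym e))) (λ y → y * x ≟ 1#)
  ... | yes inv  = inv
  ... | no  ¬inv = ⊥-elim (x≉0 (proj₁ (𝔽.tight x 0#) λ x#0 →
    let (y , yx≈1 , _) = 𝔽.#⇒invertible x#0
    in ¬inv (y , trans (*-congˡ (sym (trans (+-congˡ -0#≈0#) (+-identityʳ x)))) yx≈1)))

  *-nonzero : ∀ {x y} → ¬ (x ≈ 0#) → ¬ (y ≈ 0#) → ¬ (x * y ≈ 0#)
  *-nonzero {x} {y} x≉0 y≉0 xy≈0 = let (u , ux≈1) = inverse x≉0 in y≉0
    (trans (sym (*-identityˡ y)) (trans (*-congʳ (sym ux≈1))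
      (trans (*-assoc u x y) (trans (*-congˡ xy≈0) (zeroʳ u)))))

  -- Bounded n p: deg p < n, with the zero polynomial below every bound.
  Bounded : ℕ → Poly → Set ℓ₁
  Bounded n p = ∀ i → n ℕ.≤ i → coeff p i ≈ 0#

  bounded-length : ∀ p → Bounded (length p) p
  bounded-length []      _       _         = refl
  bounded-length (a ∷ p) (suc i) (s≤s n≤i) = bounded-length p i n≤i

  ∷-cong : ∀ {a b p r} → a ≈ b → p ≈ₚ r → a ∷ p ≈ₚ b ∷ r
  ∷-cong a≈b p≈r = mk λ { zero → a≈b ; (suc i) → at p≈r i }

  zero-∷ : ∀ {a p} → a ≈ 0# → p ≈ₚ 0ₚ → a ∷ p ≈ₚ 0ₚ
  zero-∷ a≈0 p≈0 = mk λ { zero → a≈0 ; (suc i) → at p≈0 i }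

  zero? : ∀ p → Dec (p ≈ₚ 0ₚ)
  zero? []      = yes A.refl
  zero? (a ∷ p) = map′ (λ (a≈0 , p≈0) → zero-∷ a≈0 p≈0)
    (λ e → at e 0 , mk (at e ∘ suc)) ((a ≟ 0#) ×-dec zero? p)

  -- The junk value is deg 0 = 0.
  deg : Poly → ℕ
  deg []      = 0
  deg (a ∷ p) = if does (zero? p) then 0 else suc (deg p)

  lead : Poly → Carrier
  lead p = coeff p (deg p)

  Monic : Poly → Set ℓ₁
  Monic p = lead p ≈ 1#

  deg-bounded : ∀ p → Bounded (suc (deg p)) p
  deg-bounded []      i       _ = refl
  deg-bounded (a ∷ p) (suc i) n<i with zero? p
  ... | yes p≈0 = at p≈0 i
  ... | no  _   = deg-bounded p i (ℕ.s≤s⁻¹ n<i)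

  lead-nonzero : ∀ {p} → ¬ (p ≈ₚ 0ₚ) → ¬ (lead p ≈ 0#)
  lead-nonzero {[]}    p≉0 _ = p≉0 A.refl
  lead-nonzero {a ∷ p} a∷p≉0 with zero? p
  ... | yes p≈0 = λ a≈0 → a∷p≉0 (zero-∷ a≈0 p≈0)
  ... | no  p≉0 = lead-nonzero p≉0

  private
    conv-above : ∀ {f g} m n → (∀ i → m ℕ.< i → f i ≈ 0#) → (∀ i → n ℕ.< i → g i ≈ 0#) →
                 ∀ i → m ℕ.+ n ℕ.< i → conv f g i ≈ 0#
    conv-above {g = g} zero n f0 g0 (suc i) n<i = trans
      (+-cong (trans (*-congˡ (g0 (suc i) n<i)) (zeroʳ _))
              (conv-zeroˡ g (λ j → f0 (suc j) (s≤s z≤n)) i))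
      (+-identityˡ 0#)
    conv-above (suc m) n f0 g0 (suc i) (s≤s m+n<i) = trans
      (+-cong (trans (*-congˡ (g0 (suc i) (ℕ.≤-<-trans (ℕ.m≤n+m n m) (ℕ.m≤n⇒m≤1+n m+n<i)))) (zeroʳ _))
              (conv-above m n (λ j m<j → f0 (suc j) (s≤s m<j)) g0 i m+n<i))
      (+-identityˡ 0#)

    conv-top : ∀ {f g} m n → (∀ i → m ℕ.< i → f i ≈ 0#) → (∀ i → n ℕ.< i → g i ≈ 0#) →
               conv f g (m ℕ.+ n) ≈ f m * g n
    conv-top zero zero f0 g0 = refl
    conv-top {g = g} zero (suc n) f0 g0 = trans
      (+-congˡ (conv-zeroˡ g (λ j → f0 (suc j) (s≤s z≤n)) n)) (+-identityʳ _)
    conv-top (suc m) n f0 g0 = trans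
      (+-cong (trans (*-congˡ (g0 (suc (m ℕ.+ n)) (s≤s (ℕ.m≤n+m n m)))) (zeroʳ _))
              (conv-top m n (λ j m<j → f0 (suc j) (s≤s m<j)) g0))
      (+-identityˡ _)

  coeff-*-top : ∀ p r → coeff (p *ₚ r) (deg p ℕ.+ deg r) ≈ lead p * lead r
  coeff-*-top p r = trans (coeff-* p r _) (conv-top (deg p) (deg r) (deg-bounded p) (deg-bounded r))

  factor-degree : ∀ {n b} p r → p *ₚ r ≈ₚ b → ¬ (b ≈ₚ 0ₚ) → Bounded n b → deg p ℕ.+ deg r ℕ.< n
  factor-degree p r pr≈b b≉0 bnd = ℕ.≰⇒> λ n≤ →
    *-nonzero
      (lead-nonzero {p} λ p≈0 → b≉0 (A.trans (A.sym pr≈b) (A.trans (A.*-congʳ p≈0) (A.zeroˡ r))))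
      (lead-nonzero {r} λ r≈0 → b≉0 (A.trans (A.sym pr≈b) (A.trans (A.*-congˡ {p} r≈0) (A.zeroʳ p))))
      (trans (sym (coeff-*-top p r)) (trans (at pr≈b _) (bnd _ n≤)))

  private
    weaken : ∀ {m n} p → m ℕ.≤ n → Bounded m p → Bounded n p
    weaken p m≤n bnd i n≤i = bnd i (ℕ.≤-trans m≤n n≤i)

    factor-boundedˡ : ∀ {n b} p r → p *ₚ r ≈ₚ b → ¬ (b ≈ₚ 0ₚ) → Bounded n b → Bounded n p
    factor-boundedˡ p r e b≉0 bnd = weaken p
      (ℕ.≤-trans (s≤s (ℕ.m≤m+n (deg p) (deg r))) (factor-degree p r e b≉0 bnd)) (deg-bounded p)

    factor-boundedʳ : ∀ {n b} p r → p *ₚ r ≈ₚ b → ¬ (b ≈ₚ 0ₚ) → Bounded n b → Bounded n r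
    factor-boundedʳ p r e = factor-boundedˡ r p (A.trans (A.*-comm r p) e)

    searchBounded : ∀ {p} n {Q : Poly → Set p} → (∀ {x y} → x ≈ₚ y → Q x → Q y) →
                    (∀ x → Dec (Q x)) → Dec (∃[ f ] (Bounded n f × Q f))
    searchBounded zero resp Q? = map′
      (λ Q[] → [] , (λ _ _ → refl) , Q[])
      (λ (f , bnd , Qf) → resp (mk λ i → bnd i z≤n) Qf)
      (Q? [])
    searchBounded (suc n) {Q} resp Q? = map′
      (λ (a , f , bnd , Qaf) → a ∷ f , (λ { (suc i) (s≤s n≤i) → bnd i n≤i }) , Qaf)
      uncons
      (search (λ x≈y (f , bnd , Qxf) → f , bnd , resp (∷-cong x≈y A.refl) Qxf)
        λ a → searchBounded n (λ f≈g → resp (∷-cong refl f≈g)) (λ f → Q? (a ∷ f)))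
      where
      uncons : ∃[ f ] (Bounded (suc n) f × Q f) →
               ∃[ a ] ∃[ f ] (Bounded n f × Q (a ∷ f))
      uncons ([]    , bnd , Qf) = 0# , [] , (λ _ _ → refl) , resp (A.sym (zero-∷ refl A.refl)) Qf
      uncons (a ∷ f , bnd , Qf) = a , f , (λ i n≤i → bnd (suc i) (s≤s n≤i)) , Qf

    ∣-respˡ : ∀ {a b d} → a ≈ₚ b → a ∣ d → b ∣ d
    ∣-respˡ a≈b (k , e) = k , A.trans (A.*-congˡ {k} (A.sym a≈b)) e

    ∣-respʳ : ∀ {a b d} → a ≈ₚ b → d ∣ a → d ∣ b
    ∣-respʳ a≈b (k , e) = k , A.trans e a≈b

  infix 4 _≟ₚ_
  _≟ₚ_ : ∀ p r → Dec (p ≈ₚ r)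
  p ≟ₚ r = map′ (A-.x∙y⁻¹≈ε⇒x≈y p r) A-.x≈y⇒x∙y⁻¹≈ε (zero? (p +ₚ -ₚ r))

  infix 4 _∣?_
  _∣?_ : ∀ a b → Dec (a ∣ b)
  a ∣? b with zero? b
  ... | yes b≈0 = yes (0ₚ , A.trans (A.zeroˡ a) (A.sym b≈0))
  ... | no  b≉0 = map′
    (λ (k , _ , e) → k , e)
    (λ (k , e) → k , factor-boundedˡ k a e b≉0 (bounded-length b) , e)
    (searchBounded (length b) (λ k≈l e → A.trans (A.*-congʳ (A.sym k≈l)) e) (λ k → k *ₚ a ≟ₚ b))

  squareFree? : ∀ D → Dec (SquareFree D)
  squareFree? D with zero? D
  ... | yes D≈0 = no λ sf →
    let (k , k0≈1) = sf {0ₚ} (0ₚ , A.sym D≈0)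
    in 1≉0 (sym (at (A.trans (A.sym (A.zeroʳ k)) k0≈1) 0))
  ... | no  D≉0 = map′
    (λ none {f} f²∣D → decidable-stable (f ∣? 1ₚ) λ f∤1 →
      none (f , bound f f²∣D , f²∣D , f∤1))
    (λ sf (f , _ , f²∣D , f∤1) → f∤1 (sf f²∣D))
    (¬? (searchBounded (length D)
      (λ f≈g (f²∣D , f∤1) → ∣-respˡ (A.*-cong f≈g f≈g) f²∣D , f∤1 ∘ ∣-respˡ (A.sym f≈g))
      λ f → (f *ₚ f ∣? D) ×-dec ¬? (f ∣? 1ₚ)))
    where
    bound : ∀ f → f *ₚ f ∣ D → Bounded (length D) f
    bound f (k , e) = factor-boundedʳ (k *ₚ f) f
      (A.trans (A.*-assoc k f f) e) D≉0 (bounded-length D)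

  divMod : ∀ P → ¬ (P ≈ₚ 0ₚ) → ∀ f → ∃[ k ] ∃[ r ] (Bounded (deg P) r × f ≈ₚ k *ₚ P +ₚ r)
  divMod P P≉0 []      = [] , [] , (λ _ _ → refl) , A.refl
  divMod P P≉0 (a ∷ f) =
    let (k , r , bnd , f≈) = divMod P P≉0 f
    in (0# ∷ k) +ₚ [ κ r ] , (a ∷ r) +ₚ -ₚ ([ κ r ] *ₚ P) , bounded r bnd , split k r f≈
    where
    u : Carrier
    u = proj₁ (inverse (lead-nonzero P≉0))

    κ : Poly → Carrier
    κ r = coeff (a ∷ r) (deg P) * u

    coeff-const : ∀ x i → coeff ([ x ] *ₚ P) i ≈ x * coeff P i
    coeff-const x i = trans (coeff-* [ x ] P i) (go i)
      where
      go : ∀ i → conv (coeff [ x ]) (coeff P) i ≈ x * coeff P i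
      go zero    = refl
      go (suc i) = trans (+-congˡ (conv-zeroˡ (coeff P) (λ _ → refl) i)) (+-identityʳ _)

    remainder : ∀ r i → coeff ((a ∷ r) +ₚ -ₚ ([ κ r ] *ₚ P)) i ≈
                        coeff (a ∷ r) i - κ r * coeff P i
    remainder r i = trans (coeff-+ (a ∷ r) (-ₚ ([ κ r ] *ₚ P)) i)
      (+-congˡ (trans (coeff-neg ([ κ r ] *ₚ P) i) (-‿cong (coeff-const (κ r) i))))

    bounded : ∀ r → Bounded (deg P) r → Bounded (deg P) ((a ∷ r) +ₚ -ₚ ([ κ r ] *ₚ P))
    bounded r bnd i n≤i with ℕ.m≤n⇒m<n∨m≡n n≤i
    ... | inj₂ ≡.refl = trans (remainder r i) (trans
      (+-congˡ (-‿cong (trans (*-assoc _ _ _)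
        (trans (*-congˡ (proj₂ (inverse (lead-nonzero P≉0)))) (*-identityʳ _)))))
      (-‿inverseʳ _))
    ... | inj₁ (s≤s {n = j} n≤j) = trans (remainder r i) (trans
      (+-cong (bnd j n≤j) (-‿cong (trans (*-congˡ (deg-bounded P i (s≤s n≤j))) (zeroʳ _))))
      (-‿inverseʳ _))

    split : ∀ k r → f ≈ₚ k *ₚ P +ₚ r →
            a ∷ f ≈ₚ ((0# ∷ k) +ₚ [ κ r ]) *ₚ P +ₚ ((a ∷ r) +ₚ -ₚ ([ κ r ] *ₚ P))
    split k r f≈ = begin
      a ∷ f
        ≈⟨ ∷-cong (sym (+-identityˡ a)) f≈ ⟩
      (0# ∷ k *ₚ P) +ₚ (a ∷ r)
        ≈⟨ A.+-congʳ {a ∷ r} (A.sym shift) ⟩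
      (0# ∷ k) *ₚ P +ₚ (a ∷ r)
        ≈⟨ A.+-congˡ {(0# ∷ k) *ₚ P} (A.sym (A-.xyx⁻¹≈y ([ κ r ] *ₚ P) (a ∷ r))) ⟩
      (0# ∷ k) *ₚ P +ₚ ([ κ r ] *ₚ P +ₚ (a ∷ r) +ₚ -ₚ ([ κ r ] *ₚ P))
        ≈⟨ A.+-congˡ {(0# ∷ k) *ₚ P} (A.+-assoc ([ κ r ] *ₚ P) (a ∷ r) _) ⟩
      (0# ∷ k) *ₚ P +ₚ ([ κ r ] *ₚ P +ₚ ((a ∷ r) +ₚ -ₚ ([ κ r ] *ₚ P)))
        ≈⟨ A.sym (A.+-assoc ((0# ∷ k) *ₚ P) ([ κ r ] *ₚ P) _) ⟩
      (0# ∷ k) *ₚ P +ₚ [ κ r ] *ₚ P +ₚ ((a ∷ r) +ₚ -ₚ ([ κ r ] *ₚ P))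
        ≈⟨ A.+-congʳ (A.sym (A.distribʳ P (0# ∷ k) [ κ r ])) ⟩
      ((0# ∷ k) +ₚ [ κ r ]) *ₚ P +ₚ ((a ∷ r) +ₚ -ₚ ([ κ r ] *ₚ P)) ∎
      where
      open SetoidReasoning A.setoid
      shift : (0# ∷ k) *ₚ P ≈ₚ 0# ∷ k *ₚ P
      shift = mk λ i → trans (coeff-+ (map (0# *_) P) _ i)
        (trans (+-congʳ (trans (coeff-scale 0# P i) (zeroˡ _))) (+-identityˡ _))

  squareModulo? : ∀ P D → Dec (SquareModulo P D)
  squareModulo? P D with zero? P | zero? D
  ... | yes P≈0 | yes D≈0 = yes (0ₚ , 0ₚ , A.sym (A.trans (A.+-identityʳ D) D≈0))
  ... | yes P≈0 | no  D≉0 = map′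
    (λ (f , _ , f²≈D) → f , 0ₚ , A.sym (A-.x≈y⇒x∙y⁻¹≈ε (A.sym f²≈D)))
    (λ (f , k , e) →
      let f²≈D = A.sym (A-.x∙y⁻¹≈ε⇒x≈y D (f *ₚ f)
                   (A.trans (A.sym e) (A.trans (A.*-congˡ {k} P≈0) (A.zeroʳ k))))
      in f , factor-boundedˡ f f f²≈D D≉0 (bounded-length D) , f²≈D)
    (searchBounded (length D) (λ f≈g e → A.trans (A.sym (A.*-cong f≈g f≈g)) e)
      (λ f → f *ₚ f ≟ₚ D))
  ... | no  P≉0 | _ = map′
    (λ (f , _ , P∣) → f , P∣)
    (λ (f , P∣) → let (k , r , bnd , f≈) = divMod P P≉0 f in r , bnd , reduce k f r f≈ P∣)
    (searchBounded (deg P)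
      (λ f≈g → ∣-respʳ (A.+-congˡ (A.-‿cong (A.*-cong f≈g f≈g))))
      (λ f → P ∣? D +ₚ -ₚ (f *ₚ f)))
    where
    open SetoidReasoning A.setoid
    reduce : ∀ k f r → f ≈ₚ k *ₚ P +ₚ r → P ∣ D +ₚ -ₚ (f *ₚ f) → P ∣ D +ₚ -ₚ (r *ₚ r)
    reduce k f r f≈ (m , mP≈) = m +ₚ (k *ₚ f +ₚ r *ₚ k) , (begin
      (m +ₚ (k *ₚ f +ₚ r *ₚ k)) *ₚ P
        ≈⟨ A.distribʳ P m _ ⟩
      m *ₚ P +ₚ w
        ≈⟨ A.+-congʳ mP≈ ⟩
      D +ₚ -ₚ (f *ₚ f) +ₚ w
        ≈⟨ A.+-assoc D _ _ ⟩
      D +ₚ (-ₚ (f *ₚ f) +ₚ w)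
        ≈⟨ A.+-congˡ {D} (A.+-congʳ {w} (A.-‿cong f²≈)) ⟩
      D +ₚ (-ₚ (w +ₚ r *ₚ r) +ₚ w)
        ≈⟨ A.+-congˡ {D} (A.+-congʳ {w} (A.sym (A-.-‿+-comm w (r *ₚ r)))) ⟩
      D +ₚ ((-ₚ w +ₚ -ₚ (r *ₚ r)) +ₚ w)
        ≈⟨ A.+-congˡ {D} (A.+-comm (-ₚ w +ₚ -ₚ (r *ₚ r)) w) ⟩
      D +ₚ (w +ₚ (-ₚ w +ₚ -ₚ (r *ₚ r)))
        ≈⟨ A.+-congˡ {D} (A.sym (A.+-assoc w _ _)) ⟩
      D +ₚ (w +ₚ -ₚ w +ₚ -ₚ (r *ₚ r))
        ≈⟨ A.+-congˡ {D} (A.+-congʳ (A.-‿inverseʳ w)) ⟩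
      D +ₚ -ₚ (r *ₚ r) ∎)
      where
      w : Poly
      w = (k *ₚ f +ₚ r *ₚ k) *ₚ P
      f²≈ : f *ₚ f ≈ₚ w +ₚ r *ₚ r
      f²≈ = begin
        f *ₚ f                                 ≈⟨ A.*-congʳ f≈ ⟩
        (k *ₚ P +ₚ r) *ₚ f                     ≈⟨ A.distribʳ f (k *ₚ P) r ⟩
        k *ₚ P *ₚ f +ₚ r *ₚ f                  ≈⟨ A.+-cong swap (A.trans (A.*-congˡ {r} f≈) (A.distribˡ r (k *ₚ P) r)) ⟩
        k *ₚ f *ₚ P +ₚ (r *ₚ (k *ₚ P) +ₚ r *ₚ r) ≈⟨ A.sym (A.+-assoc (k *ₚ f *ₚ P) _ _) ⟩
        k *ₚ f *ₚ P +ₚ r *ₚ (k *ₚ P) +ₚ r *ₚ r   ≈⟨ A.+-congʳ (A.+-congˡ {k *ₚ f *ₚ P} (A.sym (A.*-assoc r k P))) ⟩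
        k *ₚ f *ₚ P +ₚ r *ₚ k *ₚ P +ₚ r *ₚ r     ≈⟨ A.+-congʳ (A.sym (A.distribʳ P (k *ₚ f) (r *ₚ k))) ⟩
        w +ₚ r *ₚ r                            ∎
        where
        swap : k *ₚ P *ₚ f ≈ₚ k *ₚ f *ₚ P
        swap = A.trans (A.*-assoc k P f)
          (A.trans (A.*-congˡ {k} (A.*-comm P f)) (A.sym (A.*-assoc k f P)))

  -- The quadratic residue symbol (D / P), for P monic irreducible.
  χ : Poly → Poly → ℤ
  χ D P = if does (P ∣? D) then 0ℤ
          else if does (squareModulo? P D) then 1ℤ
          else -1ℤ

  -- Only meaningful for nonzero polynomials.
  ∣_∣ₚ : Poly → ℕ
  ∣ f ∣ₚ = q ℕ.^ deg f

  -- Every monic polynomial of degree n, exactly once up to _≈ₚ_.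
  monics : ℕ → List Poly
  monics zero    = [ 1ₚ ]
  monics (suc n) = cartesianProductWith _∷_ (tabulate from) (monics n)

  ℋ : ℕ → List Poly
  ℋ n = filter squareFree? (monics n)

  -- For P of even degree 2g, |P| = (q^g)² and so √ ∣ P ∣ₚ is the exact square root.
  M : ℕ → Poly → ℚ
  M g P = (1ℤ /₀ length (ℋ n)) ℚ.* (Σχ ℚ./ 1)
    where
    n : ℕ
    n = 2 ℕ.* g ℕ.+ 1
    Σχ : ℤ
    Σχ = foldr ℤ._+_ 0ℤ (map (λ D → χ D P ℤ.* + (√ ∣ P ∣ₚ)) (ℋ n))

{-# OPTIONS --safe #-}

-- Write S(n) and H(n) for the sums of χ_D(P) over all monic D of degree n and over the
-- square-free ones. Every non-square-free monic D is uniquely A² B with B square-free and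
-- A = a + T A′ of positive degree, so D ↦ (a , A′² B) gives H(n + 2) = S(n + 2) - q S(n) as
-- long as P is prime to all A that occur; the same recursion with 1 in place of χ counts ℋ.
-- For n = 2g - 1, S(2g + 1) vanishes since residues mod P are equidistributed in degree > 2g.
-- For S(2g - 1), the sum of 1 + χ_D(P) counts the f mod P whose square has T^(2g-1)-coefficient
-- 1 modulo P. The quadratic form f ↦ [T^(2g-1)] (f² mod P) vanishes on the g-dimensional space
-- of a with deg a < g, and on each coset T^g b + {a} with b ≠ 0 it is a nonconstant affine
-- function of a. So it takes the value 1 exactly (q^g - 1) q^(g-1) times, whence
-- S(2g - 1) = - q^(g-1) and H(2g + 1) = q^g.
module Submission where

open import Algebra.Bundles using (CommutativeRing)
import Algebra.Properties.CommutativeSemigroup as CommutativeSemigroupProperties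
import Algebra.Properties.Ring as RingProperties
import Algebra.Solver.Ring.NaturalCoefficients.Default as SemiringSolver
open import Data.Bool.Base using (if_then_else_)
open import Data.Empty using (⊥-elim)
open import Data.Fin.Base as Fin using (Fin)
import Data.Fin.Properties as Fin
open import Data.Integer.Base as ℤ using (ℤ; +_; 0ℤ; 1ℤ; -1ℤ)
import Data.Integer.Properties as ℤ
open import Data.List.Base
  using (List; []; _∷_; [_]; _++_; map; foldr; filter; length; tabulate; cartesianProductWith; drop; upTo)
open import Data.List.Membership.Propositional using (find; lose)
open import Data.List.Membership.Propositional.Properties using (∈-upTo⁺)
open import Data.List.Properties using (length-tabulate)
open import Data.List.Relation.Unary.All as All using (All; []; _∷_)
import Data.List.Relation.Unary.All.Properties as All
open import Data.List.Relation.Unary.Any as Any using (Any; here)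
import Data.List.Relation.Unary.Any.Properties as Any
open import Data.Nat.Base as ℕ using (ℕ; zero; suc; z≤n; s≤s)
open import Data.Nat.Divisibility using (divides) renaming (_∣_ to _∣ℕ_)
import Data.Nat.Properties as ℕ
open import Data.Product.Base using (∃-syntax; _×_; _,_; proj₁; proj₂)
open import Data.Rational.Base as ℚ using ()
import Data.Rational.Properties as ℚ
import Data.Rational.Unnormalised.Base as ℚᵘ
import Data.Rational.Unnormalised.Properties as ℚᵘ
open import Data.Sum.Base as Sum using (_⊎_; inj₁; inj₂; [_,_]′)
open import Function.Base using (_∘_; id)
open import Function.Bundles using (Inverse; mk⇔)
open import Level using (_⊔_)
open import Relation.Binary.Definitions using (tri<; tri≈; tri>)
open import Relation.Binary.PropositionalEquality as ≡ using (_≡_; _≢_; cong; cong₂)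
import Relation.Binary.Reasoning.Setoid as SetoidReasoning
open import Relation.Nullary using (¬_; Dec; yes; no; does)
open import Relation.Nullary.Decidable using (¬?; dec-true; dec-false; does-⇔; map′)

open import Defs

-- Both terms of the recursion have closed forms because of where the degrees lie. Degree 2g + 1 is
-- above `deg P`. Degree 2g - 1 is the top degree of a residue modulo `P`, so "monic of degree 2g -
-- 1" is a condition on one linear functional of the residue. The constant 1/(q - 1) is then H(2g +
-- 1) times the square root of |P|, that is `q^g * q^g`, over the `q^(2g) * (q - 1)` members of `ℋ`.
-- Oddness of `q` enters only as 1 + 1 ≠ 0, in two places: the square roots `r` and `- r` of a
-- nonzero square are distinct, and the linear part of the affine function, which carries the factor
-- 2, does not vanish. The formal obstacle is that polynomials are compared by `_≈ₚ_`, while the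
-- sums run over lists of representatives. A bijection of classes does not carry list entries to
-- list entries, so each change of variable is done by counting a relation along rows and along
-- columns.

private
  module ℤ- = RingProperties ℤ.+-*-ring

-- Finite sums of integers and double counting.

module Sums where

  open ≡.≡-Reasoning
  open CommutativeSemigroupProperties ℤ.+-commutativeSemigroup using (interchange)

  𝟙 : ∀ {p} {P : Set p} → Dec P → ℤ
  𝟙 P? = if does P? then 1ℤ else 0ℤ

  𝟙-yes : ∀ {p} {P : Set p} (P? : Dec P) → P → 𝟙 P? ≡ 1ℤ
  𝟙-yes P? p = cong (if_then 1ℤ else 0ℤ) (dec-true P? p)

  𝟙-no : ∀ {p} {P : Set p} (P? : Dec P) → ¬ P → 𝟙 P? ≡ 0ℤ
  𝟙-no P? ¬p = cong (if_then 1ℤ else 0ℤ) (dec-false P? ¬p)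

  𝟙-cong : ∀ {p r} {P : Set p} {R : Set r} (P? : Dec P) (R? : Dec R) →
           (P → R) → (R → P) → 𝟙 P? ≡ 𝟙 R?
  𝟙-cong (yes p) R? f g = ≡.sym (𝟙-yes R? (f p))
  𝟙-cong (no ¬p) R? f g = ≡.sym (𝟙-no R? (¬p ∘ g))

  𝟙-natural : ∀ {p} {P : Set p} (P? : Dec P) → ∃[ m ] 𝟙 P? ≡ + m
  𝟙-natural (yes _) = 1 , ≡.refl
  𝟙-natural (no _)  = 0 , ≡.refl

  𝟙+𝟙-¬ : ∀ {p} {P : Set p} (P? : Dec P) → 𝟙 P? ℤ.+ 𝟙 (¬? P?) ≡ 1ℤ
  𝟙+𝟙-¬ (yes _) = ≡.refl
  𝟙+𝟙-¬ (no _)  = ≡.refl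

  -- This is the very expression that `M` uses for its sum, so the rules below apply to `M` without
  -- any translation.
  ∑ : ∀ {a} {A : Set a} → List A → (A → ℤ) → ℤ
  ∑ xs f = foldr ℤ._+_ 0ℤ (map f xs)

  infix 5 ∑
  syntax ∑ xs (λ x → e) = ∑[ x ∈ xs ] e

  module _ {a} {A : Set a} where

    ∑-cong : ∀ {f g : A → ℤ} xs → (∀ x → f x ≡ g x) → ∑ xs f ≡ ∑ xs g
    ∑-cong []       f≡g = ≡.refl
    ∑-cong (x ∷ xs) f≡g = cong₂ ℤ._+_ (f≡g x) (∑-cong xs f≡g)

    ∑-cong-All : ∀ {p} {P : A → Set p} {f g : A → ℤ} {xs} → All P xs →
                 (∀ x → P x → f x ≡ g x) → ∑ xs f ≡ ∑ xs g
    ∑-cong-All []         f≡g = ≡.refl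
    ∑-cong-All (px ∷ pxs) f≡g = cong₂ ℤ._+_ (f≡g _ px) (∑-cong-All pxs f≡g)

    ∑-zero : ∀ (xs : List A) → (∑[ x ∈ xs ] 0ℤ) ≡ 0ℤ
    ∑-zero []       = ≡.refl
    ∑-zero (x ∷ xs) = ≡.trans (ℤ.+-identityˡ _) (∑-zero xs)

    ∑-const : ∀ (xs : List A) c → (∑[ x ∈ xs ] c) ≡ + length xs ℤ.* c
    ∑-const []       c = ≡.sym (ℤ.*-zeroˡ c)
    ∑-const (x ∷ xs) c = begin
      c ℤ.+ (∑[ x ∈ xs ] c)        ≡⟨ cong (λ s → c ℤ.+ s) (∑-const xs c) ⟩
      c ℤ.+ + length xs ℤ.* c      ≡⟨ cong (ℤ._+ + length xs ℤ.* c) (≡.sym (ℤ.*-identityˡ c)) ⟩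
      1ℤ ℤ.* c ℤ.+ + length xs ℤ.* c ≡⟨ ≡.sym (ℤ.*-distribʳ-+ c 1ℤ (+ length xs)) ⟩
      + length (x ∷ xs) ℤ.* c      ∎

    ∑-one : ∀ (xs : List A) → (∑[ x ∈ xs ] 1ℤ) ≡ + length xs
    ∑-one xs = ≡.trans (∑-const xs 1ℤ) (ℤ.*-identityʳ _)

    ∑-+ : ∀ (xs : List A) f g → (∑[ x ∈ xs ] (f x ℤ.+ g x)) ≡ ∑ xs f ℤ.+ ∑ xs g
    ∑-+ []       f g = ≡.refl
    ∑-+ (x ∷ xs) f g =
      ≡.trans (cong (λ s → f x ℤ.+ g x ℤ.+ s) (∑-+ xs f g)) (interchange (f x) (g x) _ _)

    ∑-*ˡ : ∀ (xs : List A) c f → (∑[ x ∈ xs ] (c ℤ.* f x)) ≡ c ℤ.* ∑ xs f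
    ∑-*ˡ []       c f = ≡.sym (ℤ.*-zeroʳ c)
    ∑-*ˡ (x ∷ xs) c f =
      ≡.trans (cong (λ s → c ℤ.* f x ℤ.+ s) (∑-*ˡ xs c f)) (≡.sym (ℤ.*-distribˡ-+ c (f x) _))

    ∑-*ʳ : ∀ (xs : List A) c f → (∑[ x ∈ xs ] (f x ℤ.* c)) ≡ ∑ xs f ℤ.* c
    ∑-*ʳ xs c f = ≡.trans (∑-cong xs λ x → ℤ.*-comm (f x) c)
                    (≡.trans (∑-*ˡ xs c f) (ℤ.*-comm c _))

    ∑-++ : ∀ (xs ys : List A) f → ∑ (xs ++ ys) f ≡ ∑ xs f ℤ.+ ∑ ys f
    ∑-++ []       ys f = ≡.sym (ℤ.+-identityˡ _)
    ∑-++ (x ∷ xs) ys f =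
      ≡.trans (cong (λ s → f x ℤ.+ s) (∑-++ xs ys f)) (≡.sym (ℤ.+-assoc (f x) _ _))

    ∑-filter : ∀ {p} {P : A → Set p} (P? : ∀ x → Dec (P x)) xs f →
               ∑ (filter P? xs) f ≡ (∑[ x ∈ xs ] (𝟙 (P? x) ℤ.* f x))
    ∑-filter P? []       f = ≡.refl
    ∑-filter P? (x ∷ xs) f with P? x
    ... | yes _ = cong₂ ℤ._+_ (≡.sym (ℤ.*-identityˡ (f x))) (∑-filter P? xs f)
    ... | no  _ = ≡.trans (∑-filter P? xs f) (≡.sym (ℤ.+-identityˡ _))

  ∑-map : ∀ {a b} {A : Set a} {B : Set b} (h : A → B) xs f → ∑ (map h xs) f ≡ ∑ xs (f ∘ h)
  ∑-map h []       f = ≡.refl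
  ∑-map h (x ∷ xs) f = cong (λ s → f (h x) ℤ.+ s) (∑-map h xs f)

  ∑-cartesianProductWith : ∀ {a b c} {A : Set a} {B : Set b} {C : Set c} (h : A → B → C) xs ys f →
    ∑ (cartesianProductWith h xs ys) f ≡ (∑[ x ∈ xs ] ∑[ y ∈ ys ] f (h x y))
  ∑-cartesianProductWith h []       ys f = ≡.refl
  ∑-cartesianProductWith h (x ∷ xs) ys f = ≡.trans (∑-++ (map (h x) ys) _ f)
    (cong₂ ℤ._+_ (∑-map (h x) ys f) (∑-cartesianProductWith h xs ys f))

  ∑-swap : ∀ {a b} {A : Set a} {B : Set b} (xs : List A) (ys : List B) (f : A → B → ℤ) →
           (∑[ x ∈ xs ] ∑[ y ∈ ys ] f x y) ≡ (∑[ y ∈ ys ] ∑[ x ∈ xs ] f x y)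
  ∑-swap []       ys f = ≡.sym (∑-zero ys)
  ∑-swap (x ∷ xs) ys f = ≡.trans (cong (λ s → ∑ ys (f x) ℤ.+ s) (∑-swap xs ys f))
                           (≡.sym (∑-+ ys (f x) _))

  ∑-tabulate-single : ∀ {a} {A : Set a} {n} (f : Fin n → A) {v z} j → v (f j) ≡ z →
                      (∀ i → i ≢ j → v (f i) ≡ 0ℤ) → ∑ (tabulate f) v ≡ z
  ∑-tabulate-single {n = suc n} f {v} {z} Fin.zero vj≡z v≡0 = begin
    v (f Fin.zero) ℤ.+ ∑ (tabulate (f ∘ Fin.suc)) v
      ≡⟨ cong₂ ℤ._+_ vj≡z (zeros _ λ i → v≡0 (Fin.suc i) λ ()) ⟩
    z ℤ.+ 0ℤ                                         ≡⟨ ℤ.+-identityʳ z ⟩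
    z                                                ∎
    where
    zeros : ∀ {n} (h : Fin n → _) → (∀ i → v (h i) ≡ 0ℤ) → ∑ (tabulate h) v ≡ 0ℤ
    zeros {zero}  h v≡0 = ≡.refl
    zeros {suc n} h v≡0 = cong₂ ℤ._+_ (v≡0 Fin.zero) (zeros (h ∘ Fin.suc) (v≡0 ∘ Fin.suc))
  ∑-tabulate-single {n = suc n} f {v} {z} (Fin.suc j) vj≡z v≡0 =
    ≡.trans (cong₂ ℤ._+_ (v≡0 Fin.zero λ ())
              (∑-tabulate-single (f ∘ Fin.suc) {v} j vj≡z λ i i≢j → v≡0 (Fin.suc i) (i≢j ∘ Fin.suc-injective)))
            (ℤ.+-identityˡ z)

  -- Sums a weighted 0/1 matrix in both orders. With all row and column counts equal to 1 it is
  -- reindexing along a bijection that is known only up to an equivalence; a column or row count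
  -- that is itself an indicator handles an injection that misses some entries. The weights `w` and
  -- `v` are compared on related pairs only, since elsewhere the matrix entry is 0.
  ∑-double-count :
    ∀ {a b p s r} {A : Set a} {B : Set b} {P : A → Set p} {Q : B → Set s} {R : A → B → Set r}
      (R? : ∀ x y → Dec (R x y)) {xs ys} → All P xs → All Q ys → ∀ {k w : A → ℤ} {l v : B → ℤ} →
    (∀ x → P x → (∑[ y ∈ ys ] 𝟙 (R? x y)) ≡ k x) →
    (∀ y → Q y → (∑[ x ∈ xs ] 𝟙 (R? x y)) ≡ l y) →
    (∀ x y → P x → Q y → R x y → w x ≡ v y) →
    (∑[ x ∈ xs ] (k x ℤ.* w x)) ≡ (∑[ y ∈ ys ] (l y ℤ.* v y))
  ∑-double-count {P = P} {Q} R? {xs} {ys} Pxs Qys {k} {w} {l} {v} rows columns w≡v = begin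
    (∑[ x ∈ xs ] (k x ℤ.* w x))
      ≡⟨ ∑-cong-All Pxs (λ x Px → cong (ℤ._* w x) (≡.sym (rows x Px))) ⟩
    (∑[ x ∈ xs ] ((∑[ y ∈ ys ] 𝟙 (R? x y)) ℤ.* w x))
      ≡⟨ ∑-cong xs (λ x → ≡.sym (∑-*ʳ ys (w x) _)) ⟩
    (∑[ x ∈ xs ] ∑[ y ∈ ys ] (𝟙 (R? x y) ℤ.* w x))
      ≡⟨ ∑-cong-All Pxs (λ x Px → ∑-cong-All Qys λ y Qy → weights x y Px Qy) ⟩
    (∑[ x ∈ xs ] ∑[ y ∈ ys ] (𝟙 (R? x y) ℤ.* v y))
      ≡⟨ ∑-swap xs ys _ ⟩
    (∑[ y ∈ ys ] ∑[ x ∈ xs ] (𝟙 (R? x y) ℤ.* v y))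
      ≡⟨ ∑-cong ys (λ y → ∑-*ʳ xs (v y) _) ⟩
    (∑[ y ∈ ys ] ((∑[ x ∈ xs ] 𝟙 (R? x y)) ℤ.* v y))
      ≡⟨ ∑-cong-All Qys (λ y Qy → cong (ℤ._* v y) (columns y Qy)) ⟩
    (∑[ y ∈ ys ] (l y ℤ.* v y)) ∎
    where
    weights : ∀ x y → P x → Q y → 𝟙 (R? x y) ℤ.* w x ≡ 𝟙 (R? x y) ℤ.* v y
    weights x y Px Qy with R? x y
    ... | yes Rxy = cong (1ℤ ℤ.*_) (w≡v x y Px Qy Rxy)
    ... | no  _   = ≡.trans (ℤ.*-zeroˡ (w x)) (≡.sym (ℤ.*-zeroˡ (v y)))

  -- σ exchanges the i with i < σ i and the i with σ i < i.
  fixedPointFree-involution⇒even : ∀ {n} (σ : Fin n → Fin n) → (∀ i → σ (σ i) ≡ i) →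
                                   (∀ i → σ i ≢ i) → 2 ∣ℕ n
  fixedPointFree-involution⇒even {n} σ σσ σ≢ = go
    where
    xs : List (Fin n)
    xs = tabulate id
    below above : Fin n → ℤ
    below i = 𝟙 (i Fin.<? σ i)
    above i = 𝟙 (σ i Fin.<? i)
    dichotomy : ∀ i → 1ℤ ≡ below i ℤ.+ above i
    dichotomy i with Fin.<-cmp i (σ i)
    ... | tri< lt _ ≯ = ≡.sym (cong₂ ℤ._+_ (𝟙-yes (i Fin.<? σ i) lt) (𝟙-no (σ i Fin.<? i) ≯))
    ... | tri≈ _ eq _ = ⊥-elim (σ≢ i (≡.sym eq))
    ... | tri> ≮ _ gt = ≡.sym (cong₂ ℤ._+_ (𝟙-no (i Fin.<? σ i) ≮) (𝟙-yes (σ i Fin.<? i) gt))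
    single : ∀ i → (∑[ j ∈ xs ] 𝟙 (σ i Fin.≟ j)) ≡ 1ℤ
    single i = ∑-tabulate-single id (σ i) (𝟙-yes (σ i Fin.≟ σ i) ≡.refl)
      (λ j j≢ → 𝟙-no (σ i Fin.≟ j) (j≢ ∘ ≡.sym))
    single′ : ∀ j → (∑[ i ∈ xs ] 𝟙 (σ i Fin.≟ j)) ≡ 1ℤ
    single′ j = ∑-tabulate-single id (σ j) (𝟙-yes (σ (σ j) Fin.≟ j) (σσ j))
      (λ i i≢ → 𝟙-no (σ i Fin.≟ j) λ e → i≢ (≡.trans (≡.sym (σσ i)) (cong σ e)))
    trivial : All (λ _ → Fin n) xs
    trivial = All.universal id xs
    below≡above : ∑ xs below ≡ ∑ xs above
    below≡above = begin
      ∑ xs below                        ≡⟨ ∑-cong xs (λ i → ≡.sym (ℤ.*-identityˡ (below i))) ⟩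
      (∑[ i ∈ xs ] (1ℤ ℤ.* below i))    ≡⟨ ∑-double-count (λ i j → σ i Fin.≟ j) trivial trivial
                                             (λ i _ → single i) (λ j _ → single′ j)
                                             (λ { i _ _ _ ≡.refl → cong (λ j → 𝟙 (j Fin.<? σ i)) (≡.sym (σσ i)) }) ⟩
      (∑[ j ∈ xs ] (1ℤ ℤ.* above j))    ≡⟨ ∑-cong xs (λ i → ℤ.*-identityˡ (above i)) ⟩
      ∑ xs above                        ∎
    natural : ∀ (ys : List (Fin n)) → ∃[ m ] ∑ ys below ≡ + m
    natural []       = 0 , ≡.refl
    natural (y ∷ ys) with 𝟙-natural (y Fin.<? σ y) | natural ys
    ... | k , e | m , e′ = k ℕ.+ m , cong₂ ℤ._+_ e e′
    go : 2 ∣ℕ n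
    go with natural xs
    ... | m , e = divides m (ℤ.+-injective (begin
      + n                          ≡⟨ cong +_ (≡.sym (length-tabulate {n = n} id)) ⟩
      + length xs                  ≡⟨ ≡.sym (∑-one xs) ⟩
      (∑[ i ∈ xs ] 1ℤ)             ≡⟨ ∑-cong xs dichotomy ⟩
      (∑[ i ∈ xs ] (below i ℤ.+ above i)) ≡⟨ ∑-+ xs below above ⟩
      ∑ xs below ℤ.+ ∑ xs above    ≡⟨ cong₂ ℤ._+_ e (≡.trans (≡.sym below≡above) e) ⟩
      + (m ℕ.+ m)                  ≡⟨ cong (λ k → + (m ℕ.+ k)) (≡.sym (ℕ.+-identityʳ m)) ⟩
      + (2 ℕ.* m)                  ≡⟨ cong +_ (ℕ.*-comm 2 m) ⟩
      + (m ℕ.* 2)                  ∎))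

open Sums

-- Commutative rings: identities, Bezout data, quotients and fields.

module Rings {c ℓ} (R : CommutativeRing c ℓ) where

  open CommutativeRing R
  open RingProperties ring using (-‿distribˡ-*)
  open SemiringSolver commutativeSemiring
  open SetoidReasoning setoid

  difference-of-squares : ∀ x y → (x - y) * (x + y) ≈ x * x - y * y
  difference-of-squares x y = begin
    (x - y) * (x + y)
      -- The solver knows semirings only, so `- y` enters as an independent variable `z` and the sum
      -- `y + z` is collected to be cancelled afterwards.
      ≈⟨ solve 3 (λ x y z → (x :+ z) :* (x :+ y) := x :* x :+ (y :+ z) :* x :+ z :* y) refl x y (- y) ⟩
    x * x + (y - y) * x + - y * y
      ≈⟨ +-cong (trans (+-congˡ (trans (*-congʳ (-‿inverseʳ y)) (zeroˡ x))) (+-identityʳ _))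
                (sym (-‿distribˡ-* y y)) ⟩
    x * x - y * y ∎

  -- The increment is kept as one product with the factor `e`, so that its top coefficient can later
  -- be read off a single multiplication.
  square-+ : ∀ x e → (x + e) * (x + e) ≈ x * x + e * (e + (x + x))
  square-+ = solve 2 (λ x e → (x :+ e) :* (x :+ e) := x :* x :+ e :* (e :+ (x :+ x))) refl

  x+y≈0⇒x≈-y : ∀ x y → x + y ≈ 0# → x ≈ - y
  x+y≈0⇒x≈-y x y x+y≈0 = begin
    x               ≈⟨ sym (+-identityʳ x) ⟩
    x + 0#          ≈⟨ +-congˡ (sym (-‿inverseʳ y)) ⟩
    x + (y - y)     ≈⟨ sym (+-assoc x y (- y)) ⟩
    x + y - y       ≈⟨ +-congʳ x+y≈0 ⟩
    0# - y          ≈⟨ +-identityˡ _ ⟩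
    - y             ∎

  -- Cubing x a + y b = 1 makes every term divisible by a² or by b².
  coprime-squares : ∀ {a b x y z t} → x * a + y * b ≈ 1# → a * a * t ≈ b * b * z →
                    ∃[ k ] k * (a * a) ≈ z
  coprime-squares {a} {b} {x} {y} {z} {t} xa+yb≈1 a²t≈b²z = U * z + V * t , (begin
    (U * z + V * t) * (a * a)
      ≈⟨ solve 5 (λ u v z t a → (u :* z :+ v :* t) :* (a :* a) := u :* (a :* a) :* z :+ v :* (a :* a :* t)) refl U V z t a ⟩
    U * (a * a) * z + V * (a * a * t)
      ≈⟨ +-congˡ (*-congˡ a²t≈b²z) ⟩
    U * (a * a) * z + V * (b * b * z)
      ≈⟨ solve 5 (λ x y a b z →
           (x :* x :* x :* a :+ (x :* x :* y :* b :+ x :* x :* y :* b :+ x :* x :* y :* b)) :* (a :* a) :* z :+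
           ((x :* y :* y :* a :+ x :* y :* y :* a :+ x :* y :* y :* a) :+ y :* y :* y :* b) :* (b :* b :* z) :=
           (x :* a :+ y :* b) :* (x :* a :+ y :* b) :* (x :* a :+ y :* b) :* z) refl x y a b z ⟩
    (x * a + y * b) * (x * a + y * b) * (x * a + y * b) * z
      ≈⟨ *-congʳ (*-cong (*-cong xa+yb≈1 xa+yb≈1) xa+yb≈1) ⟩
    1# * 1# * 1# * z
      ≈⟨ solve 1 (λ z → con 1 :* con 1 :* con 1 :* z := z) refl z ⟩
    z ∎)
    where
    U V : Carrier
    U = x * x * x * a + (x * x * y * b + x * x * y * b + x * x * y * b)
    V = (x * y * y * a + x * y * y * a + x * y * y * a) + y * y * y * b

  -- The cofactors `a` and `b` are kept as data: after division by the gcd they are the coprime pair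
  -- on which the uniqueness of square parts rests.
  record Bezout (x y : Carrier) : Set (c ⊔ ℓ) where
    field
      gcd a b u v : Carrier
      x-factor    : a * gcd ≈ x
      y-factor    : b * gcd ≈ y
      combination : u * x + v * y ≈ gcd

  bezout-zero : ∀ {x y} → y ≈ 0# → Bezout x y
  bezout-zero {x} {y} y≈0 = record
    { gcd = x ; a = 1# ; b = 0# ; u = 1# ; v = 0#
    ; x-factor = *-identityˡ x
    ; y-factor = trans (zeroˡ x) (sym y≈0)
    ; combination = solve 2 (λ x y → con 1 :* x :+ con 0 :* y := x) refl x y
    }

  bezout-step : ∀ {x y k r} → x ≈ k * y + r → Bezout y r → Bezout x y
  bezout-step {x} {y} {k} {r} x≈ky+r bez = record
    { gcd = gcd ; a = k * a + b ; b = a ; u = v ; v = u - v * k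
    ; x-factor = begin
        (k * a + b) * gcd
          ≈⟨ solve 4 (λ k a b g → (k :* a :+ b) :* g := k :* (a :* g) :+ b :* g) refl k a b gcd ⟩
        k * (a * gcd) + b * gcd       ≈⟨ +-cong (*-congˡ x-factor) y-factor ⟩
        k * y + r                     ≈⟨ sym x≈ky+r ⟩
        x                             ∎
    ; y-factor = x-factor
    ; combination = begin
        v * x + (u - v * k) * y
          ≈⟨ +-congʳ (*-congˡ x≈ky+r) ⟩
        v * (k * y + r) + (u - v * k) * y
          ≈⟨ solve 6 (λ v k y r u n → v :* (k :* y :+ r) :+ (u :+ n) :* y :=
               (v :* k :+ n) :* y :+ (u :* y :+ v :* r)) refl v k y r u (- (v * k)) ⟩
        (v * k - v * k) * y + (u * y + v * r)
          ≈⟨ +-cong (trans (*-congʳ (-‿inverseʳ (v * k))) (zeroˡ y)) combination ⟩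
        0# + gcd
          ≈⟨ +-identityˡ gcd ⟩
        gcd ∎
    }
    where open Bezout bez

  square-multiple-scale : ∀ {k f e u v} → v * u ≈ 1# → k * (f * f) ≈ e →
                          k * (v * v) * (u * f * (u * f)) ≈ e
  square-multiple-scale {k} {f} {e} {u} {v} vu≈1 kf²≈e = begin
    k * (v * v) * (u * f * (u * f))
      ≈⟨ solve 4 (λ k v u f → k :* (v :* v) :* (u :* f :* (u :* f)) := (v :* u) :* (v :* u) :* (k :* (f :* f)))
           refl k v u f ⟩
    (v * u) * (v * u) * (k * (f * f)) ≈⟨ *-cong (*-cong vu≈1 vu≈1) kf²≈e ⟩
    1# * 1# * e                       ≈⟨ solve 1 (λ e → con 1 :* con 1 :* e := e) refl e ⟩
    e                                 ∎

  product-of-squares : ∀ f a b → f * a * (f * a) * b ≈ (a * a * b) * (f * f)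
  product-of-squares = solve 3 (λ f a b → f :* a :* (f :* a) :* b := (a :* a :* b) :* (f :* f)) refl

  unit-multiple : ∀ {a b g x y w} → w * a ≈ 1# → a * g ≈ x → b * g ≈ y → b * w * x ≈ y
  unit-multiple {a} {b} {g} {x} {y} {w} wa≈1 ag≈x bg≈y = begin
    b * w * x         ≈⟨ *-congˡ (sym ag≈x) ⟩
    b * w * (a * g)   ≈⟨ solve 4 (λ a b g w → b :* w :* (a :* g) := (w :* a) :* (b :* g)) refl a b g w ⟩
    (w * a) * (b * g) ≈⟨ *-cong wa≈1 bg≈y ⟩
    1# * y            ≈⟨ *-identityˡ y ⟩
    y                 ∎

module Quotient {c ℓ} (R : CommutativeRing c ℓ) (m : CommutativeRing.Carrier R) where

  open CommutativeRing R
  open RingProperties ring using (-‿distribˡ-*; -‿+-comm)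
  open SemiringSolver commutativeSemiring
  open SetoidReasoning setoid

  infix 4 _≋_
  -- Congruence modulo `m` in the shape produced by division with remainder, so that `divMod` yields
  -- a congruence directly.
  record _≋_ (x y : Carrier) : Set (c ⊔ ℓ) where
    constructor mk
    field
      {quotient} : Carrier
      equation   : x ≈ quotient * m + y
  open _≋_ public

  difference⇒≋ : ∀ {x y k} → k * m ≈ x - y → x ≋ y
  difference⇒≋ {x} {y} {k} km≈x-y = mk (begin
    x               ≈⟨ sym (+-identityʳ x) ⟩
    x + 0#          ≈⟨ +-congˡ (sym (-‿inverseˡ y)) ⟩
    x + (- y + y)   ≈⟨ sym (+-assoc x (- y) y) ⟩
    x - y + y       ≈⟨ +-congʳ (sym km≈x-y) ⟩
    k * m + y       ∎)

  ≋⇒difference : ∀ {x y} → (x≋y : x ≋ y) → quotient x≋y * m ≈ x - y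
  ≋⇒difference {x} {y} (mk {k} e) = begin
    k * m               ≈⟨ sym (+-identityʳ _) ⟩
    k * m + 0#          ≈⟨ +-congˡ (sym (-‿inverseʳ y)) ⟩
    k * m + (y - y)     ≈⟨ sym (+-assoc _ y (- y)) ⟩
    k * m + y - y       ≈⟨ +-congʳ (sym e) ⟩
    x - y               ∎

  multiple⇒≋0 : ∀ {x k} → k * m ≈ x → x ≋ 0#
  multiple⇒≋0 km≈x = mk (trans (sym km≈x) (sym (+-identityʳ _)))

  ≋0⇒multiple : ∀ {x} → (x≋0 : x ≋ 0#) → quotient x≋0 * m ≈ x
  ≋0⇒multiple (mk e) = sym (trans e (+-identityʳ _))

  ≈⇒≋ : ∀ {x y} → x ≈ y → x ≋ y
  ≈⇒≋ {x} {y} x≈y = mk {quotient = 0#} (trans x≈y (solve 2 (λ m y → y := con 0 :* m :+ y) refl m y))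

  ≋-sym : ∀ {x y} → x ≋ y → y ≋ x
  ≋-sym {x} {y} (mk {k} e) = mk (begin
    y                              ≈⟨ sym (+-identityˡ y) ⟩
    0# + y                         ≈⟨ +-congʳ (sym (-‿inverseˡ (k * m))) ⟩
    (- (k * m) + k * m) + y        ≈⟨ +-assoc _ _ _ ⟩
    - (k * m) + (k * m + y)        ≈⟨ +-cong (-‿distribˡ-* k m) (sym e) ⟩
    - k * m + x                    ∎)

  ≋-trans : ∀ {x y z} → x ≋ y → y ≋ z → x ≋ z
  ≋-trans {z = z} (mk {k} e) (mk {l} e′) = mk (trans e (trans (+-congˡ e′)
    (solve 4 (λ k l m z → k :* m :+ (l :* m :+ z) := (k :+ l) :* m :+ z) refl k l m z)))

  -- The carrier and operations stay the same and only equality becomes coarser, so a polynomial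
  -- serves as its own residue class.
  ring/ : CommutativeRing c (c ⊔ ℓ)
  ring/ = record
    { Carrier = Carrier
    ; _≈_     = _≋_
    ; _+_     = _+_
    ; _*_     = _*_
    ; -_      = -_
    ; 0#      = 0#
    ; 1#      = 1#
    ; isCommutativeRing = record
      { isRing = record
        { +-isAbelianGroup = record
          { isGroup = record
            { isMonoid = record
              { isSemigroup = record
                { isMagma = record
                  { isEquivalence = record { refl = ≈⇒≋ refl ; sym = ≋-sym ; trans = ≋-trans }
                  ; ∙-cong = λ {x} {y} {u} {v} (mk {k} e) (mk {l} e′) → mk (trans (+-cong e e′)
                      (solve 5 (λ k l m y v → (k :* m :+ y) :+ (l :* m :+ v) := (k :+ l) :* m :+ (y :+ v))
                        refl k l m y v))
                  }
                ; assoc = λ x y z → ≈⇒≋ (+-assoc x y z)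
                }
              ; identity = (λ x → ≈⇒≋ (+-identityˡ x)) , λ x → ≈⇒≋ (+-identityʳ x)
              }
            ; inverse = (λ x → ≈⇒≋ (-‿inverseˡ x)) , λ x → ≈⇒≋ (-‿inverseʳ x)
            ; ⁻¹-cong = λ {x} {y} (mk {k} e) → mk (begin
                - x                ≈⟨ -‿cong e ⟩
                - (k * m + y)      ≈⟨ sym (-‿+-comm (k * m) y) ⟩
                - (k * m) - y      ≈⟨ +-congʳ (-‿distribˡ-* k m) ⟩
                - k * m - y        ∎)
            }
          ; comm = λ x y → ≈⇒≋ (+-comm x y)
          }
        ; *-cong = λ {x} {y} {u} {v} (mk {k} e) (mk {l} e′) → mk (trans (*-cong e e′)
            (solve 5 (λ k l m y v → (k :* m :+ y) :* (l :* m :+ v) :=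
              (k :* (l :* m) :+ k :* v :+ y :* l) :* m :+ y :* v) refl k l m y v))
        ; *-assoc = λ x y z → ≈⇒≋ (*-assoc x y z)
        ; *-identity = (λ x → ≈⇒≋ (*-identityˡ x)) , λ x → ≈⇒≋ (*-identityʳ x)
        ; distrib = (λ x y z → ≈⇒≋ (distribˡ x y z)) , λ x y z → ≈⇒≋ (distribʳ x y z)
        }
      ; *-comm = λ x y → ≈⇒≋ (*-comm x y)
      }
    }

Invertible : ∀ {c ℓ} (K : CommutativeRing c ℓ) → CommutativeRing.Carrier K → Set (c ⊔ ℓ)
Invertible K x = ∃[ y ] y * x ≈ 1#
  where open CommutativeRing K

module DiscreteField {c ℓ} (K : CommutativeRing c ℓ)
  (invert : ∀ x → CommutativeRing._≈_ K x (CommutativeRing.0# K) ⊎ Invertible K x) where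

  open CommutativeRing K
  open Rings K
  open RingProperties ring using (x≈y⇒x∙y⁻¹≈ε; x∙y⁻¹≈ε⇒x≈y)
  open SemiringSolver commutativeSemiring
  open SetoidReasoning setoid

  integral : ∀ {x y} → x * y ≈ 0# → x ≈ 0# ⊎ y ≈ 0#
  integral {x} {y} xy≈0 with invert x
  ... | inj₁ x≈0        = inj₁ x≈0
  ... | inj₂ (u , ux≈1) = inj₂ (begin
    y             ≈⟨ sym (*-identityˡ y) ⟩
    1# * y        ≈⟨ *-congʳ (sym ux≈1) ⟩
    u * x * y     ≈⟨ *-assoc u x y ⟩
    u * (x * y)   ≈⟨ *-congˡ xy≈0 ⟩
    u * 0#        ≈⟨ zeroʳ u ⟩
    0#            ∎)

  square-zero : ∀ {x} → x * x ≈ 0# → x ≈ 0#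
  square-zero x²≈0 = [ (λ e → e) , (λ e → e) ]′ (integral x²≈0)

  equal-squares : ∀ {x y} → x * x ≈ y * y → x ≈ y ⊎ x ≈ - y
  equal-squares {x} {y} x²≈y² = Sum.map (x∙y⁻¹≈ε⇒x≈y x y) (x+y≈0⇒x≈-y x y)
    (integral (trans (difference-of-squares x y) (x≈y⇒x∙y⁻¹≈ε x²≈y²)))

  square-*⇒square : ∀ {x y f u} → u * x ≈ 1# → x * x * y ≈ f * f → y ≈ u * f * (u * f)
  square-*⇒square {x} {y} {f} {u} ux≈1 x²y≈f² = begin
    y                       ≈⟨ solve 1 (λ y → y := con 1 :* con 1 :* y) refl y ⟩
    1# * 1# * y             ≈⟨ *-congʳ (*-cong (sym ux≈1) (sym ux≈1)) ⟩
    u * x * (u * x) * y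
      ≈⟨ solve 3 (λ u x y → u :* x :* (u :* x) :* y := u :* u :* (x :* x :* y)) refl u x y ⟩
    u * u * (x * x * y)     ≈⟨ *-congˡ x²y≈f² ⟩
    u * u * (f * f)         ≈⟨ solve 2 (λ u f → u :* u :* (f :* f) := u :* f :* (u :* f)) refl u f ⟩
    u * f * (u * f)         ∎

-- Polynomials over a finite field: degrees, monic polynomials, sums over cosets.

module FinitePolynomialProperties {c ℓ₁ ℓ₂ q} (F : FiniteField c ℓ₁ ℓ₂ q) where

  open FiniteField F
  open Inverse enumeration using (to; from; to-cong; strictlyInverseˡ; strictlyInverseʳ)
  open CommutativeRing commutativeRing hiding (isCommutativeRing)
  open FinitePolynomials F
  module F- = RingProperties ring
  open F- using (-0#≈0#)
  module A = CommutativeRing R[T]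
  module A- = RingProperties A.ring

  bounded-cong : ∀ {n p r} → p ≈ₚ r → Bounded n p → Bounded n r
  bounded-cong p≈r bnd i n≤i = trans (sym (at p≈r i)) (bnd i n≤i)

  bounded-≤ : ∀ {m n} p → m ℕ.≤ n → Bounded m p → Bounded n p
  bounded-≤ p m≤n bnd i n≤i = bnd i (ℕ.≤-trans m≤n n≤i)

  bounded-+ : ∀ {n} p r → Bounded n p → Bounded n r → Bounded n (p +ₚ r)
  bounded-+ p r bp br i n≤i =
    trans (coeff-+ p r i) (trans (+-cong (bp i n≤i) (br i n≤i)) (+-identityˡ 0#))

  bounded-neg : ∀ {n} p → Bounded n p → Bounded n (-ₚ p)
  bounded-neg p bp i n≤i = trans (coeff-neg p i) (trans (-‿cong (bp i n≤i)) -0#≈0#)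

  -- The asymmetric bounds make this sharp without predecessors: degrees below `m` and at most `n`
  -- give a product of degree below `m + n`. In particular a polynomial of degree below g has a
  -- square without a coefficient at 2g - 1.
  bounded-* : ∀ {m n} p r → Bounded m p → Bounded (suc n) r → Bounded (m ℕ.+ n) (p *ₚ r)
  bounded-* []                  r bp br i       _ = refl
  bounded-* {zero}      (a ∷ p) r bp br i       _ =
    at (A.trans (A.*-congʳ {r} {a ∷ p} {0ₚ} (mk λ j → bp j z≤n)) (A.zeroˡ r)) i
  bounded-* {suc m} {n} (a ∷ p) r bp br (suc i) (s≤s m+n≤i) = begin
    coeff (map (a *_) r +ₚ (0# ∷ p *ₚ r)) (suc i)
      ≈⟨ coeff-+ (map (a *_) r) (0# ∷ p *ₚ r) (suc i) ⟩
    coeff (map (a *_) r) (suc i) + coeff (p *ₚ r) i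
      ≈⟨ +-cong (coeff-scale a r (suc i)) (bounded-* p r (λ j m≤j → bp (suc j) (s≤s m≤j)) br i m+n≤i) ⟩
    a * coeff r (suc i) + 0#
      ≈⟨ +-identityʳ _ ⟩
    a * coeff r (suc i)
      ≈⟨ *-congˡ (br (suc i) (s≤s (ℕ.≤-trans (ℕ.m≤n+m n m) m+n≤i))) ⟩
    a * 0#
      ≈⟨ zeroʳ a ⟩
    0# ∎
    where open SetoidReasoning setoid

  deg-unique : ∀ {n} p → ¬ (coeff p n ≈ 0#) → Bounded (suc n) p → deg p ≡ n
  deg-unique {n} p pₙ≉0 bnd = ℕ.≤-antisym
    (ℕ.≮⇒≥ λ n<deg → lead-nonzero {p} (λ p≈0 → pₙ≉0 (at p≈0 n)) (bnd _ n<deg))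
    (ℕ.≮⇒≥ λ deg<n → pₙ≉0 (deg-bounded p n deg<n))

  deg-zero : ∀ p → p ≈ₚ 0ₚ → deg p ≡ 0
  deg-zero []      _     = ≡.refl
  deg-zero (a ∷ p) a∷p≈0 with zero? p
  ... | yes _   = ≡.refl
  ... | no  p≉0 = ⊥-elim (p≉0 (mk (at a∷p≈0 ∘ suc)))

  deg-cong : ∀ {p r} → ¬ (p ≈ₚ 0ₚ) → p ≈ₚ r → deg p ≡ deg r
  deg-cong {p} {r} p≉0 p≈r = ≡.sym (deg-unique r
    (λ e → lead-nonzero {p} p≉0 (trans (at p≈r _) e)) (bounded-cong p≈r (deg-bounded p)))

  *ₚ-nonzero : ∀ {p r} → ¬ (p ≈ₚ 0ₚ) → ¬ (r ≈ₚ 0ₚ) → ¬ (p *ₚ r ≈ₚ 0ₚ)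
  *ₚ-nonzero {p} {r} p≉0 r≉0 pr≈0 = *-nonzero (lead-nonzero {p} p≉0) (lead-nonzero {r} r≉0)
    (trans (sym (coeff-*-top p r)) (at pr≈0 (deg p ℕ.+ deg r)))

  deg-* : ∀ {p r} → ¬ (p ≈ₚ 0ₚ) → ¬ (r ≈ₚ 0ₚ) → deg (p *ₚ r) ≡ deg p ℕ.+ deg r
  deg-* {p} {r} p≉0 r≉0 = deg-unique (p *ₚ r)
    (λ e → *-nonzero (lead-nonzero {p} p≉0) (lead-nonzero {r} r≉0) (trans (sym (coeff-*-top p r)) e))
    (bounded-* p r (deg-bounded p) (deg-bounded r))

  *ₚ-cancelˡ : ∀ p {x y} → ¬ (p ≈ₚ 0ₚ) → p *ₚ x ≈ₚ p *ₚ y → x ≈ₚ y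
  *ₚ-cancelˡ p {x} {y} p≉0 px≈py with zero? (x +ₚ -ₚ y)
  ... | yes x-y≈0 = A-.x∙y⁻¹≈ε⇒x≈y x y x-y≈0
  ... | no  x-y≉0 = ⊥-elim (*ₚ-nonzero {p} p≉0 x-y≉0
    (A.trans (A-.x[y-z]≈xy-xz p x y) (A-.x≈y⇒x∙y⁻¹≈ε px≈py)))

  monic⇒nonzero : ∀ {p} → Monic p → ¬ (p ≈ₚ 0ₚ)
  monic⇒nonzero {p} monic p≈0 = 1≉0 (trans (sym monic) (at p≈0 (deg p)))

  monic-* : ∀ {p r} → Monic p → Monic r → Monic (p *ₚ r)
  monic-* {p} {r} p-monic r-monic =
    trans (reflexive (cong (coeff (p *ₚ r)) (deg-* {p} {r} (monic⇒nonzero {p} p-monic) (monic⇒nonzero {r} r-monic))))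
      (trans (coeff-*-top p r) (trans (*-cong p-monic r-monic) (*-identityˡ 1#)))

  monic-cong : ∀ {p r} → p ≈ₚ r → Monic p → Monic r
  monic-cong {p} {r} p≈r p-monic =
    trans (reflexive (cong (coeff r) (≡.sym (deg-cong {p} {r} (monic⇒nonzero {p} p-monic) p≈r))))
      (trans (sym (at p≈r (deg p))) p-monic)

  1ₚ-monic : Monic 1ₚ
  1ₚ-monic = refl

  monic-quotient : ∀ {p r} → Monic p → Monic (p *ₚ r) → Monic r
  monic-quotient {p} {r} p-monic pr-monic with zero? r
  ... | yes r≈0 = ⊥-elim (monic⇒nonzero {p *ₚ r} pr-monic (A.trans (A.*-congˡ {p} r≈0) (A.zeroʳ p)))
  ... | no  r≉0 = begin
    lead r              ≈⟨ sym (*-identityˡ (lead r)) ⟩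
    1# * lead r         ≈⟨ *-congʳ (sym p-monic) ⟩
    lead p * lead r     ≈⟨ sym (coeff-*-top p r) ⟩
    coeff (p *ₚ r) (deg p ℕ.+ deg r)
      ≡⟨ cong (coeff (p *ₚ r)) (≡.sym (deg-* {p} {r} (monic⇒nonzero {p} p-monic) r≉0)) ⟩
    lead (p *ₚ r)       ≈⟨ pr-monic ⟩
    1#                  ∎
    where open SetoidReasoning setoid

  deg≡0⇒unit : ∀ {p} → ¬ (p ≈ₚ 0ₚ) → deg p ≡ 0 → p ∣ 1ₚ
  deg≡0⇒unit {p} p≉0 deg≡0 = [ u ] , A.trans (A.*-congˡ {[ u ]} constant) u*lead
    where
    u : Carrier
    u = proj₁ (inverse (lead-nonzero {p} p≉0))
    constant : p ≈ₚ [ lead p ]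
    constant = mk λ
      { zero    → reflexive (cong (coeff p) (≡.sym deg≡0))
      ; (suc i) → deg-bounded p (suc i) (s≤s (ℕ.≤-trans (ℕ.≤-reflexive deg≡0) z≤n)) }
    u*lead : [ u ] *ₚ [ lead p ] ≈ₚ 1ₚ
    u*lead = ∷-cong (trans (+-identityʳ _) (proj₂ (inverse (lead-nonzero {p} p≉0)))) A.refl

  unit⇒deg≡0 : ∀ {p} → p ∣ 1ₚ → deg p ≡ 0
  unit⇒deg≡0 {p} (k , kp≈1) = ℕ.n≤0⇒n≡0 (ℕ.≤-trans (ℕ.m≤n+m (deg p) (deg k)) (ℕ.s≤s⁻¹
    (factor-degree k p kp≈1 (λ 1≈0 → 1≉0 (at 1≈0 0)) (bounded-length 1ₚ))))

  monic-unit : ∀ {p} → Monic p → deg p ≡ 0 → p ≈ₚ 1ₚ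
  monic-unit {p} p-monic deg≡0 = mk λ
    { zero    → trans (reflexive (cong (coeff p) (≡.sym deg≡0))) p-monic
    ; (suc i) → deg-bounded p (suc i) (s≤s (ℕ.≤-trans (ℕ.≤-reflexive deg≡0) z≤n)) }

  normalise : ∀ {p} → ¬ (p ≈ₚ 0ₚ) → ∃[ u ] (Monic ([ u ] *ₚ p) × deg ([ u ] *ₚ p) ≡ deg p × [ u ] ∣ 1ₚ)
  normalise {p} p≉0 = u , monic , degree , deg≡0⇒unit {[ u ]} u≉0 deg-u
    where
    u : Carrier
    u = proj₁ (inverse (lead-nonzero {p} p≉0))
    u*lead : u * lead p ≈ 1#
    u*lead = proj₂ (inverse (lead-nonzero {p} p≉0))
    u≉0 : ¬ ([ u ] ≈ₚ 0ₚ)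
    u≉0 [u]≈0 = 1≉0 (trans (sym u*lead) (trans (*-congʳ (at [u]≈0 0)) (zeroˡ _)))
    deg-u : deg [ u ] ≡ 0
    deg-u = ≡.refl
    degree : deg ([ u ] *ₚ p) ≡ deg p
    degree = deg-* {[ u ]} {p} u≉0 p≉0
    monic : Monic ([ u ] *ₚ p)
    monic = trans (reflexive (cong (coeff ([ u ] *ₚ p)) degree)) (trans (coeff-*-top [ u ] p) u*lead)

  small-multiple : ∀ {P z} → P ∣ z → Bounded (deg P) z → z ≈ₚ 0ₚ
  small-multiple {P} {z} (k , kP≈z) bnd with zero? z
  ... | yes z≈0 = z≈0
  ... | no  z≉0 = ⊥-elim (ℕ.<⇒≱ (factor-degree k P kP≈z z≉0 bnd) (ℕ.m≤n+m (deg P) (deg k)))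

  shift : ℕ → Poly → Poly
  shift zero    p = p
  shift (suc k) p = 0# ∷ shift k p

  shift-cong : ∀ k {p r} → p ≈ₚ r → shift k p ≈ₚ shift k r
  shift-cong zero    p≈r = p≈r
  shift-cong (suc k) p≈r = ∷-cong refl (shift-cong k p≈r)

  coeff-shift : ∀ k p i → coeff (shift k p) (k ℕ.+ i) ≡ coeff p i
  coeff-shift zero    p i = ≡.refl
  coeff-shift (suc k) p i = coeff-shift k p i

  coeff-shift-* : ∀ k c p i → coeff (shift k [ c ] *ₚ p) (k ℕ.+ i) ≈ c * coeff p i
  coeff-shift-* zero    c p i = trans (coeff-+ (map (c *_) p) (0# ∷ []) i)
    (trans (+-cong (coeff-scale c p i) (zero-at i)) (+-identityʳ _))
    where
    zero-at : ∀ i → coeff (0# ∷ []) i ≈ 0#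
    zero-at zero    = refl
    zero-at (suc i) = refl
  coeff-shift-* (suc k) c p i = trans (coeff-+ (map (0# *_) p) _ (suc (k ℕ.+ i)))
    (trans (+-cong (trans (coeff-scale 0# p (suc (k ℕ.+ i))) (zeroˡ _)) (coeff-shift-* k c p i)) (+-identityˡ _))

  -- The coset of `T^n t` modulo the polynomials of degree below `n`. The choice `t = 0` gives the
  -- residues and `t = 1` the monics of degree `n`, so both are handled by the same lemmas.
  InCoset : ℕ → Poly → Poly → Set ℓ₁
  InCoset n t p = ∀ i → coeff p (n ℕ.+ i) ≈ coeff t i

  elements : List Carrier
  elements = tabulate from

  coset : ℕ → Poly → List Poly
  coset zero    t = [ t ]
  coset (suc n) t = cartesianProductWith _∷_ elements (coset n t)

  residues : ℕ → List Poly
  residues n = coset n 0ₚ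

  monics≡coset : ∀ n → monics n ≡ coset n 1ₚ
  monics≡coset zero    = ≡.refl
  monics≡coset (suc n) = cong (cartesianProductWith _∷_ elements) (monics≡coset n)

  coset-sound : ∀ n t → All (InCoset n t) (coset n t)
  coset-sound zero    t = (λ _ → refl) ∷ []
  coset-sound (suc n) t = All.cartesianProductWith⁺ (≡.setoid _) (≡.setoid _) _∷_ elements (coset n t)
    (λ _ p∈ → All.lookup (coset-sound n t) p∈)

  head∷tail : ∀ p → p ≈ₚ coeff p 0 ∷ drop 1 p
  head∷tail []      = A.sym (zero-∷ refl A.refl)
  head∷tail (a ∷ p) = A.refl

  coeff-drop : ∀ p i → coeff (drop 1 p) i ≡ coeff p (suc i)
  coeff-drop []      i = ≡.refl
  coeff-drop (a ∷ p) i = ≡.refl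

  inCoset-drop : ∀ {n t} p → InCoset (suc n) t p → InCoset n t (drop 1 p)
  inCoset-drop {n} p h i = trans (reflexive (coeff-drop p (n ℕ.+ i))) (h i)

  coset-complete : ∀ n t p → InCoset n t p → Any (_≈ₚ p) (coset n t)
  coset-complete zero    t p h = here (mk λ i → sym (h i))
  coset-complete (suc n) t p h = Any.cartesianProductWith⁺ _∷_
    (λ e e′ → A.trans (∷-cong e e′) (A.sym (head∷tail p)))
    (Any.tabulate⁺ (to (coeff p 0)) (strictlyInverseʳ (coeff p 0)))
    (coset-complete n t (drop 1 p) (inCoset-drop {t = t} p h))

  inCoset⇒bounded : ∀ {n p} → InCoset n 0ₚ p → Bounded n p
  inCoset⇒bounded {n} {p} h i n≤i = trans (reflexive (cong (coeff p) (≡.sym (ℕ.m+[n∸m]≡n n≤i)))) (h (i ℕ.∸ n))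

  bounded⇒inCoset : ∀ {n} p → Bounded n p → InCoset n 0ₚ p
  bounded⇒inCoset {n} p bnd i = bnd (n ℕ.+ i) (ℕ.m≤m+n n i)

  inCoset⇒monic : ∀ {n} p → InCoset n 1ₚ p → Monic p × deg p ≡ n
  inCoset⇒monic {n} p h = trans (reflexive (cong (coeff p) degree)) top , degree
    where
    top : coeff p n ≈ 1#
    top = trans (reflexive (cong (coeff p) (≡.sym (ℕ.+-identityʳ n)))) (h 0)
    degree : deg p ≡ n
    degree = deg-unique p (λ e → 1≉0 (trans (sym top) e)) λ i n<i → trans
      (reflexive (cong (coeff p) (≡.sym (≡.trans (ℕ.+-suc n (i ℕ.∸ suc n)) (ℕ.m+[n∸m]≡n n<i)))))
      (h (suc (i ℕ.∸ suc n)))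

  monic⇒inCoset : ∀ {n} p → Monic p → deg p ≡ n → InCoset n 1ₚ p
  monic⇒inCoset p p-monic ≡.refl zero    = trans (reflexive (cong (coeff p) (ℕ.+-identityʳ (deg p)))) p-monic
  monic⇒inCoset p p-monic ≡.refl (suc i) =
    deg-bounded p _ (ℕ.≤-trans (s≤s (ℕ.m≤m+n (deg p) i)) (ℕ.≤-reflexive (≡.sym (ℕ.+-suc (deg p) i))))

  ∑-coset-suc : ∀ n t v → ∑ (coset (suc n) t) v ≡ (∑[ a ∈ elements ] ∑[ p ∈ coset n t ] v (a ∷ p))
  ∑-coset-suc n t v = ∑-cartesianProductWith _∷_ elements (coset n t) v

  length-elements : length elements ≡ q
  length-elements = length-tabulate from

  ∑-coset-one : ∀ n t → (∑[ p ∈ coset n t ] 1ℤ) ≡ + (q ℕ.^ n)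
  ∑-coset-one zero    t = ≡.refl
  ∑-coset-one (suc n) t = begin
    (∑[ p ∈ coset (suc n) t ] 1ℤ)                 ≡⟨ ∑-coset-suc n t (λ _ → 1ℤ) ⟩
    (∑[ a ∈ elements ] ∑[ p ∈ coset n t ] 1ℤ)     ≡⟨ ∑-const elements _ ⟩
    + length elements ℤ.* (∑[ p ∈ coset n t ] 1ℤ)
      ≡⟨ cong₂ ℤ._*_ (cong +_ length-elements) (∑-coset-one n t) ⟩
    + q ℤ.* + (q ℕ.^ n)                           ≡⟨ ≡.sym (ℤ.pos-* q (q ℕ.^ n)) ⟩
    + (q ℕ.^ suc n)                               ∎
    where open ≡.≡-Reasoning

  ∑-elements-single : ∀ {v z} y → (∀ x → x ≈ y → v x ≡ z) → (∀ x → ¬ (x ≈ y) → v x ≡ 0ℤ) →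
                      ∑ elements v ≡ z
  ∑-elements-single {v} y v≡z v≡0 = ∑-tabulate-single from {v} (to y) (v≡z _ (strictlyInverseʳ y))
    λ i i≢ → v≡0 _ λ e → i≢ (≡.trans (≡.sym (strictlyInverseˡ i)) (to-cong e))

  -- This expresses that the coset list meets each class of `_≈ₚ_` exactly once. The induction
  -- compares one coefficient at a time, and a wrong constant coefficient kills the whole inner sum.
  ∑-coset-single : ∀ {n t v z} r → InCoset n t r →
                   (∀ p → InCoset n t p → p ≈ₚ r → v p ≡ z) →
                   (∀ p → InCoset n t p → ¬ (p ≈ₚ r) → v p ≡ 0ℤ) → ∑ (coset n t) v ≡ z
  ∑-coset-single {zero} {t} r h v≡z v≡0 =
    ≡.trans (ℤ.+-identityʳ _) (v≡z t (λ _ → refl) (mk λ i → sym (h i)))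
  ∑-coset-single {suc n} {t} {v} r h v≡z v≡0 = ≡.trans (∑-coset-suc n t v)
    (∑-elements-single (coeff r 0)
      (λ a a≈ → ∑-coset-single (drop 1 r) (inCoset-drop {t = t} r h)
        (λ p p∈ p≈ → v≡z (a ∷ p) p∈ (A.trans (∷-cong a≈ p≈) (A.sym (head∷tail r))))
        (λ p p∈ p≉ → v≡0 (a ∷ p) p∈ λ e → p≉ (mk λ i → trans (at e (suc i)) (reflexive (≡.sym (coeff-drop r i))))))
      (λ a a≉ → ≡.trans
        (∑-cong-All (coset-sound n t) λ p p∈ → v≡0 (a ∷ p) p∈ λ e → a≉ (at e 0))
        (∑-zero (coset n t))))

  ∑-coset-𝟙 : ∀ {n t p} {R : Poly → Set p} (R? : ∀ x → Dec (R x)) r → InCoset n t r →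
              (∀ x → InCoset n t x → x ≈ₚ r → R x) → (∀ x → InCoset n t x → R x → x ≈ₚ r) →
              (∑[ x ∈ coset n t ] 𝟙 (R? x)) ≡ 1ℤ
  ∑-coset-𝟙 R? r r∈ R⇐ R⇒ = ∑-coset-single r r∈
    (λ x x∈ x≈r → 𝟙-yes (R? x) (R⇐ x x∈ x≈r)) (λ x x∈ x≉r → 𝟙-no (R? x) (x≉r ∘ R⇒ x x∈))

  ∑-𝟙-none : ∀ {n t p} {R : Poly → Set p} (R? : ∀ x → Dec (R x)) →
             (∀ x → InCoset n t x → ¬ R x) → (∑[ x ∈ coset n t ] 𝟙 (R? x)) ≡ 0ℤ
  ∑-𝟙-none {n} {t} R? none = ≡.trans
    (∑-cong-All (coset-sound n t) λ x x∈ → 𝟙-no (R? x) (none x x∈)) (∑-zero (coset n t))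

  Respectful : (Poly → ℤ) → Set _
  Respectful w = ∀ {x y} → x ≈ₚ y → w x ≡ w y

  -- Adding `u` permutes the classes but need not send entries to entries. The relation
  -- `p +ₚ u ≈ₚ r` has exactly one entry in each row, at `p +ₚ u`, and in each column, at
  -- `r +ₚ -ₚ u`.
  ∑-translate : ∀ {n w} → Respectful w → ∀ u → Bounded n u →
                (∑[ p ∈ residues n ] w (p +ₚ u)) ≡ ∑ (residues n) w
  ∑-translate {n} {w} w-resp u u-bnd = begin
    (∑[ p ∈ residues n ] w (p +ₚ u))
      ≡⟨ ∑-cong (residues n) (λ p → ≡.sym (ℤ.*-identityˡ _)) ⟩
    (∑[ p ∈ residues n ] (1ℤ ℤ.* w (p +ₚ u)))
      ≡⟨ ∑-double-count (λ p r → p +ₚ u ≟ₚ r) (coset-sound n 0ₚ) (coset-sound n 0ₚ)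
           (λ p p∈ → ∑-coset-𝟙 (p +ₚ u ≟ₚ_) (p +ₚ u)
             (bounded⇒inCoset (p +ₚ u) (bounded-+ p u (inCoset⇒bounded {p = p} p∈) u-bnd))
             (λ _ _ → A.sym) (λ _ _ → A.sym))
           (λ r r∈ → ∑-coset-𝟙 (λ p → p +ₚ u ≟ₚ r) (r +ₚ -ₚ u)
             (bounded⇒inCoset (r +ₚ -ₚ u) (bounded-+ r (-ₚ u) (inCoset⇒bounded {p = r} r∈) (bounded-neg u u-bnd)))
             (λ x _ x≈ → A.trans (A.+-congʳ {u} x≈) (cancel r (-ₚ u) u (A.-‿inverseˡ u)))
             (λ x _ x+u≈r → A.trans (A.sym (cancel x u (-ₚ u) (A.-‿inverseʳ u))) (A.+-congʳ { -ₚ u} x+u≈r)))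
           (λ _ _ _ _ → w-resp) ⟩
    (∑[ r ∈ residues n ] (1ℤ ℤ.* w r))
      ≡⟨ ∑-cong (residues n) (λ r → ℤ.*-identityˡ _) ⟩
    ∑ (residues n) w ∎
    where
    open ≡.≡-Reasoning
    cancel : ∀ x y z → y +ₚ z ≈ₚ 0ₚ → x +ₚ y +ₚ z ≈ₚ x
    cancel x y z e = A.trans (A.+-assoc x y z) (A.trans (A.+-congˡ {x} e) (A.+-identityʳ x))

  ∑-coset-+ : ∀ m {n t w} → Respectful w →
              ∑ (coset (m ℕ.+ n) t) w ≡ (∑[ a ∈ residues m ] ∑[ b ∈ coset n t ] w (a +ₚ shift m b))
  ∑-coset-+ zero    {n} {t} {w} w-resp = ≡.sym (ℤ.+-identityʳ _)
  ∑-coset-+ (suc m) {n} {t} {w} w-resp = begin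
    ∑ (coset (suc m ℕ.+ n) t) w
      ≡⟨ ∑-coset-suc (m ℕ.+ n) t w ⟩
    (∑[ x ∈ elements ] ∑[ p ∈ coset (m ℕ.+ n) t ] w (x ∷ p))
      ≡⟨ ∑-cong elements (λ x → ∑-coset-+ m (λ e → w-resp (∷-cong refl e))) ⟩
    (∑[ x ∈ elements ] ∑[ a ∈ residues m ] ∑[ b ∈ coset n t ] w (x ∷ (a +ₚ shift m b)))
      -- `shift (suc m) b` begins with `0#`, so the sum on the next line begins with `x + 0#`
      -- instead of `x`.
      ≡⟨ ∑-cong elements (λ x → ∑-cong (residues m) λ a → ∑-cong (coset n t) λ b →
           w-resp (∷-cong (sym (+-identityʳ x)) A.refl)) ⟩
    (∑[ x ∈ elements ] ∑[ a ∈ residues m ] ∑[ b ∈ coset n t ] w ((x ∷ a) +ₚ shift (suc m) b))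
      ≡⟨ ≡.sym (∑-coset-suc m 0ₚ _) ⟩
    (∑[ a ∈ residues (suc m) ] ∑[ b ∈ coset n t ] w (a +ₚ shift (suc m) b)) ∎
    where open ≡.≡-Reasoning

-- Decomposition into a square and a square-free part.

module SquareParts {c ℓ₁ ℓ₂ q} (F : FiniteField c ℓ₁ ℓ₂ q) where

  open FiniteField F
  open CommutativeRing commutativeRing hiding (isCommutativeRing)
  open FinitePolynomials F
  open FinitePolynomialProperties F
  open Rings R[T]
    using (Bezout; bezout-zero; bezout-step; coprime-squares; square-multiple-scale;
           product-of-squares; unit-multiple)

  -- Euclid's algorithm by induction on the bound `n`: for nonzero `g` the remainder has degree
  -- below `deg g`, and `deg g` is at most the smaller bound.
  bezout : ∀ n f g → Bounded n g → Bezout f g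
  bezout n f g g-bnd with zero? g
  bezout n       f g g-bnd | yes g≈0 = bezout-zero g≈0
  bezout zero    f g g-bnd | no  g≉0 = ⊥-elim (g≉0 (mk λ i → g-bnd i z≤n))
  bezout (suc n) f g g-bnd | no  g≉0 =
    let (k , r , r-bnd , f≈kg+r) = divMod g g≉0 f
    in bezout-step {k = k} f≈kg+r (bezout n g r (bounded-≤ r deg≤n r-bnd))
    where
    deg≤n : deg g ℕ.≤ n
    deg≤n = ℕ.≮⇒≥ λ n<deg → lead-nonzero {g} g≉0 (g-bnd (deg g) n<deg)

  deg-∣ : ∀ {f g} → f ∣ g → ¬ (g ≈ₚ 0ₚ) → deg f ℕ.≤ deg g
  deg-∣ {f} {g} (k , kf≈g) g≉0 =
    ℕ.≤-trans (ℕ.m≤n+m (deg f) (deg k)) (ℕ.s≤s⁻¹ (factor-degree k f kf≈g g≉0 (deg-bounded g)))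

  -- The degrees agree, so the leading terms cancel and `f - g` is a multiple of `f` of smaller
  -- degree, hence zero.
  monic-associates : ∀ {f g} → Monic f → Monic g → f ∣ g → g ∣ f → f ≈ₚ g
  monic-associates {f} {g} f-monic g-monic (k , kf≈g) g∣f =
    A-.x∙y⁻¹≈ε⇒x≈y f g (small-multiple {f} f∣f-g bounded)
    where
    degrees : deg f ≡ deg g
    degrees = ℕ.≤-antisym (deg-∣ {f} {g} (k , kf≈g) (monic⇒nonzero {g} g-monic))
                          (deg-∣ {g} {f} g∣f (monic⇒nonzero {f} f-monic))
    f∣f-g : f ∣ f +ₚ -ₚ g
    f∣f-g = 1ₚ +ₚ -ₚ k , A.trans (A-.[y-z]x≈yx-zx f 1ₚ k)
      (A.+-cong (A.*-identityˡ f) (A.-‿cong kf≈g))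
    bounded : Bounded (deg f) (f +ₚ -ₚ g)
    bounded i n≤i = trans (coeff-+ f (-ₚ g) i) (trans (+-congˡ (coeff-neg g i)) (go (ℕ.m≤n⇒m<n∨m≡n n≤i)))
      where
      go : deg f ℕ.< i ⊎ deg f ≡ i → coeff f i - coeff g i ≈ 0#
      go (inj₁ n<i)    = trans (+-cong (deg-bounded f i n<i)
        (-‿cong (deg-bounded g i (≡.subst (ℕ._< i) degrees n<i)))) (-‿inverseʳ 0#)
      go (inj₂ ≡.refl) = trans (+-cong f-monic
        (-‿cong (trans (reflexive (cong (coeff g) degrees)) g-monic))) (-‿inverseʳ 1#)

  record SquarePart (f : Poly) : Set (c ⊔ ℓ₁) where
    field
      root core       : Poly
      root-monic      : Monic root
      core-squareFree : SquareFree core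
      equation        : root *ₚ root *ₚ core ≈ₚ f

  -- A gcd does the work of prime factorisations. Write `f = x h` and `g = y h` with `x`, `y`
  -- coprime and cancel `h²`, leaving `x² a = y² b`. Then `x²` divides `b` and `y²` divides `a`, so
  -- both cofactors are units and `f`, `g` are monic associates.
  squarePart-unique : ∀ {f g a b} → Monic f → Monic g → SquareFree a → SquareFree b →
                      f *ₚ f *ₚ a ≈ₚ g *ₚ g *ₚ b → f ≈ₚ g × a ≈ₚ b
  squarePart-unique {f} {g} {a} {b} f-monic g-monic a-sf b-sf f²a≈g²b = f≈g , a≈b
    where
    open SetoidReasoning A.setoid
    bez : Bezout f g
    bez = bezout (length g) f g (bounded-length g)
    open Bezout bez renaming (gcd to h; a to x; b to y)
    f≉0 : ¬ (f ≈ₚ 0ₚ)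
    f≉0 = monic⇒nonzero {f} f-monic
    h≉0 : ¬ (h ≈ₚ 0ₚ)
    h≉0 h≈0 = f≉0 (A.trans (A.sym x-factor) (A.trans (A.*-congˡ {x} h≈0) (A.zeroʳ x)))
    coprime : u *ₚ x +ₚ v *ₚ y ≈ₚ 1ₚ
    coprime = *ₚ-cancelˡ h h≉0 (begin
      h *ₚ (u *ₚ x +ₚ v *ₚ y)             ≈⟨ A.*-comm h _ ⟩
      (u *ₚ x +ₚ v *ₚ y) *ₚ h             ≈⟨ A.distribʳ h (u *ₚ x) (v *ₚ y) ⟩
      u *ₚ x *ₚ h +ₚ v *ₚ y *ₚ h          ≈⟨ A.+-cong (A.*-assoc u x h) (A.*-assoc v y h) ⟩
      u *ₚ (x *ₚ h) +ₚ v *ₚ (y *ₚ h)      ≈⟨ A.+-cong (A.*-congˡ {u} x-factor) (A.*-congˡ {v} y-factor) ⟩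
      u *ₚ f +ₚ v *ₚ g                    ≈⟨ combination ⟩
      h                                   ≈⟨ A.sym (A.*-identityʳ h) ⟩
      h *ₚ 1ₚ                             ∎)
    pull : ∀ z p t → z *ₚ h ≈ₚ p → h *ₚ h *ₚ (z *ₚ z *ₚ t) ≈ₚ p *ₚ p *ₚ t
    pull z p t zh≈p = A.trans (A.*-comm (h *ₚ h) _) (A.trans (A.sym (product-of-squares h z t))
      (A.*-congʳ {t} (A.*-cong hz≈p hz≈p)))
      where
      hz≈p : h *ₚ z ≈ₚ p
      hz≈p = A.trans (A.*-comm h z) zh≈p
    x²a≈y²b : x *ₚ x *ₚ a ≈ₚ y *ₚ y *ₚ b
    x²a≈y²b = *ₚ-cancelˡ (h *ₚ h) (*ₚ-nonzero {h} h≉0 h≉0)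
      (A.trans (pull x f a x-factor) (A.trans f²a≈g²b (A.sym (pull y g b y-factor))))
    x-unit : x ∣ 1ₚ
    x-unit = let (k , kx²≈b) = coprime-squares {x} {y} {u} {v} {b} {a} coprime x²a≈y²b in b-sf {x} (k , kx²≈b)
    y-unit : y ∣ 1ₚ
    y-unit = let (k , ky²≈a) = coprime-squares {y} {x} {v} {u} {a} {b}
                   (A.trans (A.+-comm (v *ₚ y) (u *ₚ x)) coprime) (A.sym x²a≈y²b)
             in a-sf {y} (k , ky²≈a)
    divides-by-unit : ∀ {x y p r} → x ∣ 1ₚ → x *ₚ h ≈ₚ p → y *ₚ h ≈ₚ r → p ∣ r
    divides-by-unit {x} {y} (w , wx≈1) xh≈p yh≈r = y *ₚ w , unit-multiple {x} {y} {h} wx≈1 xh≈p yh≈r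
    f≈g : f ≈ₚ g
    f≈g = monic-associates {f} {g} f-monic g-monic
      (divides-by-unit {x} {y} x-unit x-factor y-factor) (divides-by-unit {y} {x} y-unit y-factor x-factor)
    a≈b : a ≈ₚ b
    a≈b = *ₚ-cancelˡ (f *ₚ f) (*ₚ-nonzero {f} f≉0 f≉0)
      (A.trans f²a≈g²b (A.*-congʳ {b} (A.sym (A.*-cong f≈g f≈g))))

  -- A refutation of `SquareFree` exhibits no factor. Searching the finite lists of monics returns
  -- one; the index `suc k` keeps the degree positive, so that the factor is not a unit.
  repeatedFactor? : ∀ f → Dec (Any (λ k → Any (λ g → g *ₚ g ∣ f) (coset (suc k) 1ₚ)) (upTo (length f)))
  repeatedFactor? f = Any.any? (λ k → Any.any? (λ g → g *ₚ g ∣? f) (coset (suc k) 1ₚ)) (upTo (length f))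

  monic-repeatedFactor : ∀ {f g} → ¬ (f ≈ₚ 0ₚ) → ∀ k → deg g ≡ suc k → g *ₚ g ∣ f →
                         Any (λ g → g *ₚ g ∣ f) (coset (suc k) 1ₚ)
  monic-repeatedFactor {f} {g} f≉0 k deg≡1+k (h , hg²≈f) = go (normalise {g} g≉0)
    where
    g≉0 : ¬ (g ≈ₚ 0ₚ)
    g≉0 g≈0 = ℕ.0≢1+n (≡.trans (≡.sym (deg-zero g g≈0)) deg≡1+k)
    go : ∃[ u ] (Monic ([ u ] *ₚ g) × deg ([ u ] *ₚ g) ≡ deg g × [ u ] ∣ 1ₚ) →
         Any (λ g → g *ₚ g ∣ f) (coset (suc k) 1ₚ)
    go (u , monic , degree , v , vu≈1) = Any.map multiple
      (coset-complete (suc k) 1ₚ ([ u ] *ₚ g) (monic⇒inCoset ([ u ] *ₚ g) monic (≡.trans degree deg≡1+k)))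
      where
      multiple : ∀ {x} → x ≈ₚ [ u ] *ₚ g → x *ₚ x ∣ f
      multiple {x} x≈ug = h *ₚ (v *ₚ v) , A.trans (A.*-congˡ {h *ₚ (v *ₚ v)} (A.*-cong x≈ug x≈ug))
        (square-multiple-scale {h} {g} {f} {[ u ]} {v} vu≈1 hg²≈f)

  squareFactor : ∀ f → ¬ (f ≈ₚ 0ₚ) →
                 SquareFree f ⊎ ∃[ g ] (Monic g × 1 ℕ.≤ deg g × g *ₚ g ∣ f)
  squareFactor f f≉0 with repeatedFactor? f
  ... | yes found = inj₂ (extract (Any.satisfied found))
    where
    extract : ∃[ k ] Any (λ g → g *ₚ g ∣ f) (coset (suc k) 1ₚ) →
              ∃[ g ] (Monic g × 1 ℕ.≤ deg g × g *ₚ g ∣ f)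
    extract (k , factor) =
      let (g , g∈ , g²∣f)   = find factor
          (g-monic , deg-g) = inCoset⇒monic g (All.lookup (coset-sound (suc k) 1ₚ) g∈)
      in g , g-monic , ≡.subst (1 ℕ.≤_) (≡.sym deg-g) (s≤s z≤n) , g²∣f
  ... | no ¬found = inj₁ λ {g} g²∣f → unit g g²∣f (deg g) ≡.refl
    where
    unit : ∀ g → g *ₚ g ∣ f → ∀ n → deg g ≡ n → g ∣ 1ₚ
    unit g (k , kg²≈f) zero deg≡0 = deg≡0⇒unit {g} g≉0 deg≡0
      where
      g≉0 : ¬ (g ≈ₚ 0ₚ)
      g≉0 g≈0 = f≉0 (A.trans (A.sym kg²≈f)
        (A.trans (A.*-congˡ {k} (A.trans (A.*-congˡ {g} g≈0) (A.zeroʳ g))) (A.zeroʳ k)))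
    unit g (k , kg²≈f) (suc n) deg≡1+n = ⊥-elim (¬found (lose
      (∈-upTo⁺ (ℕ.<-trans (ℕ.n<1+n n) (≡.subst (ℕ._< length f) deg≡1+n deg<length)))
      (monic-repeatedFactor {f} {g} f≉0 n deg≡1+n (k , kg²≈f))))
      where
      deg<length : deg g ℕ.< length f
      deg<length = ℕ.≤-<-trans (ℕ.m≤n+m (deg g) (deg (k *ₚ g)))
        (factor-degree (k *ₚ g) g (A.trans (A.*-assoc k g g) kg²≈f) f≉0 (bounded-length f))

  -- Monic square factors are stripped one at a time. Each has positive degree, so the cofactor `h`
  -- meets the smaller bound required by the recursion.
  squarePart : ∀ n f → ¬ (f ≈ₚ 0ₚ) → Bounded n f → SquarePart f
  squarePart zero    f f≉0 f-bnd = ⊥-elim (f≉0 (mk λ i → f-bnd i z≤n))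
  squarePart (suc n) f f≉0 f-bnd with squareFactor f f≉0
  ... | inj₁ f-sf = record
    { root = 1ₚ ; core = f ; root-monic = 1ₚ-monic ; core-squareFree = λ {g} → f-sf {g}
    ; equation = A.trans (A.*-congʳ {f} (A.*-identityˡ 1ₚ)) (A.*-identityˡ f)
    }
  ... | inj₂ (g , g-monic , 1≤deg , h , hg²≈f) = record
    { root = g *ₚ root ; core = core
    ; root-monic = monic-* {g} g-monic root-monic
    ; core-squareFree = λ {g} → core-squareFree {g}
    ; equation = A.trans (product-of-squares g root core) (A.trans (A.*-congʳ {g *ₚ g} equation) hg²≈f)
    }
    where
    g≉0 : ¬ (g ≈ₚ 0ₚ)
    g≉0 = monic⇒nonzero {g} g-monic
    h≉0 : ¬ (h ≈ₚ 0ₚ)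
    h≉0 h≈0 = f≉0 (A.trans (A.sym hg²≈f) (A.trans (A.*-congʳ {g *ₚ g} h≈0) (A.zeroˡ (g *ₚ g))))
    deg-h : suc (deg h) ℕ.≤ n
    deg-h = begin
      suc (deg h)               ≡⟨ ≡.sym (ℕ.+-comm (deg h) 1) ⟩
      deg h ℕ.+ 1               ≤⟨ ℕ.+-monoʳ-≤ (deg h) (ℕ.≤-trans 1≤deg (ℕ.m≤m+n (deg g) (deg g))) ⟩
      deg h ℕ.+ (deg g ℕ.+ deg g) ≡⟨ cong (deg h ℕ.+_) (≡.sym (deg-* {g} g≉0 g≉0)) ⟩
      deg h ℕ.+ deg (g *ₚ g)    ≤⟨ ℕ.s≤s⁻¹ (factor-degree h (g *ₚ g) hg²≈f f≉0 f-bnd) ⟩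
      n                         ∎
      where open ℕ.≤-Reasoning
    open SquarePart (squarePart n h h≉0 (bounded-≤ h deg-h (deg-bounded h)))

-- The residue field modulo P and complete character sums.

module Residues {c ℓ₁ ℓ₂ q} (F : FiniteField c ℓ₁ ℓ₂ q)
  (P : FinitePolynomials.Poly F) (P-monic : FinitePolynomials.Monic F P)
  (P-irreducible : FinitePolynomials.Irreducible F P) where

  open FiniteField F
  open FinitePolynomials F
  open CommutativeRing commutativeRing hiding (isCommutativeRing)
  open Inverse enumeration using (to)
  open FinitePolynomialProperties F
  open SquareParts F using (bezout)
  open Rings R[T] using (Bezout; square-+)
  open Quotient R[T] P
  module K = CommutativeRing ring/

  P≉0 : ¬ (P ≈ₚ 0ₚ)
  P≉0 = monic⇒nonzero {P} P-monic

  ∣⇒≋0 : ∀ {f} → P ∣ f → f ≋ 0ₚ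
  ∣⇒≋0 (k , kP≈f) = multiple⇒≋0 {k = k} kP≈f

  ≋0⇒∣ : ∀ {f} → f ≋ 0ₚ → P ∣ f
  ≋0⇒∣ f≋0 = quotient f≋0 , ≋0⇒multiple f≋0

  -- Irreducibility is applied to `P = b * gcd`. If `b` is a unit, the gcd is an associate of `P`,
  -- so `P` divides `f`; if the gcd is a unit, the Bezout combination provides an inverse of `f`.
  invert : ∀ f → f ≋ 0ₚ ⊎ ∃[ u ] u *ₚ f ≋ 1ₚ
  invert f = cases (Irreducible.split-∣1 P-irreducible (A.sym y-factor))
    where
    open Bezout (bezout (length P) f P (bounded-length P))
    cases : b ∣ 1ₚ ⊎ gcd ∣ 1ₚ → f ≋ 0ₚ ⊎ ∃[ u ] u *ₚ f ≋ 1ₚ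
    cases (inj₁ (w , wb≈1)) = inj₁ (multiple⇒≋0 {k = a *ₚ w} (A.trans
      (A.*-congˡ {a *ₚ w} (A.sym y-factor)) (A.trans (cancel a w b gcd wb≈1) x-factor)))
      where
      cancel : ∀ a w b g → w *ₚ b ≈ₚ 1ₚ → a *ₚ w *ₚ (b *ₚ g) ≈ₚ a *ₚ g
      cancel a w b g wb≈1 = begin
        a *ₚ w *ₚ (b *ₚ g)     ≈⟨ A.*-assoc a w (b *ₚ g) ⟩
        a *ₚ (w *ₚ (b *ₚ g))   ≈⟨ A.*-congˡ {a} (A.sym (A.*-assoc w b g)) ⟩
        a *ₚ (w *ₚ b *ₚ g)     ≈⟨ A.*-congˡ {a} (A.*-congʳ {g} wb≈1) ⟩
        a *ₚ (1ₚ *ₚ g)         ≈⟨ A.*-congˡ {a} (A.*-identityˡ g) ⟩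
        a *ₚ g                 ∎
        where open SetoidReasoning A.setoid
    cases (inj₂ (w , wg≈1)) = inj₂ (w *ₚ u , ≋-sym (mk {quotient = w *ₚ v} (begin
      1ₚ                                 ≈⟨ A.sym wg≈1 ⟩
      w *ₚ gcd                           ≈⟨ A.*-congˡ {w} (A.sym combination) ⟩
      w *ₚ (u *ₚ f +ₚ v *ₚ P)            ≈⟨ A.distribˡ w (u *ₚ f) (v *ₚ P) ⟩
      w *ₚ (u *ₚ f) +ₚ w *ₚ (v *ₚ P)     ≈⟨ A.+-comm (w *ₚ (u *ₚ f)) (w *ₚ (v *ₚ P)) ⟩
      w *ₚ (v *ₚ P) +ₚ w *ₚ (u *ₚ f)     ≈⟨ A.sym (A.+-cong (A.*-assoc w v P) (A.*-assoc w u f)) ⟩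
      w *ₚ v *ₚ P +ₚ w *ₚ u *ₚ f         ∎)))
      where open SetoidReasoning A.setoid

  open DiscreteField ring/ invert

  rem : Poly → Poly
  rem f = proj₁ (proj₂ (divMod P P≉0 f))

  rem-bounded : ∀ f → Bounded (deg P) (rem f)
  rem-bounded f = proj₁ (proj₂ (proj₂ (divMod P P≉0 f)))

  rem-≋ : ∀ f → f ≋ rem f
  rem-≋ f = mk {quotient = proj₁ (divMod P P≉0 f)} (proj₂ (proj₂ (proj₂ (divMod P P≉0 f))))

  bounded-≋⇒≈ : ∀ {f g} → Bounded (deg P) f → Bounded (deg P) g → f ≋ g → f ≈ₚ g
  bounded-≋⇒≈ {f} {g} f-bnd g-bnd f≋g = A-.x∙y⁻¹≈ε⇒x≈y f g
    (small-multiple {P} (quotient f≋g , ≋⇒difference f≋g) (bounded-+ f (-ₚ g) f-bnd (bounded-neg g g-bnd)))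

  rem-unique : ∀ {f r} → Bounded (deg P) r → f ≋ r → rem f ≈ₚ r
  rem-unique {f} r-bnd f≋r = bounded-≋⇒≈ (rem-bounded f) r-bnd (≋-trans (≋-sym (rem-≋ f)) f≋r)

  rem-+ : ∀ f g → rem (f +ₚ g) ≈ₚ rem f +ₚ rem g
  rem-+ f g = rem-unique (bounded-+ (rem f) (rem g) (rem-bounded f) (rem-bounded g))
    (K.+-cong {f} {rem f} {g} {rem g} (rem-≋ f) (rem-≋ g))

  infix 4 _≋?_
  _≋?_ : ∀ f g → Dec (f ≋ g)
  f ≋? g = map′ (λ (k , e) → difference⇒≋ {k = k} e) (λ f≋g → quotient f≋g , ≋⇒difference f≋g) (P ∣? f +ₚ -ₚ g)

  SquareModulo⇒≋ : ∀ {f} → SquareModulo P f → ∃[ g ] f ≋ g *ₚ g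
  SquareModulo⇒≋ (g , k , e) = g , difference⇒≋ {k = k} e

  ≋⇒SquareModulo : ∀ {f} g → f ≋ g *ₚ g → SquareModulo P f
  ≋⇒SquareModulo g f≋g² = g , quotient f≋g² , ≋⇒difference f≋g²

  -- `χ f P` unfolds to `symbol (P ∣? f) (squareModulo? P f)`. Having the two decisions as arguments
  -- permits a case analysis on them.
  symbol : ∀ {a b} {A : Set a} {B : Set b} → Dec A → Dec B → ℤ
  symbol A? B? = if does A? then 0ℤ else if does B? then 1ℤ else -1ℤ

  χ-cong-⇔ : ∀ {f g} → (P ∣ f → P ∣ g) → (P ∣ g → P ∣ f) →
             (SquareModulo P f → SquareModulo P g) → (SquareModulo P g → SquareModulo P f) → χ f P ≡ χ g P
  χ-cong-⇔ {f} {g} to∣ from∣ to□ from□ = cong₂ (λ a b → if a then 0ℤ else if b then 1ℤ else -1ℤ)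
    (does-⇔ (mk⇔ to∣ from∣) (P ∣? f) (P ∣? g))
    (does-⇔ (mk⇔ to□ from□) (squareModulo? P f) (squareModulo? P g))

  χ-≋ : ∀ {f g} → f ≋ g → χ f P ≡ χ g P
  χ-≋ {f} {g} f≋g = χ-cong-⇔ (∣-resp f≋g) (∣-resp (≋-sym f≋g)) (□-resp f≋g) (□-resp (≋-sym f≋g))
    where
    ∣-resp : ∀ {f g} → f ≋ g → P ∣ f → P ∣ g
    ∣-resp f≋g P∣f = ≋0⇒∣ (≋-trans (≋-sym f≋g) (∣⇒≋0 P∣f))
    □-resp : ∀ {f g} → f ≋ g → SquareModulo P f → SquareModulo P g
    □-resp f≋g f□ = let (h , f≋h²) = SquareModulo⇒≋ f□ in ≋⇒SquareModulo h (≋-trans (≋-sym f≋g) f≋h²)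

  χ-cong : ∀ {f g} → f ≈ₚ g → χ f P ≡ χ g P
  χ-cong f≈g = χ-≋ (≈⇒≋ f≈g)

  -- Here `f` is invertible modulo `P`, and multiplying or dividing by `f²` preserves both
  -- divisibility by `P` and being a square modulo `P`.
  χ-square-* : ∀ {f g} → ¬ (P ∣ f) → χ (f *ₚ f *ₚ g) P ≡ χ g P
  χ-square-* {f} {g} P∤f = χ-cong-⇔ to∣ from∣ to□ from□
    where
    to∣ : P ∣ f *ₚ f *ₚ g → P ∣ g
    to∣ P∣ = [ (λ f²≋0 → ⊥-elim (P∤f (≋0⇒∣ (square-zero f²≋0)))) , ≋0⇒∣ ]′
      (integral {f *ₚ f} {g} (∣⇒≋0 P∣))
    from∣ : P ∣ g → P ∣ f *ₚ f *ₚ g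
    from∣ (k , kP≈g) = f *ₚ f *ₚ k , A.trans (A.*-assoc (f *ₚ f) k P) (A.*-congˡ {f *ₚ f} kP≈g)
    to□ : SquareModulo P (f *ₚ f *ₚ g) → SquareModulo P g
    to□ □ = [ (λ f≋0 → ⊥-elim (P∤f (≋0⇒∣ f≋0)))
            , (λ (u , uf≋1) → let (h , f²g≋h²) = SquareModulo⇒≋ □ in
                 ≋⇒SquareModulo (u *ₚ h) (square-*⇒square {f} {g} {h} {u} uf≋1 f²g≋h²)) ]′ (invert f)
    from□ : SquareModulo P g → SquareModulo P (f *ₚ f *ₚ g)
    from□ □ = let (h , g≋h²) = SquareModulo⇒≋ □ in ≋⇒SquareModulo (f *ₚ h)
      (≋-trans (K.*-congˡ {f *ₚ f} g≋h²) (≈⇒≋ (interchange f h)))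
      where
      interchange : ∀ f h → f *ₚ f *ₚ (h *ₚ h) ≈ₚ f *ₚ h *ₚ (f *ₚ h)
      interchange f h = begin
        f *ₚ f *ₚ (h *ₚ h)     ≈⟨ A.*-assoc f f (h *ₚ h) ⟩
        f *ₚ (f *ₚ (h *ₚ h))   ≈⟨ A.*-congˡ {f} (A.sym (A.*-assoc f h h)) ⟩
        f *ₚ (f *ₚ h *ₚ h)     ≈⟨ A.*-congˡ {f} (A.*-comm (f *ₚ h) h) ⟩
        f *ₚ (h *ₚ (f *ₚ h))   ≈⟨ A.sym (A.*-assoc f h (f *ₚ h)) ⟩
        f *ₚ h *ₚ (f *ₚ h)     ∎
        where open SetoidReasoning A.setoid

  module OddCharacteristic (2≉0 : ¬ (1# + 1# ≈ 0#)) where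

    -- For any `c`, some translation of the argument adds `c` to `φ`, so all `q` fibres have the
    -- same size. Together they contain `q^(n+1)` polynomials, and `q` can be cancelled.
    ∑-equidistributed : ∀ n (φ : Poly → Carrier) → (∀ {f g} → f ≈ₚ g → φ f ≈ φ g) →
      (∀ c → ∃[ e ] (Bounded (suc n) e × ∀ f → Bounded (suc n) f → φ (f +ₚ e) ≈ φ f + c)) →
      ∀ y → (∑[ f ∈ residues (suc n) ] 𝟙 (φ f ≟ y)) ≡ + (q ℕ.^ n)
    ∑-equidistributed n φ φ-cong translation y = ℤ.*-cancelˡ-≡ (+ q) _ _ {{q≢0}} (begin
      + q ℤ.* count y
        ≡⟨ cong (λ m → + m ℤ.* count y) (≡.sym length-elements) ⟩
      + length elements ℤ.* count y
        ≡⟨ ≡.sym (∑-const elements (count y)) ⟩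
      (∑[ x ∈ elements ] count y)
        ≡⟨ ∑-cong elements (λ x → independent x y) ⟩
      (∑[ x ∈ elements ] count x)
        ≡⟨ ∑-swap elements (residues (suc n)) _ ⟩
      (∑[ f ∈ residues (suc n) ] ∑[ x ∈ elements ] 𝟙 (φ f ≟ x))
        ≡⟨ ∑-cong (residues (suc n)) (λ f → ∑-elements-single (φ f)
                                                                          (λ x x≈ → 𝟙-yes (φ f ≟ x) (sym x≈))
                                                                          (λ x x≉ → 𝟙-no (φ f ≟ x) (x≉ ∘ sym))) ⟩
      (∑[ f ∈ residues (suc n) ] 1ℤ)                                 ≡⟨ ∑-coset-one (suc n) 0ₚ ⟩
      + (q ℕ.^ suc n)                                                ≡⟨ ℤ.pos-* q (q ℕ.^ n) ⟩
      + q ℤ.* + (q ℕ.^ n)                                            ∎)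
      where
      open ≡.≡-Reasoning
      count : Carrier → ℤ
      count x = ∑[ f ∈ residues (suc n) ] 𝟙 (φ f ≟ x)
      q≢0 : ℕ.NonZero q
      q≢0 = Fin.nonZeroIndex (to 0#)
      independent : ∀ x y → count y ≡ count x
      independent x y = let (e , e-bnd , φ-e) = translation (y - x) in begin
        count y
          ≡⟨ ≡.sym (∑-translate {w = λ f → 𝟙 (φ f ≟ y)}
               (λ {f} {g} f≈g → 𝟙-cong (φ f ≟ y) (φ g ≟ y) (trans (sym (φ-cong f≈g))) (trans (φ-cong f≈g))) e e-bnd) ⟩
        (∑[ f ∈ residues (suc n) ] 𝟙 (φ (f +ₚ e) ≟ y))
          ≡⟨ ∑-cong-All (coset-sound (suc n) 0ₚ) (λ f f∈ → 𝟙-cong (φ (f +ₚ e) ≟ y) (φ f ≟ x)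
               (λ φ≈y → x≈ (trans (sym (φ-e f (inCoset⇒bounded {p = f} f∈))) φ≈y))
               (λ φ≈x → trans (φ-e f (inCoset⇒bounded {p = f} f∈)) (trans (+-congʳ φ≈x) x+[y-x]≈y))) ⟩
        count x ∎
        where
        x+[y-x]≈y : x + (y - x) ≈ y
        x+[y-x]≈y = trans (sym (+-assoc x y (- x))) (F-.xyx⁻¹≈y x y)
        x≈ : ∀ {z} → z + (y - x) ≈ y → z ≈ x
        x≈ {z} e = F-.+-cancelʳ (y - x) z x (trans e (sym x+[y-x]≈y))

    double-zero : ∀ {x} → x + x ≈ 0# → x ≈ 0#
    double-zero {x} x+x≈0 with x ≟ 0#
    ... | yes x≈0 = x≈0
    ... | no  x≉0 = ⊥-elim (*-nonzero 2≉0 x≉0 (trans (distribʳ x 1# 1#)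
      (trans (+-cong (*-identityˡ x) (*-identityˡ x)) x+x≈0)))

    double-zeroₚ : ∀ {f} → f +ₚ f ≈ₚ 0ₚ → f ≈ₚ 0ₚ
    double-zeroₚ {f} f+f≈0 = mk λ i → double-zero (trans (sym (coeff-+ f f i)) (at f+f≈0 i))

    -- In the residue field 0 has the single root 0, a nonzero square has exactly the roots `s` and
    -- `- s`, distinct because 2 is nonzero, and any other class has none.
    count-roots : ∀ f → (∑[ r ∈ residues (deg P) ] 𝟙 (f ≋? r *ₚ r)) ≡ 1ℤ ℤ.+ χ f P
    count-roots f = cases (P ∣? f) (squareModulo? P f)
      where
      cases : (P∣? : Dec (P ∣ f)) (□? : Dec (SquareModulo P f)) →
              (∑[ r ∈ residues (deg P) ] 𝟙 (f ≋? r *ₚ r)) ≡ 1ℤ ℤ.+ symbol P∣? □?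
      cases (yes P∣f) □? = ∑-coset-𝟙 (λ r → f ≋? r *ₚ r) 0ₚ (λ _ → refl)
        (λ r _ r≈0 → K.trans {f} {0ₚ} {r *ₚ r} (∣⇒≋0 P∣f) (≋-sym (≈⇒≋ (A.trans (A.*-congˡ {r} r≈0) (A.zeroʳ r)))))
        (λ r r∈ f≋r² → bounded-≋⇒≈ (inCoset⇒bounded {p = r} r∈) (λ _ _ → refl)
          (square-zero (≋-trans (≋-sym f≋r²) (∣⇒≋0 P∣f))))
      cases (no P∤f) (yes □) = begin
        (∑[ r ∈ residues (deg P) ] 𝟙 (f ≋? r *ₚ r))
          ≡⟨ ∑-cong-All (coset-sound (deg P) 0ₚ) pointwise ⟩
        (∑[ r ∈ residues (deg P) ] (𝟙 (r ≟ₚ s) ℤ.+ 𝟙 (r ≟ₚ -ₚ s)))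
          ≡⟨ ∑-+ (residues (deg P)) _ _ ⟩
        (∑[ r ∈ residues (deg P) ] 𝟙 (r ≟ₚ s)) ℤ.+ (∑[ r ∈ residues (deg P) ] 𝟙 (r ≟ₚ -ₚ s))
          ≡⟨ cong₂ ℤ._+_
               (∑-coset-𝟙 (_≟ₚ s) s (bounded⇒inCoset s s-bnd) (λ _ _ e → e) (λ _ _ e → e))
               (∑-coset-𝟙 (_≟ₚ -ₚ s) (-ₚ s) (bounded⇒inCoset (-ₚ s) -s-bnd) (λ _ _ e → e) (λ _ _ e → e)) ⟩
        1ℤ ℤ.+ 1ℤ ∎
        where
        open ≡.≡-Reasoning
        s : Poly
        s = rem (proj₁ (SquareModulo⇒≋ □))
        s-bnd : Bounded (deg P) s
        s-bnd = rem-bounded (proj₁ (SquareModulo⇒≋ □))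
        -s-bnd : Bounded (deg P) (-ₚ s)
        -s-bnd = bounded-neg s s-bnd
        f≋s² : f ≋ s *ₚ s
        f≋s² = ≋-trans (proj₂ (SquareModulo⇒≋ □))
          (K.*-cong (rem-≋ (proj₁ (SquareModulo⇒≋ □))) (rem-≋ (proj₁ (SquareModulo⇒≋ □))))
        s≉-s : ¬ (s ≈ₚ -ₚ s)
        s≉-s s≈-s = P∤f (≋0⇒∣ (≋-trans f≋s² (≈⇒≋ (A.trans (A.*-congˡ {s} s≈0) (A.zeroʳ s)))))
          where
          s≈0 : s ≈ₚ 0ₚ
          s≈0 = double-zeroₚ {s} (A.trans (A.+-congˡ {s} s≈-s) (A.-‿inverseʳ s))
        square-neg : -ₚ s *ₚ -ₚ s ≈ₚ s *ₚ s
        square-neg = A.trans (A.sym (A-.-‿distribˡ-* s (-ₚ s)))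
          (A.trans (A.-‿cong (A.sym (A-.-‿distribʳ-* s s))) (A-.-‿involutive (s *ₚ s)))
        pointwise : ∀ r → InCoset (deg P) 0ₚ r → 𝟙 (f ≋? r *ₚ r) ≡ 𝟙 (r ≟ₚ s) ℤ.+ 𝟙 (r ≟ₚ -ₚ s)
        pointwise r r∈ = split (r ≟ₚ s) (r ≟ₚ -ₚ s)
          where
          split : (a? : Dec (r ≈ₚ s)) (b? : Dec (r ≈ₚ -ₚ s)) → 𝟙 (f ≋? r *ₚ r) ≡ 𝟙 a? ℤ.+ 𝟙 b?
          split (yes r≈s) (yes r≈-s) = ⊥-elim (s≉-s (A.trans (A.sym r≈s) r≈-s))
          split (yes r≈s) (no _)     = 𝟙-yes (f ≋? r *ₚ r)
            (≋-trans f≋s² (≈⇒≋ (A.sym (A.*-cong r≈s r≈s))))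
          split (no _)    (yes r≈-s) = 𝟙-yes (f ≋? r *ₚ r)
            (≋-trans f≋s² (≈⇒≋ (A.sym (A.trans (A.*-cong r≈-s r≈-s) square-neg))))
          split (no r≉s)  (no r≉-s)  = 𝟙-no (f ≋? r *ₚ r) λ f≋r² →
            [ (λ r≋s → r≉s (bounded-≋⇒≈ r-bnd s-bnd r≋s)) , (λ r≋-s → r≉-s (bounded-≋⇒≈ r-bnd -s-bnd r≋-s)) ]′
              (equal-squares {r} {s} (≋-trans (≋-sym f≋r²) f≋s²))
            where
            r-bnd : Bounded (deg P) r
            r-bnd = inCoset⇒bounded {p = r} r∈
      cases (no P∤f) (no ¬□) = ∑-𝟙-none {deg P} {0ₚ} (λ r → f ≋? r *ₚ r) λ r _ f≋r² → ¬□ (≋⇒SquareModulo r f≋r²)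

    ∑-1+χ : ∀ n t → (∑[ f ∈ coset n t ] (1ℤ ℤ.+ χ f P)) ≡
            (∑[ r ∈ residues (deg P) ] ∑[ f ∈ coset n t ] 𝟙 (f ≋? r *ₚ r))
    ∑-1+χ n t = ≡.trans (∑-cong (coset n t) λ f → ≡.sym (count-roots f)) (∑-swap (coset n t) (residues (deg P)) _)

    -- Turns a character sum into a counting problem: the pairs `(r , f)` with `f` congruent to
    -- `r²`, less the number of `f`.
    ∑χ : ∀ n t → (∑[ f ∈ coset n t ] χ f P) ≡
         (∑[ r ∈ residues (deg P) ] ∑[ f ∈ coset n t ] 𝟙 (f ≋? r *ₚ r)) ℤ.- + (q ℕ.^ n)
    ∑χ n t = begin
      X                                 ≡⟨ ≡.sym (ℤ.+-identityʳ X) ⟩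
      X ℤ.+ 0ℤ                          ≡⟨ cong (λ z → X ℤ.+ z) (≡.sym (ℤ.+-inverseʳ N)) ⟩
      X ℤ.+ (N ℤ.- N)                   ≡⟨ ≡.sym (ℤ.+-assoc X N (ℤ.- N)) ⟩
      (X ℤ.+ N) ℤ.- N                   ≡⟨ cong (ℤ._- N) (ℤ.+-comm X N) ⟩
      (N ℤ.+ X) ℤ.- N                   ≡⟨ cong (λ n → (n ℤ.+ X) ℤ.- N) (≡.sym (∑-coset-one n t)) ⟩
      ((∑[ f ∈ coset n t ] 1ℤ) ℤ.+ X) ℤ.- N
        ≡⟨ cong (ℤ._- N) (≡.sym (∑-+ (coset n t) (λ _ → 1ℤ) (λ f → χ f P))) ⟩
      (∑[ f ∈ coset n t ] (1ℤ ℤ.+ χ f P)) ℤ.- N ≡⟨ cong (ℤ._- N) (∑-1+χ n t) ⟩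
      _ ∎
      where
      open ≡.≡-Reasoning
      X N : ℤ
      X = ∑[ f ∈ coset n t ] χ f P
      N = + (q ℕ.^ n)

    -- Each `r²` has exactly one reduced representative, so the number of pairs is the number of
    -- `r`, which equals the term subtracted in `∑χ`.
    ∑χ-residues : (∑[ f ∈ residues (deg P) ] χ f P) ≡ 0ℤ
    ∑χ-residues = ≡.trans (∑χ (deg P) 0ₚ) (≡.trans
      (cong (ℤ._- + (q ℕ.^ deg P)) (≡.trans
        (∑-cong (residues (deg P)) λ r → ∑-coset-𝟙 (_≋? r *ₚ r) (rem (r *ₚ r))
          (bounded⇒inCoset (rem (r *ₚ r)) (rem-bounded (r *ₚ r)))
          (λ f _ f≈ → ≋-trans (≈⇒≋ f≈) (≋-sym (rem-≋ (r *ₚ r))))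
          (λ f f∈ f≋ → A.sym (rem-unique (inCoset⇒bounded {p = f} f∈) (≋-sym f≋))))
        (∑-coset-one (deg P) 0ₚ)))
      (ℤ.+-inverseʳ (+ (q ℕ.^ deg P))))

    -- Writing `f = a + T^(deg P) b` and fixing `b`, the residue of `f` is a translate of `a`; it
    -- runs through a complete residue system, over which `χ` sums to zero.
    ∑χ-long : ∀ n t → (∑[ f ∈ coset (deg P ℕ.+ n) t ] χ f P) ≡ 0ℤ
    ∑χ-long n t = begin
      (∑[ f ∈ coset (deg P ℕ.+ n) t ] χ f P)
        ≡⟨ ∑-coset-+ (deg P) χ-cong ⟩
      (∑[ a ∈ residues (deg P) ] ∑[ b ∈ coset n t ] χ (a +ₚ shift (deg P) b) P)
        ≡⟨ ∑-swap (residues (deg P)) (coset n t) _ ⟩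
      (∑[ b ∈ coset n t ] ∑[ a ∈ residues (deg P) ] χ (a +ₚ shift (deg P) b) P)
        ≡⟨ ∑-cong (coset n t) (λ b → ∑-cong (residues (deg P)) λ a →
             χ-≋ {a +ₚ shift (deg P) b} {a +ₚ rem (shift (deg P) b)}
               (K.+-congˡ {a} {shift (deg P) b} {rem (shift (deg P) b)} (rem-≋ (shift (deg P) b)))) ⟩
      (∑[ b ∈ coset n t ] ∑[ a ∈ residues (deg P) ] χ (a +ₚ rem (shift (deg P) b)) P)
        ≡⟨ ∑-cong (coset n t) (λ b → ≡.trans
             (∑-translate {w = λ f → χ f P} χ-cong (rem (shift (deg P) b)) (rem-bounded (shift (deg P) b)))
             ∑χ-residues) ⟩
      (∑[ b ∈ coset n t ] 0ℤ)
        ≡⟨ ∑-zero (coset n t) ⟩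
      0ℤ ∎
      where open ≡.≡-Reasoning

    -- For `m = deg P - 1` this is the linear functional that reads the top coefficient of a
    -- residue; composed with squaring it is the quadratic form of the count.
    leading : ℕ → Poly → Carrier
    leading m f = coeff (rem f) m

    leading-cong : ∀ m {f g} → f ≋ g → leading m f ≈ leading m g
    leading-cong m {f} {g} f≋g = at (rem-unique {f} (rem-bounded g) (≋-trans f≋g (rem-≋ g))) m

    leading-bounded : ∀ m {f} → Bounded (deg P) f → leading m f ≈ coeff f m
    leading-bounded m {f} f-bnd = at (rem-unique {f} {f} f-bnd (≈⇒≋ (A.refl {f}))) m

    leading-+ : ∀ m f g → leading m (f +ₚ g) ≈ leading m f + leading m g
    leading-+ m f g = trans (at (rem-+ f g) m) (coeff-+ (rem f) (rem g) m)

    -- A monic `f` of degree `deg P - 1` is already reduced, so the only candidate is the remainder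
    -- of `r²`. That remainder lies in the coset exactly when its coefficient at `m` is 1.
    ∑-square-roots-of-monics : ∀ m → deg P ≡ suc m → ∀ r →
      (∑[ f ∈ coset m 1ₚ ] 𝟙 (f ≋? r *ₚ r)) ≡ 𝟙 (leading m (r *ₚ r) ≟ 1#)
    ∑-square-roots-of-monics m d≡ r = cases (leading m (r *ₚ r) ≟ 1#)
      where
      s : Poly
      s = rem (r *ₚ r)
      s-bnd : Bounded (suc m) s
      s-bnd = ≡.subst (λ d → Bounded d s) d≡ (rem-bounded (r *ₚ r))
      bounded : ∀ f → InCoset m 1ₚ f → Bounded (deg P) f
      bounded f f∈ = ≡.subst (λ d → Bounded d f)
        (≡.trans (cong suc (proj₂ (inCoset⇒monic f f∈))) (≡.sym d≡)) (deg-bounded f)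
      f≈s : ∀ f → InCoset m 1ₚ f → f ≋ r *ₚ r → f ≈ₚ s
      f≈s f f∈ f≋r² = A.sym (rem-unique (bounded f f∈) (≋-sym f≋r²))
      cases : (lead? : Dec (leading m (r *ₚ r) ≈ 1#)) → (∑[ f ∈ coset m 1ₚ ] 𝟙 (f ≋? r *ₚ r)) ≡ 𝟙 lead?
      cases (yes lead≈1) = ∑-coset-𝟙 {m} {1ₚ} (_≋? r *ₚ r) s
        (λ { zero    → trans (reflexive (cong (coeff s) (ℕ.+-identityʳ m))) lead≈1
           ; (suc i) → s-bnd (m ℕ.+ suc i) (ℕ.≤-trans (s≤s (ℕ.m≤m+n m i)) (ℕ.≤-reflexive (≡.sym (ℕ.+-suc m i)))) })
        (λ f _ f≈s → ≋-trans (≈⇒≋ f≈s) (≋-sym (rem-≋ (r *ₚ r))))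
        f≈s
      cases (no lead≉1) = ∑-𝟙-none {m} {1ₚ} (_≋? r *ₚ r) λ f f∈ f≋r² → lead≉1
        (trans (sym (at (f≈s f f∈ f≋r²) m))
          (trans (reflexive (cong (coeff f) (≡.sym (ℕ.+-identityʳ m)))) (f∈ 0)))

    -- The quadratic form for deg P = 2g and the sum over monics of degree 2g - 1.

    module EvenDegree (h : ℕ) (d≡ : deg P ≡ suc (suc h ℕ.+ h)) where

      g : ℕ
      g = suc h

      -- The index `g + h` is 2g - 1. The square has degree at most 2g - 2, so it needs no reduction
      -- modulo `P`, and these `a` form an isotropic subspace.
      bounded-square : ∀ {a} → Bounded g a → leading (g ℕ.+ h) (a *ₚ a) ≈ 0#
      bounded-square {a} a-bnd = trans (leading-bounded (g ℕ.+ h) {a *ₚ a} (λ i d≤i → a²-bnd i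
          (ℕ.≤-trans (ℕ.n≤1+n _) (≡.subst (ℕ._≤ i) d≡ d≤i)))) (a²-bnd (g ℕ.+ h) ℕ.≤-refl)
        where
        a²-bnd : Bounded (g ℕ.+ h) (a *ₚ a)
        a²-bnd = bounded-* {g} {h} a a a-bnd a-bnd

      -- The coefficient of T^(d-1) of the square of a + T^g b is affine in a, with
      -- nonzero linear part: T^(g-1-deg b) pairs with T^g b in degree exactly d - 1.
      square-translation : ∀ {b} → ¬ (b ≈ₚ 0ₚ) → Bounded g b → ∀ c →
        ∃[ e ] (Bounded g e × ∀ a → Bounded g a →
          leading (g ℕ.+ h) ((a +ₚ e +ₚ shift g b) *ₚ (a +ₚ e +ₚ shift g b)) ≈
          leading (g ℕ.+ h) ((a +ₚ shift g b) *ₚ (a +ₚ shift g b)) + c)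
      square-translation {b} b≉0 b-bnd c = e , e-bnd , increment
        where
        j k : ℕ
        j = deg b
        k = h ℕ.∸ j
        j≤h : j ℕ.≤ h
        j≤h = ℕ.≮⇒≥ λ h<j → lead-nonzero {b} b≉0 (b-bnd j h<j)
        slope : Carrier
        slope = lead b + lead b
        slope-inverse : ∃[ u ] u * slope ≈ 1#
        slope-inverse = inverse (lead-nonzero {b} b≉0 ∘ double-zero)
        x : Carrier
        -- The increment will have top coefficient `x * slope`, with `slope` invertible because 2
        -- and the leading coefficient of `b` are nonzero; hence `x` is `c` divided by `slope`.
        x = c * proj₁ slope-inverse
        e : Poly
        e = shift k [ x ]
        e-bnd′ : Bounded (suc k) e
        e-bnd′ i k<i = trans (reflexive (≡.trans
          (cong (coeff e) (≡.sym (≡.trans (ℕ.+-suc k _) (ℕ.m+[n∸m]≡n k<i)))) (coeff-shift k [ x ] (suc (i ℕ.∸ suc k))))) refl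
        e-bnd : Bounded g e
        e-bnd = bounded-≤ e (s≤s (ℕ.m∸n≤m h j)) e-bnd′
        β : Poly
        β = shift g b
        coeff-β : ∀ i → coeff β (g ℕ.+ i) ≡ coeff b i
        coeff-β = coeff-shift g b
        module _ (a : Poly) (a-bnd : Bounded g a) where
          v : Poly
          -- The cofactor of `e` in the increment of the square. Both `a` and `e` stay below degree
          -- `g`, so from there on only twice `b` is visible, independently of `a`.
          v = e +ₚ ((a +ₚ β) +ₚ (a +ₚ β))
          coeff-a+β : ∀ i → coeff (a +ₚ β) (g ℕ.+ i) ≈ coeff b i
          coeff-a+β i = trans (coeff-+ a β (g ℕ.+ i)) (trans
            (+-cong (a-bnd (g ℕ.+ i) (ℕ.m≤m+n g i)) (reflexive (coeff-β i))) (+-identityˡ _))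
          coeff-v : ∀ i → coeff v (g ℕ.+ i) ≈ coeff b i + coeff b i
          coeff-v i = trans (coeff-+ e ((a +ₚ β) +ₚ (a +ₚ β)) (g ℕ.+ i)) (trans
            (+-cong (e-bnd (g ℕ.+ i) (ℕ.m≤m+n g i)) (trans (coeff-+ (a +ₚ β) (a +ₚ β) (g ℕ.+ i))
              (+-cong (coeff-a+β i) (coeff-a+β i)))) (+-identityˡ _))
          v-bnd : Bounded (suc (g ℕ.+ j)) v
          v-bnd i g+j<i = trans (reflexive (cong (coeff v) (≡.sym i≡))) (trans (coeff-v l)
            (trans (+-cong b-zero b-zero) (+-identityˡ 0#)))
            where
            l : ℕ
            l = i ℕ.∸ g
            i≡ : g ℕ.+ l ≡ i
            i≡ = ℕ.m+[n∸m]≡n (ℕ.≤-trans (ℕ.m≤m+n g j) (ℕ.<⇒≤ g+j<i))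
            b-zero : coeff b l ≈ 0#
            b-zero = deg-bounded b l (ℕ.+-cancelˡ-< g j l (≡.subst (g ℕ.+ j ℕ.<_) (≡.sym i≡) g+j<i))
          k+[g+j]≡g+h : k ℕ.+ (g ℕ.+ j) ≡ g ℕ.+ h
          k+[g+j]≡g+h = ≡.trans (ℕ.+-comm k (g ℕ.+ j)) (≡.trans (ℕ.+-assoc g j k) (cong (g ℕ.+_) (ℕ.m+[n∸m]≡n j≤h)))
          -- The square of `a +ₚ β` may require reduction modulo `P`, but the increment `e *ₚ v` has
          -- degree at most 2g - 1. By additivity of `leading` this is all that matters.
          ev-bnd : Bounded (deg P) (e *ₚ v)
          ev-bnd = ≡.subst (λ d → Bounded d (e *ₚ v)) (≡.trans (cong suc k+[g+j]≡g+h) (≡.sym d≡))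
            (bounded-* e v e-bnd′ v-bnd)
          coeff-ev : coeff (e *ₚ v) (g ℕ.+ h) ≈ c
          coeff-ev = begin
            coeff (e *ₚ v) (g ℕ.+ h)           ≡⟨ cong (coeff (e *ₚ v)) (≡.sym k+[g+j]≡g+h) ⟩
            coeff (e *ₚ v) (k ℕ.+ (g ℕ.+ j))   ≈⟨ coeff-shift-* k x v (g ℕ.+ j) ⟩
            x * coeff v (g ℕ.+ j)              ≈⟨ *-congˡ (coeff-v j) ⟩
            c * proj₁ slope-inverse * slope    ≈⟨ *-assoc c _ slope ⟩
            c * (proj₁ slope-inverse * slope)  ≈⟨ *-congˡ (proj₂ slope-inverse) ⟩
            c * 1#                             ≈⟨ *-identityʳ c ⟩
            c                                  ∎
            where open SetoidReasoning setoid
          reorder : a +ₚ e +ₚ β ≈ₚ a +ₚ β +ₚ e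
          reorder = A.trans (A.+-assoc a e β) (A.trans (A.+-congˡ {a} (A.+-comm e β)) (A.sym (A.+-assoc a β e)))
          increment : leading (g ℕ.+ h) ((a +ₚ e +ₚ β) *ₚ (a +ₚ e +ₚ β)) ≈
                      leading (g ℕ.+ h) ((a +ₚ β) *ₚ (a +ₚ β)) + c
          increment = trans
            (leading-cong (g ℕ.+ h) {(a +ₚ e +ₚ β) *ₚ (a +ₚ e +ₚ β)} {(a +ₚ β) *ₚ (a +ₚ β) +ₚ e *ₚ v}
              (≈⇒≋ (A.trans (A.*-cong reorder reorder) (square-+ (a +ₚ β) e))))
            (trans (leading-+ (g ℕ.+ h) ((a +ₚ β) *ₚ (a +ₚ β)) (e *ₚ v))
              (+-congˡ (trans (leading-bounded (g ℕ.+ h) {e *ₚ v} ev-bnd) coeff-ev)))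

      count-leading : ∀ b → Bounded g b →
        (∑[ a ∈ residues g ] 𝟙 (leading (g ℕ.+ h) ((a +ₚ shift g b) *ₚ (a +ₚ shift g b)) ≟ 1#)) ≡
        𝟙 (¬? (b ≟ₚ 0ₚ)) ℤ.* + (q ℕ.^ h)
      count-leading b b-bnd = cases (b ≟ₚ 0ₚ)
        where
        cases : (b≟0 : Dec (b ≈ₚ 0ₚ)) →
          (∑[ a ∈ residues g ] 𝟙 (leading (g ℕ.+ h) ((a +ₚ shift g b) *ₚ (a +ₚ shift g b)) ≟ 1#)) ≡
          𝟙 (¬? b≟0) ℤ.* + (q ℕ.^ h)
        cases (yes b≈0) = ≡.trans (∑-𝟙-none {g} {0ₚ}
            (λ a → leading (g ℕ.+ h) ((a +ₚ shift g b) *ₚ (a +ₚ shift g b)) ≟ 1#) λ a a∈ lead≈1 → 1≉0 (trans (sym lead≈1)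
            (trans (leading-cong (g ℕ.+ h) (≈⇒≋ (A.*-cong (a+β≈a a) (a+β≈a a))))
              (bounded-square {a} (inCoset⇒bounded {p = a} a∈))))) (≡.sym (ℤ.*-zeroˡ (+ (q ℕ.^ h))))
          where
          shift-zero : ∀ n → shift n 0ₚ ≈ₚ 0ₚ
          shift-zero zero    = A.refl
          shift-zero (suc n) = zero-∷ refl (shift-zero n)
          a+β≈a : ∀ a → a +ₚ shift g b ≈ₚ a
          a+β≈a a = A.trans (A.+-congˡ {a} (A.trans (shift-cong g b≈0) (shift-zero g))) (A.+-identityʳ a)
        cases (no b≉0) = ≡.trans
          (∑-equidistributed h (λ a → leading (g ℕ.+ h) ((a +ₚ shift g b) *ₚ (a +ₚ shift g b)))
            (λ a≈a′ → leading-cong (g ℕ.+ h) (≈⇒≋ (A.*-cong (A.+-congʳ {shift g b} a≈a′) (A.+-congʳ {shift g b} a≈a′))))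
            (square-translation {b} b≉0 b-bnd) 1#)
          (≡.sym (ℤ.*-identityˡ (+ (q ℕ.^ h))))

      -- Each of the `q^g` cosets would have to contribute `q^h` to match the number `q^(g+h)` of
      -- monics. All do except `b = 0`, which contributes nothing, and its missing `q^h` is the
      -- value of the sum.
      ∑χ-below : (∑[ f ∈ coset (g ℕ.+ h) 1ₚ ] χ f P) ≡ ℤ.- + (q ℕ.^ h)
      ∑χ-below = begin
        (∑[ f ∈ coset (g ℕ.+ h) 1ₚ ] χ f P)
          ≡⟨ ∑χ (g ℕ.+ h) 1ₚ ⟩
        (∑[ r ∈ residues (deg P) ] ∑[ f ∈ coset (g ℕ.+ h) 1ₚ ] 𝟙 (f ≋? r *ₚ r)) ℤ.- + (q ℕ.^ (g ℕ.+ h))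
          ≡⟨ cong (ℤ._- + (q ℕ.^ (g ℕ.+ h))) (begin
               (∑[ r ∈ residues (deg P) ] ∑[ f ∈ coset (g ℕ.+ h) 1ₚ ] 𝟙 (f ≋? r *ₚ r))
                 ≡⟨ ∑-cong (residues (deg P)) (∑-square-roots-of-monics (g ℕ.+ h) d≡) ⟩
               (∑[ r ∈ residues (deg P) ] W r)
                 ≡⟨ cong (λ d → ∑ (residues d) W) (≡.trans d≡ (≡.sym (ℕ.+-suc g h))) ⟩
               (∑[ r ∈ residues (g ℕ.+ g) ] W r)
                 ≡⟨ ∑-coset-+ g W-cong ⟩
               (∑[ a ∈ residues g ] ∑[ b ∈ residues g ] W (a +ₚ shift g b))
                 ≡⟨ ∑-swap (residues g) (residues g) _ ⟩
               (∑[ b ∈ residues g ] ∑[ a ∈ residues g ] W (a +ₚ shift g b))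
                 ≡⟨ ∑-cong-All (coset-sound g 0ₚ) (λ b b∈ → count-leading b (inCoset⇒bounded {p = b} b∈)) ⟩
               (∑[ b ∈ residues g ] (𝟙 (¬? (b ≟ₚ 0ₚ)) ℤ.* + Q))
                 ≡⟨ ∑-*ʳ (residues g) (+ Q) (λ b → 𝟙 (¬? (b ≟ₚ 0ₚ))) ⟩
               (∑[ b ∈ residues g ] 𝟙 (¬? (b ≟ₚ 0ₚ))) ℤ.* + Q
                 ≡⟨ cong (ℤ._* + Q) nonzero ⟩
               (+ (q ℕ.^ g) ℤ.- 1ℤ) ℤ.* + Q
                 ≡⟨ ℤ.*-distribʳ-+ (+ Q) (+ (q ℕ.^ g)) -1ℤ ⟩
               + (q ℕ.^ g) ℤ.* + Q ℤ.+ -1ℤ ℤ.* + Q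
                 ≡⟨ cong₂ ℤ._+_ (≡.trans (≡.sym (ℤ.pos-* (q ℕ.^ g) Q)) (cong +_ (≡.sym (ℕ.^-distribˡ-+-* q g h)))) (ℤ.-1*i≡-i (+ Q)) ⟩
               + (q ℕ.^ (g ℕ.+ h)) ℤ.- + Q ∎) ⟩
        (+ (q ℕ.^ (g ℕ.+ h)) ℤ.- + Q) ℤ.- + (q ℕ.^ (g ℕ.+ h))
          ≡⟨ ℤ-.xyx⁻¹≈y (+ (q ℕ.^ (g ℕ.+ h))) (ℤ.- + Q) ⟩
        ℤ.- + Q ∎
        where
        open ≡.≡-Reasoning
        Q : ℕ
        Q = q ℕ.^ h
        W : Poly → ℤ
        W r = 𝟙 (leading (g ℕ.+ h) (r *ₚ r) ≟ 1#)
        W-cong : ∀ {r s} → r ≈ₚ s → W r ≡ W s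
        W-cong {r} {s} r≈s = 𝟙-cong (leading (g ℕ.+ h) (r *ₚ r) ≟ 1#) (leading (g ℕ.+ h) (s *ₚ s) ≟ 1#)
          (trans (sym e)) (trans e)
          where
          e : leading (g ℕ.+ h) (r *ₚ r) ≈ leading (g ℕ.+ h) (s *ₚ s)
          e = leading-cong (g ℕ.+ h) (≈⇒≋ (A.*-cong r≈s r≈s))
        nonzero : (∑[ b ∈ residues g ] 𝟙 (¬? (b ≟ₚ 0ₚ))) ≡ + (q ℕ.^ g) ℤ.- 1ℤ
        nonzero = begin
          N                                   ≡⟨ ≡.sym (ℤ-.xyx⁻¹≈y 1ℤ N) ⟩
          (1ℤ ℤ.+ N) ℤ.- 1ℤ
            ≡⟨ cong (λ z → (z ℤ.+ N) ℤ.- 1ℤ) (≡.sym (∑-coset-𝟙 {g} {0ₚ} (_≟ₚ 0ₚ) 0ₚ (λ _ → refl) (λ _ _ x → x) (λ _ _ x → x))) ⟩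
          (Z ℤ.+ N) ℤ.- 1ℤ
            ≡⟨ cong (ℤ._- 1ℤ) (≡.sym (∑-+ (residues g) (λ b → 𝟙 (b ≟ₚ 0ₚ)) (λ b → 𝟙 (¬? (b ≟ₚ 0ₚ))))) ⟩
          (∑[ b ∈ residues g ] (𝟙 (b ≟ₚ 0ₚ) ℤ.+ 𝟙 (¬? (b ≟ₚ 0ₚ)))) ℤ.- 1ℤ
                                              ≡⟨ cong (ℤ._- 1ℤ) (∑-cong (residues g) λ b → 𝟙+𝟙-¬ (b ≟ₚ 0ₚ)) ⟩
          (∑[ b ∈ residues g ] 1ℤ) ℤ.- 1ℤ     ≡⟨ cong (ℤ._- 1ℤ) (∑-coset-one g 0ₚ) ⟩
          + (q ℕ.^ g) ℤ.- 1ℤ                  ∎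
          where
          Z N : ℤ
          Z = ∑[ b ∈ residues g ] 𝟙 (b ≟ₚ 0ₚ)
          N = ∑[ b ∈ residues g ] 𝟙 (¬? (b ≟ₚ 0ₚ))

-- Sums over square-free monics.

module SquareFreeSums {c ℓ₁ ℓ₂ q} (F : FiniteField c ℓ₁ ℓ₂ q) where

  open FiniteField F
  open CommutativeRing commutativeRing hiding (isCommutativeRing)
  open FinitePolynomials F
  open FinitePolynomialProperties F
  open SquareParts F

  -- The junk value at zero is 1 , 1.
  squareParts : ∀ f → Dec (f ≈ₚ 0ₚ) → Poly × Poly
  squareParts f (yes _)  = 1ₚ , 1ₚ
  squareParts f (no f≉0) = SquarePart.root s , SquarePart.core s
    where
    s : SquarePart f
    s = squarePart (length f) f f≉0 (bounded-length f)

  root core : Poly → Poly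
  root f = proj₁ (squareParts f (zero? f))
  core f = proj₂ (squareParts f (zero? f))

  root-core-spec : ∀ f → ¬ (f ≈ₚ 0ₚ) → Monic (root f) × SquareFree (core f) × root f *ₚ root f *ₚ core f ≈ₚ f
  root-core-spec f f≉0 = spec (zero? f)
    where
    spec : (f≟0 : Dec (f ≈ₚ 0ₚ)) → let r = proj₁ (squareParts f f≟0) ; b = proj₂ (squareParts f f≟0) in
           Monic r × SquareFree b × r *ₚ r *ₚ b ≈ₚ f
    spec (yes f≈0) = ⊥-elim (f≉0 f≈0)
    spec (no f≉0)  = SquarePart.root-monic s , (λ {g} → SquarePart.core-squareFree s {g}) , SquarePart.equation s
      where
      s : SquarePart f
      s = squarePart (length f) f f≉0 (bounded-length f)

  deg-∷ : ∀ a {p} → ¬ (p ≈ₚ 0ₚ) → deg (a ∷ p) ≡ suc (deg p)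
  deg-∷ a {p} p≉0 with zero? p
  ... | yes p≈0 = ⊥-elim (p≉0 p≈0)
  ... | no  _   = ≡.refl

  monic-∷ : ∀ a {p} → Monic p → Monic (a ∷ p)
  monic-∷ a {p} p-monic = trans (reflexive (cong (coeff (a ∷ p)) (deg-∷ a {p} (monic⇒nonzero {p} p-monic)))) p-monic

  monic-drop : ∀ {p} → Monic p → ¬ (deg p ≡ 0) → Monic (drop 1 p) × deg p ≡ suc (deg (drop 1 p))
  monic-drop {[]}    p-monic deg≢0 = ⊥-elim (deg≢0 ≡.refl)
  monic-drop {a ∷ p} p-monic deg≢0 with zero? p
  ... | yes _ = ⊥-elim (deg≢0 ≡.refl)
  ... | no  _ = p-monic , ≡.refl

  deg-square-* : ∀ {f a} → Monic f → Monic a → deg (f *ₚ f *ₚ a) ≡ deg f ℕ.+ deg f ℕ.+ deg a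
  deg-square-* {f} {a} f-monic a-monic = ≡.trans
    (deg-* {f *ₚ f} {a} (*ₚ-nonzero {f} f≉0 f≉0) (monic⇒nonzero {a} a-monic))
    (cong (ℕ._+ deg a) (deg-* {f} f≉0 f≉0))
    where
    f≉0 : ¬ (f ≈ₚ 0ₚ)
    f≉0 = monic⇒nonzero {f} f-monic

  squareFree-cong : ∀ {f g} → f ≈ₚ g → SquareFree f → SquareFree g
  squareFree-cong f≈g f-sf {h} (k , e) = f-sf {h} (k , A.trans e (A.sym f≈g))

  -- The pair (a , f² b) with b square-free, encoded as a ∷ f² b, goes to (a + T f)² b.
  enlarge : Poly → Poly
  enlarge p = let r = coeff p 0 ∷ root (drop 1 p) in r *ₚ r *ₚ core (drop 1 p)

  module Enlarge {n} (p : Poly) (p∈ : InCoset (suc n) 1ₚ p) where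
    e : Poly
    e = drop 1 p
    e-monic×deg : Monic e × deg e ≡ n
    e-monic×deg = inCoset⇒monic e (inCoset-drop {n} {1ₚ} p p∈)
    e≉0 : ¬ (e ≈ₚ 0ₚ)
    e≉0 = monic⇒nonzero {e} (proj₁ e-monic×deg)
    root-monic : Monic (root e)
    root-monic = proj₁ (root-core-spec e e≉0)
    core-sf : SquareFree (core e)
    core-sf {g} = proj₁ (proj₂ (root-core-spec e e≉0)) {g}
    e≈ : root e *ₚ root e *ₚ core e ≈ₚ e
    e≈ = proj₂ (proj₂ (root-core-spec e e≉0))
    core-monic : Monic (core e)
    core-monic = monic-quotient {root e *ₚ root e} {core e} (monic-* {root e} {root e} root-monic root-monic)
      (monic-cong {e} {root e *ₚ root e *ₚ core e} (A.sym e≈) (proj₁ e-monic×deg))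
    r : Poly
    r = coeff p 0 ∷ root e
    r-monic : Monic r
    r-monic = monic-∷ (coeff p 0) {root e} root-monic
    deg-r : deg r ≡ suc (deg (root e))
    deg-r = deg-∷ (coeff p 0) {root e} (monic⇒nonzero {root e} root-monic)
    enlarge-monic : Monic (enlarge p)
    enlarge-monic = monic-* {r *ₚ r} {core e} (monic-* {r} {r} r-monic r-monic) core-monic
    degrees : deg (root e) ℕ.+ deg (root e) ℕ.+ deg (core e) ≡ n
    degrees = ≡.trans (≡.sym (deg-square-* {root e} {core e} root-monic core-monic))
      (≡.trans (≡.sym (deg-cong {e} e≉0 (A.sym e≈))) (proj₂ e-monic×deg))
    degrees′ : deg r ℕ.+ deg r ℕ.+ deg (core e) ≡ suc (suc n)
    degrees′ = begin
      deg r ℕ.+ deg r ℕ.+ deg (core e)             ≡⟨ cong (λ d → d ℕ.+ d ℕ.+ deg (core e)) deg-r ⟩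
      suc (deg (root e) ℕ.+ suc (deg (root e)) ℕ.+ deg (core e))
        ≡⟨ cong (λ d → suc (d ℕ.+ deg (core e))) (ℕ.+-suc (deg (root e)) (deg (root e))) ⟩
      suc (suc (deg (root e) ℕ.+ deg (root e) ℕ.+ deg (core e))) ≡⟨ cong (suc ∘ suc) degrees ⟩
      suc (suc n)                                                ∎
      where open ≡.≡-Reasoning
    enlarge-inCoset : InCoset (suc (suc n)) 1ₚ (enlarge p)
    enlarge-inCoset = monic⇒inCoset (enlarge p) enlarge-monic
      (≡.trans (deg-square-* {r} {core e} r-monic core-monic) degrees′)
    enlarge-not-squareFree : ¬ SquareFree (enlarge p)
    -- `r` has positive degree, being `a + T f`, so it is a non-unit whose square divides the value.
    enlarge-not-squareFree sf = ℕ.0≢1+n (≡.trans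
      (≡.sym (unit⇒deg≡0 {r} (sf {r} (core e , A.*-comm (core e) (r *ₚ r))))) deg-r)

  -- Up to `_≈ₚ_`, `enlarge` is a bijection from the monics of degree n + 1 onto the monics of
  -- degree n + 2 that are not square-free. The preimage of `f = s² b` with `s = a + T t` is
  -- `a ∷ t² b`; uniqueness of square parts confirms it in both directions.
  count-enlarge : ∀ n f → InCoset (suc (suc n)) 1ₚ f →
    (∑[ p ∈ coset (suc n) 1ₚ ] 𝟙 (f ≟ₚ enlarge p)) ≡ 𝟙 (¬? (squareFree? f))
  count-enlarge n f f∈ = cases (squareFree? f)
    where
    cases : (sf? : Dec (SquareFree f)) → (∑[ p ∈ coset (suc n) 1ₚ ] 𝟙 (f ≟ₚ enlarge p)) ≡ 𝟙 (¬? sf?)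
    cases (yes f-sf) = ∑-𝟙-none {suc n} {1ₚ} (λ p → f ≟ₚ enlarge p) λ p p∈ f≈ →
      Enlarge.enlarge-not-squareFree p p∈ λ {g} → squareFree-cong f≈ f-sf {g}
    cases (no ¬f-sf) = ∑-coset-𝟙 {suc n} {1ₚ} (λ p → f ≟ₚ enlarge p) p₀ p₀∈ complete sound
      where
      f-monic×deg : Monic f × deg f ≡ suc (suc n)
      f-monic×deg = inCoset⇒monic f f∈
      f≉0 : ¬ (f ≈ₚ 0ₚ)
      f≉0 = monic⇒nonzero {f} (proj₁ f-monic×deg)
      s b : Poly
      s = root f
      b = core f
      s-monic : Monic s
      s-monic = proj₁ (root-core-spec f f≉0)
      b-sf : SquareFree b
      b-sf {g} = proj₁ (proj₂ (root-core-spec f f≉0)) {g}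
      f≈ : s *ₚ s *ₚ b ≈ₚ f
      f≈ = proj₂ (proj₂ (root-core-spec f f≉0))
      b-monic : Monic b
      b-monic = monic-quotient {s *ₚ s} {b} (monic-* {s} {s} s-monic s-monic)
        (monic-cong {f} {s *ₚ s *ₚ b} (A.sym f≈) (proj₁ f-monic×deg))
      -- A monic root of degree 0 is 1, and then `f` would equal its square-free core.
      deg-s≢0 : ¬ (deg s ≡ 0)
      deg-s≢0 deg≡0 = ¬f-sf (λ {g} → squareFree-cong (A.trans (A.sym s²b≈b) f≈) b-sf {g})
        where
        s≈1 : s ≈ₚ 1ₚ
        s≈1 = monic-unit {s} s-monic deg≡0
        s²b≈b : s *ₚ s *ₚ b ≈ₚ b
        s²b≈b = A.trans (A.*-congʳ {b} (A.trans (A.*-cong s≈1 s≈1) (A.*-identityˡ 1ₚ))) (A.*-identityˡ b)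
      t : Poly
      t = drop 1 s
      t-monic : Monic t
      t-monic = proj₁ (monic-drop {s} s-monic deg-s≢0)
      e₀ p₀ : Poly
      e₀ = t *ₚ t *ₚ b
      p₀ = coeff s 0 ∷ e₀
      e₀-monic : Monic e₀
      e₀-monic = monic-* {t *ₚ t} {b} (monic-* {t} {t} t-monic t-monic) b-monic
      deg-e₀ : deg e₀ ≡ n
      deg-e₀ = ℕ.suc-injective (ℕ.suc-injective (begin
        suc (suc (deg e₀))
          ≡⟨ cong (suc ∘ suc) (deg-square-* {t} {b} t-monic b-monic) ⟩
        suc (suc (deg t ℕ.+ deg t ℕ.+ deg b))
          ≡⟨ cong (λ d → suc (d ℕ.+ deg b)) (≡.sym (ℕ.+-suc (deg t) (deg t))) ⟩
        suc (deg t) ℕ.+ suc (deg t) ℕ.+ deg b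
          ≡⟨ cong (λ d → d ℕ.+ d ℕ.+ deg b) (≡.sym (proj₂ (monic-drop {s} s-monic deg-s≢0))) ⟩
        deg s ℕ.+ deg s ℕ.+ deg b                   ≡⟨ ≡.sym (deg-square-* {s} {b} s-monic b-monic) ⟩
        deg (s *ₚ s *ₚ b)                           ≡⟨ ≡.sym (deg-cong {f} f≉0 (A.sym f≈)) ⟩
        deg f                                       ≡⟨ proj₂ f-monic×deg ⟩
        suc (suc n)                                 ∎))
        where open ≡.≡-Reasoning
      p₀∈ : InCoset (suc n) 1ₚ p₀
      p₀∈ = monic⇒inCoset e₀ e₀-monic deg-e₀
      complete : ∀ p → InCoset (suc n) 1ₚ p → p ≈ₚ p₀ → f ≈ₚ enlarge p
      complete p p∈ p≈p₀ = A.trans (A.sym f≈) (A.sym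
        (A.*-cong (A.*-cong r≈s r≈s) (proj₂ unique)))
        where
        open Enlarge p p∈
        e≈e₀ : e ≈ₚ e₀
        e≈e₀ = mk λ i → trans (reflexive (coeff-drop p i)) (at p≈p₀ (suc i))
        unique : root e ≈ₚ t × core e ≈ₚ b
        unique = squarePart-unique {root e} {t} {core e} {b} root-monic t-monic
          (λ {g} → core-sf {g}) (λ {g} → b-sf {g}) (A.trans e≈ e≈e₀)
        r≈s : r ≈ₚ s
        r≈s = A.trans (∷-cong (at p≈p₀ 0) (proj₁ unique)) (A.sym (head∷tail s))
      sound : ∀ p → InCoset (suc n) 1ₚ p → f ≈ₚ enlarge p → p ≈ₚ p₀
      sound p p∈ f≈enlarge = A.trans (head∷tail p) (∷-cong (at r≈s 0)
        (A.trans (A.sym e≈) (A.*-cong (A.*-cong root≈t root≈t) (proj₂ unique))))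
        where
        open Enlarge p p∈
        unique : r ≈ₚ s × core e ≈ₚ b
        unique = squarePart-unique {r} {s} {core e} {b} r-monic s-monic
          (λ {g} → core-sf {g}) (λ {g} → b-sf {g}) (A.sym (A.trans f≈ f≈enlarge))
        r≈s : r ≈ₚ s
        r≈s = proj₁ unique
        root≈t : root e ≈ₚ t
        root≈t = mk λ i → trans (at r≈s (suc i)) (reflexive (≡.sym (coeff-drop s i)))

  -- Serves both the constant weight 1 and `χ`. Invariance under a square factor is required only
  -- within the degrees a root can have, because `χ` loses it when `P` divides `f`.
  ∑-squareFree : ∀ n {w} → Respectful w →
    (∀ f a → Monic f → deg f ℕ.+ deg f ℕ.≤ suc (suc n) → w (f *ₚ f *ₚ a) ≡ w a) →
    ∑ (ℋ (suc (suc n))) w ≡ ∑ (coset (suc (suc n)) 1ₚ) w ℤ.- + q ℤ.* ∑ (coset n 1ₚ) w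
  ∑-squareFree n {w} w-resp w-square = begin
    ∑ (ℋ m) w
      ≡⟨ ∑-filter squareFree? (monics m) w ⟩
    (∑[ f ∈ monics m ] (𝟙 (squareFree? f) ℤ.* w f))
      ≡⟨ cong (λ fs → ∑[ f ∈ fs ] (𝟙 (squareFree? f) ℤ.* w f)) (monics≡coset m) ⟩
    S
      ≡⟨ ≡.sym (ℤ-.xyx⁻¹≈y N S) ⟩
    (N ℤ.+ S) ℤ.- N
      ≡⟨ cong₂ ℤ._-_ N+S≡∑ N≡q∑ ⟩
    ∑ (coset m 1ₚ) w ℤ.- + q ℤ.* ∑ (coset n 1ₚ) w ∎
    where
    open ≡.≡-Reasoning
    m : ℕ
    m = suc (suc n)
    S N : ℤ
    S = ∑[ f ∈ coset m 1ₚ ] (𝟙 (squareFree? f) ℤ.* w f)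
    N = ∑[ f ∈ coset m 1ₚ ] (𝟙 (¬? (squareFree? f)) ℤ.* w f)
    N+S≡∑ : N ℤ.+ S ≡ ∑ (coset m 1ₚ) w
    N+S≡∑ = ≡.trans (ℤ.+-comm N S) (≡.trans
      (≡.sym (∑-+ (coset m 1ₚ) (λ f → 𝟙 (squareFree? f) ℤ.* w f) (λ f → 𝟙 (¬? (squareFree? f)) ℤ.* w f)))
      (∑-cong (coset m 1ₚ) λ f → ≡.trans (≡.sym (ℤ.*-distribʳ-+ (w f) (𝟙 (squareFree? f)) (𝟙 (¬? (squareFree? f)))))
        (≡.trans (cong (ℤ._* w f) (𝟙+𝟙-¬ (squareFree? f))) (ℤ.*-identityˡ (w f)))))
    -- `f` and `drop 1 p` have the same square-free core, and `w` sees nothing else of either.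
    weights : ∀ f p → InCoset m 1ₚ f → InCoset (suc n) 1ₚ p → f ≈ₚ enlarge p → w f ≡ w (drop 1 p)
    weights f p f∈ p∈ f≈ = begin
      w f                              ≡⟨ w-resp f≈ ⟩
      w (r *ₚ r *ₚ core e)
        ≡⟨ w-square r (core e) r-monic (ℕ.≤-trans (ℕ.m≤m+n _ (deg (core e))) (ℕ.≤-reflexive degrees′)) ⟩
      w (core e)                       ≡⟨ ≡.sym (w-square (root e) (core e) root-monic
                                            (ℕ.≤-trans (ℕ.m≤m+n _ (deg (core e))) (ℕ.≤-trans (ℕ.≤-reflexive degrees) (ℕ.m≤n+m n 2)))) ⟩
      w (root e *ₚ root e *ₚ core e)   ≡⟨ w-resp e≈ ⟩
      w e                              ∎
      where open Enlarge p p∈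
    N≡q∑ : N ≡ + q ℤ.* ∑ (coset n 1ₚ) w
    N≡q∑ = begin
      N
        ≡⟨ ∑-double-count (λ f p → f ≟ₚ enlarge p) (coset-sound m 1ₚ) (coset-sound (suc n) 1ₚ)
             (count-enlarge n)
             (λ p p∈ → ∑-coset-𝟙 (_≟ₚ enlarge p) (enlarge p) (Enlarge.enlarge-inCoset p p∈) (λ _ _ x → x) (λ _ _ x → x))
             weights ⟩
      (∑[ p ∈ coset (suc n) 1ₚ ] (1ℤ ℤ.* w (drop 1 p)))
        ≡⟨ ∑-cong (coset (suc n) 1ₚ) (λ p → ℤ.*-identityˡ (w (drop 1 p))) ⟩
      (∑[ p ∈ coset (suc n) 1ₚ ] w (drop 1 p))
        -- The weight ignores the constant coefficient of `p`, whose `q` values supply the factor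
        -- `q`.
        ≡⟨ ∑-coset-suc n 1ₚ (λ p → w (drop 1 p)) ⟩
      (∑[ a ∈ elements ] ∑ (coset n 1ₚ) w)
        ≡⟨ ∑-const elements (∑ (coset n 1ₚ) w) ⟩
      + length elements ℤ.* ∑ (coset n 1ₚ) w
        ≡⟨ cong (λ l → + l ℤ.* ∑ (coset n 1ₚ) w) length-elements ⟩
      + q ℤ.* ∑ (coset n 1ₚ) w ∎

-- Size of ℋ, the character sum over it, and the mean value.

two-distinct⇒2≤ : ∀ {n} (i j : Fin n) → i ≢ j → ∃[ p ] n ≡ suc (suc p)
two-distinct⇒2≤ {suc zero}    Fin.zero Fin.zero i≢j = ⊥-elim (i≢j ≡.refl)
two-distinct⇒2≤ {suc (suc n)} _        _        _   = n , ≡.refl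

-- Normalised fractions are divided by a gcd; on unnormalised representatives the claim is a
-- cross-multiplication of natural numbers.
/₀-cancel : ∀ a b → (1ℤ /₀ (suc a ℕ.* suc b)) ℚ.* (+ suc a ℚ./ 1) ≡ 1ℤ /₀ suc b
/₀-cancel a b = ℚ.toℚᵘ-injective (begin
  ℚ.toℚᵘ (ℚ.fromℚᵘ x ℚ.* ℚ.fromℚᵘ y)             ≈⟨ ℚ.toℚᵘ-homo-* (ℚ.fromℚᵘ x) (ℚ.fromℚᵘ y) ⟩
  ℚ.toℚᵘ (ℚ.fromℚᵘ x) ℚᵘ.* ℚ.toℚᵘ (ℚ.fromℚᵘ y)   ≈⟨ ℚᵘ.*-cong (ℚ.toℚᵘ-fromℚᵘ x) (ℚ.toℚᵘ-fromℚᵘ y) ⟩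
  x ℚᵘ.* y                                       ≈⟨ ℚᵘ.*≡* (cong +_ cross) ⟩
  z                                              ≈⟨ ℚᵘ.≃-sym (ℚ.toℚᵘ-fromℚᵘ z) ⟩
  ℚ.toℚᵘ (ℚ.fromℚᵘ z)                            ∎)
  where
  open SetoidReasoning ℚᵘ.≃-setoid
  x y z : ℚᵘ.ℚᵘ
  -- `mkℚᵘ` stores the denominator minus one, and `suc a * suc b` reduces to `suc (b + a * suc b)`.
  x = ℚᵘ.mkℚᵘ 1ℤ (b ℕ.+ a ℕ.* suc b)
  y = ℚᵘ.mkℚᵘ (+ suc a) 0
  z = ℚᵘ.mkℚᵘ 1ℤ b
  cross : (suc a ℕ.+ 0) ℕ.* suc b ≡ suc a ℕ.* suc b ℕ.* 1 ℕ.+ 0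
  cross = ≡.trans (cong (ℕ._* suc b) (ℕ.+-identityʳ (suc a))) (≡.sym (≡.trans (ℕ.+-identityʳ _) (ℕ.*-identityʳ _)))

module _ {c ℓ₁ ℓ₂ q} (F : FiniteField c ℓ₁ ℓ₂ q) where

  open FiniteField F
  open CommutativeRing commutativeRing hiding (isCommutativeRing)
  open Inverse enumeration using (to; from; to-cong; strictlyInverseˡ; strictlyInverseʳ)
  open FinitePolynomials F
  open FinitePolynomialProperties F
  open SquareFreeSums F

  2≤q : ∃[ p ] q ≡ suc (suc p)
  2≤q = two-distinct⇒2≤ (to 1#) (to 0#) λ e → 1≉0
    (trans (sym (strictlyInverseʳ 1#)) (trans (reflexive (cong from e)) (strictlyInverseʳ 0#)))

  -- If 1 + 1 were zero, adding 1 would be an involution of the field without fixed points, and `q`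
  -- would be even.
  odd⇒2≉0 : ¬ (2 ∣ℕ q) → ¬ (1# + 1# ≈ 0#)
  odd⇒2≉0 2∤q 1+1≈0 = 2∤q (fixedPointFree-involution⇒even σ involutive free)
    where
    open SetoidReasoning setoid
    σ : Fin q → Fin q
    σ i = to (from i + 1#)
    involutive : ∀ i → σ (σ i) ≡ i
    involutive i = ≡.trans (to-cong (begin
      from (σ i) + 1#       ≈⟨ +-congʳ (strictlyInverseʳ (from i + 1#)) ⟩
      from i + 1# + 1#      ≈⟨ +-assoc (from i) 1# 1# ⟩
      from i + (1# + 1#)    ≈⟨ +-congˡ 1+1≈0 ⟩
      from i + 0#           ≈⟨ +-identityʳ (from i) ⟩
      from i                ∎)) (strictlyInverseˡ i)
    free : ∀ i → σ i ≢ i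
    free i e = 1≉0 (F-.+-cancelˡ (from i) 1# 0# (begin
      from i + 1#           ≈⟨ sym (strictlyInverseʳ (from i + 1#)) ⟩
      from (σ i)            ≡⟨ cong from e ⟩
      from i                ≈⟨ sym (+-identityʳ (from i)) ⟩
      from i + 0#           ∎))

  length-ℋ : ∀ n → length (ℋ (suc (suc n))) ≡ q ℕ.^ suc n ℕ.* (q ℕ.∸ 1)
  length-ℋ n = ℤ.+-injective (begin
    + length (ℋ (suc (suc n)))
      ≡⟨ ≡.sym (∑-one (ℋ (suc (suc n)))) ⟩
    (∑[ f ∈ ℋ (suc (suc n)) ] 1ℤ)
      ≡⟨ ∑-squareFree n {λ _ → 1ℤ} (λ _ → ≡.refl) (λ _ _ _ _ → ≡.refl) ⟩
    (∑[ f ∈ coset (suc (suc n)) 1ₚ ] 1ℤ) ℤ.- + q ℤ.* (∑[ f ∈ coset n 1ₚ ] 1ℤ)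
      ≡⟨ cong₂ (λ x y → x ℤ.- + q ℤ.* y) (∑-coset-one (suc (suc n)) 1ₚ) (∑-coset-one n 1ₚ) ⟩
    + (q ℕ.* Q) ℤ.- + q ℤ.* + (q ℕ.^ n)
      ≡⟨ cong (λ y → + (q ℕ.* Q) ℤ.- y) (≡.sym (ℤ.pos-* q (q ℕ.^ n))) ⟩
    + (q ℕ.* Q) ℤ.- + Q
      ≡⟨ cong (λ x → + x ℤ.- + Q) qQ≡Q+Q[q-1] ⟩
    + (Q ℕ.+ Q ℕ.* (q ℕ.∸ 1)) ℤ.- + Q
      ≡⟨ ℤ-.xyx⁻¹≈y (+ Q) (+ (Q ℕ.* (q ℕ.∸ 1))) ⟩
    + (Q ℕ.* (q ℕ.∸ 1)) ∎)
    where
    open ≡.≡-Reasoning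
    Q : ℕ
    Q = q ℕ.^ suc n
    qQ≡Q+Q[q-1] : q ℕ.* Q ≡ Q ℕ.+ Q ℕ.* (q ℕ.∸ 1)
    qQ≡Q+Q[q-1] = ≡.trans (cong (ℕ._* Q) (≡.trans (proj₂ 2≤q) (cong (λ k → suc (k ℕ.∸ 1)) (≡.sym (proj₂ 2≤q)))))
      (cong (Q ℕ.+_) (ℕ.*-comm (q ℕ.∸ 1) Q))

  ∑χ-ℋ : ¬ (2 ∣ℕ q) → ∀ h P → Monic P → Irreducible P → deg P ≡ suc (suc h ℕ.+ h) →
         (∑[ D ∈ ℋ (suc (suc (suc h ℕ.+ h))) ] χ D P) ≡ + (q ℕ.^ suc h)
  ∑χ-ℋ 2∤q h P P-monic P-irreducible d≡ = begin
    (∑[ D ∈ ℋ (suc (suc m)) ] χ D P)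
      ≡⟨ ∑-squareFree m χ-cong χ-square ⟩
    (∑[ D ∈ coset (suc (suc m)) 1ₚ ] χ D P) ℤ.- + q ℤ.* (∑[ D ∈ coset m 1ₚ ] χ D P)
      ≡⟨ cong₂ (λ x y → x ℤ.- + q ℤ.* y)
           -- The degree 2g + 1 is `deg P + 1`, so the complete sum vanishes and only
           -- `- q * (- q^h)` remains.
           (≡.trans (cong (λ n → ∑[ D ∈ coset n 1ₚ ] χ D P) (≡.sym (≡.trans (cong (ℕ._+ 1) d≡) (ℕ.+-comm (suc m) 1))))
             (∑χ-long 1 1ₚ))
           ∑χ-below ⟩
    0ℤ ℤ.- + q ℤ.* (ℤ.- + (q ℕ.^ h))
      ≡⟨ ℤ.+-identityˡ _ ⟩
    ℤ.- (+ q ℤ.* (ℤ.- + (q ℕ.^ h)))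
      ≡⟨ cong ℤ.-_ (≡.sym (ℤ.neg-distribʳ-* (+ q) (+ (q ℕ.^ h)))) ⟩
    ℤ.- (ℤ.- (+ q ℤ.* + (q ℕ.^ h)))
      ≡⟨ ℤ.neg-involutive _ ⟩
    + q ℤ.* + (q ℕ.^ h)
      ≡⟨ ≡.sym (ℤ.pos-* q (q ℕ.^ h)) ⟩
    + (q ℕ.^ suc h) ∎
    where
    open ≡.≡-Reasoning
    open Residues F P P-monic P-irreducible
    open OddCharacteristic (odd⇒2≉0 2∤q)
    open EvenDegree h d≡ using (∑χ-below)
    m : ℕ
    m = suc h ℕ.+ h
    χ-square : ∀ f a → Monic f → deg f ℕ.+ deg f ℕ.≤ suc (suc m) → χ (f *ₚ f *ₚ a) P ≡ χ a P
    χ-square f a f-monic 2deg≤ = χ-square-* {f} {a} λ P∣f → ℕ.<⇒≱ small (ℕ.≤-trans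
      (ℕ.+-mono-≤ (deg≥ P∣f) (deg≥ P∣f)) 2deg≤)
      where
      deg≥ : P ∣ f → suc m ℕ.≤ deg f
      deg≥ P∣f = ≡.subst (ℕ._≤ deg f) d≡ (SquareParts.deg-∣ F {P} {f} P∣f (monic⇒nonzero {f} f-monic))
      -- This is 2g + 1 < 4g, valid as g is at least 1: a multiple of `P` is too large to be a root.
      small : suc (suc m) ℕ.< suc m ℕ.+ suc m
      small = s≤s (≡.subst (suc (suc m) ℕ.≤_) (≡.sym (ℕ.+-suc m m)) (s≤s (ℕ.+-monoˡ-≤ m (s≤s z≤n))))

  -- The character sum `q^g` and the square root `q^g` of |P| multiply to `q^(2g)`, the very power
  -- that occurs in `#ℋ = q^(2g) * (q - 1)`.
  M≡ : ¬ (2 ∣ℕ q) → ∀ h P → Monic P → Irreducible P → deg P ≡ 2 ℕ.* suc h → M (suc h) P ≡ 1ℤ /₀ (q ℕ.∸ 1)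
  M≡ 2∤q h P P-monic P-irreducible deg≡ = begin
    M (suc h) P
      ≡⟨ cong₂ (λ l s → (1ℤ /₀ l) ℚ.* (s ℚ./ 1)) length≡ sum≡ ⟩
    (1ℤ /₀ (Q ℕ.* (q ℕ.∸ 1))) ℚ.* (+ Q ℚ./ 1)
      ≡⟨ cancel (q ℕ.∸ 1) Q (cong (ℕ._∸ 1) (proj₂ 2≤q)) Q≢0 ⟩
    1ℤ /₀ (q ℕ.∸ 1) ∎
    where
    open ≡.≡-Reasoning
    g m n Q : ℕ
    g = suc h
    m = g ℕ.+ h
    n = 2 ℕ.* g ℕ.+ 1
    Q = q ℕ.^ suc m
    2g≡ : 2 ℕ.* g ≡ suc m
    2g≡ = ≡.trans (cong (g ℕ.+_) (ℕ.+-identityʳ g)) (ℕ.+-suc g h)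
    n≡ : n ≡ suc (suc m)
    n≡ = ≡.trans (cong (ℕ._+ 1) 2g≡) (ℕ.+-comm (suc m) 1)
    Q≢0 : ℕ.NonZero Q
    Q≢0 = ℕ.m^n≢0 q (suc m) {{≡.subst ℕ.NonZero (≡.sym (proj₂ 2≤q)) _}}
    cancel : ∀ b a {k} → b ≡ suc k → ℕ.NonZero a → (1ℤ /₀ (a ℕ.* b)) ℚ.* (+ a ℚ./ 1) ≡ 1ℤ /₀ b
    cancel (suc k) (suc a) ≡.refl _ = /₀-cancel a k
    length≡ : length (ℋ n) ≡ Q ℕ.* (q ℕ.∸ 1)
    length≡ = ≡.trans (cong (length ∘ ℋ) n≡) (length-ℋ m)
    Q≡square : Q ≡ q ℕ.^ g ℕ.* q ℕ.^ g
    Q≡square = ≡.trans (cong (q ℕ.^_) (≡.sym (ℕ.+-suc g h))) (ℕ.^-distribˡ-+-* q g g)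
    √≡ : √ ∣ P ∣ₚ ≡ q ℕ.^ g
    √≡ = ≡.trans (cong √_ (≡.trans (cong (q ℕ.^_) (≡.trans deg≡ 2g≡)) Q≡square)) (√-square (q ℕ.^ g))
    sum≡ : (∑[ D ∈ ℋ n ] (χ D P ℤ.* + (√ ∣ P ∣ₚ))) ≡ + Q
    sum≡ = begin
      (∑[ D ∈ ℋ n ] (χ D P ℤ.* + (√ ∣ P ∣ₚ)))      ≡⟨ ∑-*ʳ (ℋ n) (+ (√ ∣ P ∣ₚ)) (λ D → χ D P) ⟩
      (∑[ D ∈ ℋ n ] χ D P) ℤ.* + (√ ∣ P ∣ₚ)        ≡⟨ cong₂ (λ k r → (∑[ D ∈ ℋ k ] χ D P) ℤ.* + r) n≡ √≡ ⟩
      (∑[ D ∈ ℋ (suc (suc m)) ] χ D P) ℤ.* + (q ℕ.^ g)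
        ≡⟨ cong (ℤ._* + (q ℕ.^ g)) (∑χ-ℋ 2∤q h P P-monic P-irreducible (≡.trans deg≡ 2g≡)) ⟩
      + (q ℕ.^ g) ℤ.* + (q ℕ.^ g)                  ≡⟨ ≡.sym (ℤ.pos-* (q ℕ.^ g) (q ℕ.^ g)) ⟩
      + (q ℕ.^ g ℕ.* q ℕ.^ g)                      ≡⟨ cong +_ (≡.sym Q≡square) ⟩
      + Q ∎

open import Data.Nat.Base using (_*_; _∸_; _≤_)

theorem1p1 : ∀ {c ℓ₁ ℓ₂} {q : ℕ} (F : FiniteField c ℓ₁ ℓ₂ q) → OddPrimePower q →
    ∀ (g : ℕ) → 1 ≤ g →
    let open FinitePolynomials F in
    ∀ (P : Poly) → Monic P → Irreducible P → deg P ≡ 2 * g →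
    M g P ≡ 1ℤ /₀ (q ∸ 1)
theorem1p1 F (_ , 2∤q) (suc h) _ = M≡ F 2∤q h
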